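{- Let $T$ be a tree with vertices $1,2,\ldots,n$ that is NEB at vertex $n$, let $A\in S^-(T)$, and let $f:\mathbb{R}^{n-1}\to\mathbb{R}^{n-1}$ be the polynomial map associated with $T$ defined in the context. If $A$ has the Duarte property with respect to vertex $n$, then the Jacobian matrix $\operatorname{Jac}(f)|_A$ is nonsingular.
   Context: For a real skew-symmetric matrix $A=[a_{i,j}]$ of order $n$, its graph $G(A)$ has vertex set $\{1,\ldots,n\}$ and edge set $\{\{i,j\}: a_{i,j}\ne 0,\ i<j\}$. $S^-(T)$ is the set of all real skew-symmetric matrices whose graph is $T$. For a vertex $w$ of a tree $T$, $T(w)$ is the forest obtained by deleting $w$; for a neighbor $v$ of $w$, $T_v(w)$ is the connected component of $T(w)$ containing $v$. For $A\in S^-(T)$, $A(w)$ and $A_v(w)$ denote the principal submatrices of $A$ corresponding to $T(w)$ and $T_v(w)$ (rows and columns keep their vertex labels). NEB (nearly even branching; recursive): let $T$ be a tree on $n$ vertices and $w$ a vertex of $T$. If $n=1$, $T$ is NEB at $w$. If $n\ge2$, $T$ is NEB at $w$ if (i) $T(w)$ has exactly one odd component (a connected component with an odd number of vertices) when $n$ is even, and no odd component when $n$ is odd; and (ii) for each neighbor $v$ of $w$ in $T$, $T_v(w)$ is NEB at $v$. Order on $\mathrm{i}\mathbb{R}$: $a\le b$ means $-\mathrm{i}a\le-\mathrm{i}b$ as real numbers. Spectra of real skew-symmetric matrices (contained in $\mathrm{i}\mathbb{R}$) are listed with multiplicity in increasing order; $\{\mu_1,\ldots,\mu_{n-1}\}$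 strictly interlaces $\{\lambda_1,\ldots,\lambda_n\}$ if $\lambda_1<\mu_1<\lambda_2<\cdots<\mu_{n-1}<\lambda_n$. Duarte property (recursive): let $A$ be a matrix whose graph is a tree and $w$ a vertex of $G(A)$. If $G(A)$ has just one vertex, $A$ has the Duarte property with respect to $w$. If $G(A)$ has more than one vertex, $A$ has the Duarte property with respect to $w$ provided the eigenvalues of $A(w)$ strictly interlace those of $A$ and, for each neighbor $v$ of $w$, $A_v(w)$ has the Duarte property with respect to $v$. The map $f$: let the edges of $T$ be $e_k=\{i_k,j_k\}$ with $i_k<j_k$, $k=1,\ldots,n-1$. For $x=(x_1,\ldots,x_{n-1})\in\mathbb{R}^{n-1}$, $M=M(x)$ is the $n\times n$ matrix with $x_k$ in position $(i_k,j_k)$ and $-x_k$ in position $(j_k,i_k)$ for $k=1,\ldots,n-1$, and zeros elsewhere; $N=N(x)$ is the matrix obtained from $M(x)$ by deleting its last row and column. Then $$f(x)=\left(\tfrac{\operatorname{tr}M^2}{4},\tfrac{\operatorname{tr}M^4}{8},\ldots,\tfrac{\operatorname{tr}M^{2m}}{4m},\tfrac{\operatorname{tr}N^2}{4},\tfrac{\operatorname{tr}N^4}{8},\ldots,\tfrac{\operatorname{tr}N^{2(m-1)}}{4(m-1)}\right)\quad\text{if } n=2m,$$ $$f(x)=\left(\tfrac{\operatorname{tr}M^2}{4},\tfrac{\operatorname{tr}M^4}{8},\ldots,\tfrac{\operatorname{tr}M^{2m}}{4m},\tfrac{\operatorname{tr}N^2}{4},\tfrac{\operatorname{tr}N^4}{8},\ldots,\tfrac{\operatorname{tr}N^{2m}}{4m}\right)\quad\text{if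 } n=2m+1.$$ For $A=[a_{i,j}]\in S^-(T)$, $\operatorname{Jac}(f)|_A$ denotes the Jacobian matrix of $f$ evaluated at the point $x_k=a_{i_k,j_k}$, $k=1,\ldots,n-1$. -}

module Defs where

open import Level using (Level; _⊔_) renaming (suc to lsuc)
open import Algebra.Bundles.Raw using (RawRing)
open import Algebra.Core using (Op₁; Op₂)
import Algebra.Definitions.RawMonoid as RawMonoidDefs
import Algebra.Definitions.RawSemiring as RawSemiringDefs
open import Algebra.Structures using (IsCommutativeRing)
open import Data.Bool.Base using (if_then_else_)
open import Data.Fin.Base using (Fin; zero; suc; toℕ; inject₁; fromℕ; punchIn)
  renaming (_<_ to _<ᶠ_)
import Data.Fin.Properties as Finₚ
open import Data.Fin.Subset using (Subset; inside; outside; _∈_; ⊤; ∣_∣; _-_)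
open import Data.Nat.Base as ℕ using (ℕ; zero; suc; ⌊_/2⌋)
open import Data.Nat.Divisibility using () renaming (_∣_ to _divides_)
import Data.Nat.Properties as ℕₚ
open import Data.Product.Base using (_×_; _,_; proj₁; ∃; ∃-syntax)
open import Data.Product using (∃!)
open import Data.Sum.Base using (_⊎_; swap; [_,_]′)
open import Data.Vec.Base using (_∷_)
open import Data.Vec.Functional using (Vector; updateAt)
open import Function.Base using (_∘_)
open import Function.Bundles using (_⇔_)
open import Function.Definitions using (Injective)
open import Relation.Binary.Construct.Closure.ReflexiveTransitive using (Star)
open import Relation.Binary.Core using (Rel)
open import Relation.Binary.Definitions using (Symmetric; Decidable)
open import Relation.Binary.PropositionalEquality.Core using (_≡_; refl)
open import Relation.Binary.Structures using (IsStrictTotalOrder)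
open import Relation.Nullary.Decidable.Core using (does; _×-dec_; _⊎-dec_; ¬?)
open import Relation.Nullary.Negation.Core using (¬_)
open import Relation.Unary using (Pred)

private
  variable
    g : Level
    n m k : ℕ

------------------------------------------------------------------------
-- Graphs on {0, …, n-1} and their induced subgraphs

record Graph (n : ℕ) (g : Level) : Set (lsuc g) where
  field
    Adj    : Rel (Fin n) g
    adj?   : Decidable Adj
    sym    : Symmetric Adj
    irrefl : ∀ {i} → ¬ Adj i i

open Graph public using (Adj)

-- Graphs on the same vertex set with the same edges.
SameEdges : ∀ {g₁ g₂} → Graph n g₁ → Graph n g₂ → Set (g₁ ⊔ g₂)
SameEdges G H = ∀ i j → Adj G i j ⇔ Adj H i j

Cycle : Graph n g → (Fin (3 ℕ.+ k) → Fin n) → Set g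
Cycle {k = k} G c =
  Injective _≡_ _≡_ c
  × (∀ i → Adj G (c (inject₁ i)) (c (suc i)))
  × Adj G (c (fromℕ (2 ℕ.+ k))) (c zero)

record IsTree (G : Graph n g) : Set g where
  field
    connected : ∀ u v → Star (Adj G) u v
    acyclic   : ∀ {k} (c : Fin (3 ℕ.+ k) → Fin n) → ¬ Cycle G c

AdjIn : Graph n g → Subset n → Rel (Fin n) g
AdjIn G S u v = u ∈ S × v ∈ S × Adj G u v

-- C is the vertex set of the component containing v of the subgraph
-- induced on S.
IsComponentAt : Graph n g → Subset n → Fin n → Subset n → Set g
IsComponentAt G S v C =
  v ∈ S × (∀ u → (u ∈ C) ⇔ Star (AdjIn G S) v u)

OddComponent : Graph n g → Subset n → Subset n → Set g
OddComponent G S C =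
  (∃[ v ] IsComponentAt G S v C) × ¬ (2 divides ∣ C ∣)

-- NEB T S w: the subtree of T with vertex set S is NEB at w.  Vertices
-- keep their labels, so all subtrees met in the recursion are subsets of
-- the one vertex set.
data NEB (T : Graph n g) (S : Subset n) (w : Fin n) : Set g where
  single : w ∈ S → ∣ S ∣ ≡ 1 → NEB T S w
  branch : w ∈ S → 2 ℕ.≤ ∣ S ∣ →
           (2 divides ∣ S ∣ → ∃! _≡_ (OddComponent T (S - w))) →
           (¬ (2 divides ∣ S ∣) → ¬ ∃ (OddComponent T (S - w))) →
           (∀ v C → Adj T w v → IsComponentAt T (S - w) v C → NEB T C v) →
           NEB T S w

-- A listing e₁, …, e_m of the edges of T, e_k = {lo k, hi k}.
record EdgeEnumeration (T : Graph n g) (m : ℕ) : Set g where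
  field
    lo hi    : Fin m → Fin n
    lo<hi    : ∀ k → lo k <ᶠ hi k
    isEdge   : ∀ k → Adj T (lo k) (hi k)
    complete : ∀ {i j} → i <ᶠ j → Adj T i j →
               ∃! _≡_ (λ k → lo k ≡ i × hi k ≡ j)

------------------------------------------------------------------------
-- Matrices

-- The increasing enumeration of a subset.
enum : (S : Subset n) → Fin ∣ S ∣ → Fin n
enum (inside  ∷ S) zero    = zero
enum (inside  ∷ S) (suc i) = suc (enum S i)
enum (outside ∷ S) i       = suc (enum S i)

module Matrices {c ℓ} (R : RawRing c ℓ) where
  open RawRing R
  open RawMonoidDefs +-rawMonoid public using (sum)
  open RawMonoidDefs *-rawMonoid public using () renaming (sum to product)
  open RawSemiringDefs rawSemiring using (_^_)

  Matrix : ℕ → Set c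
  Matrix n = Fin n → Fin n → Carrier

  𝟙 : Matrix n
  𝟙 i j = if does (i Finₚ.≟ j) then 1# else 0#

  infixl 7 _⊛_
  _⊛_ : Matrix n → Matrix n → Matrix n
  (A ⊛ B) i j = sum (λ k → A i k * B k j)

  power : Matrix n → ℕ → Matrix n
  power A zero    = 𝟙
  power A (suc p) = A ⊛ power A p

  tr : Matrix n → Carrier
  tr A = sum (λ i → A i i)

  -- Cofactor expansion along the first row.
  det : Matrix n → Carrier
  det {n = zero}  A = 1#
  det {n = suc n} A =
    sum (λ j → ((- 1#) ^ toℕ j) * (A zero j * det (λ i l → A (suc i) (punchIn j l))))

  infix 9 _[_]
  _[_] : Matrix n → (S : Subset n) → Matrix ∣ S ∣
  (A [ S ]) i j = A (enum S i) (enum S j)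

------------------------------------------------------------------------
-- The real numbers

-- Any two Dedekind-complete ordered fields are isomorphic, so a
-- model of these axioms is a copy of ℝ.  The axioms are the classical
-- ones: `compare` in IsStrictTotalOrder decides the order.
record CompleteOrderedField c ℓ₁ ℓ₂ : Set (lsuc (c ⊔ ℓ₁ ⊔ ℓ₂)) where
  infix  9 _⁻¹
  infix  8 -_
  infixl 7 _*_
  infixl 6 _+_
  infix  4 _≈_ _<_ _≤_
  field
    Carrier : Set c
    _≈_     : Rel Carrier ℓ₁
    _<_     : Rel Carrier ℓ₂
    _+_     : Op₂ Carrier
    _*_     : Op₂ Carrier
    -_      : Op₁ Carrier
    _⁻¹     : Op₁ Carrier    -- the value at 0# is unspecified
    0#      : Carrier
    1#      : Carrier

  _≤_ : Rel Carrier (ℓ₁ ⊔ ℓ₂)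
  x ≤ y = x < y ⊎ x ≈ y

  UpperBound : ∀ {p} → Pred Carrier p → Pred Carrier (c ⊔ ℓ₁ ⊔ ℓ₂ ⊔ p)
  UpperBound P b = ∀ x → P x → x ≤ b

  field
    isCommutativeRing  : IsCommutativeRing _≈_ _+_ _*_ -_ 0# 1#
    isStrictTotalOrder : IsStrictTotalOrder _≈_ _<_
    0<1                : 0# < 1#
    +-monoˡ-<          : ∀ {x y} z → x < y → x + z < y + z
    *-pos              : ∀ {x y} → 0# < x → 0# < y → 0# < x * y
    ⁻¹-cong            : ∀ {x y} → x ≈ y → x ⁻¹ ≈ y ⁻¹
    ⁻¹-inverseʳ        : ∀ x → ¬ (x ≈ 0#) → x * x ⁻¹ ≈ 1#
    supremum           : (P : Pred Carrier (c ⊔ ℓ₁ ⊔ ℓ₂)) →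
                         ∃ P → ∃ (UpperBound P) →
                         ∃[ s ] (UpperBound P s × (∀ b → UpperBound P b → s ≤ b))

  rawRing : RawRing c ℓ₁
  rawRing = record
    { _≈_ = _≈_ ; _+_ = _+_ ; _*_ = _*_ ; -_ = -_ ; 0# = 0# ; 1# = 1# }

module OverReals {c ℓ₁ ℓ₂} (ℝ : CompleteOrderedField c ℓ₁ ℓ₂) where
  open CompleteOrderedField ℝ
  open IsStrictTotalOrder isStrictTotalOrder using (_≟_)
  open Matrices rawRing public
  open RawMonoidDefs (RawRing.+-rawMonoid rawRing) using () renaming (_×_ to _·_)

  infixl 6 _−_
  _−_ : Op₂ Carrier
  x − y = x + (- y)

  -- The pair (a , b) is a + bi.
  complexRing : RawRing c ℓ₁
  complexRing = record
    { Carrier = Carrier × Carrier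
    ; _≈_ = λ { (a , b) (a′ , b′) → a ≈ a′ × b ≈ b′ }
    ; _+_ = λ { (a , b) (a′ , b′) → a + a′ , b + b′ }
    ; _*_ = λ { (a , b) (a′ , b′) → a * a′ − b * b′ , a * b′ + b * a′ }
    ; -_  = λ { (a , b) → - a , - b }
    ; 0#  = 0# , 0#
    ; 1#  = 1# , 0#
    }

  module ℂ = RawRing complexRing
  module ℂᴹ = Matrices complexRing

  fromReal : Carrier → ℂ.Carrier
  fromReal t = t , 0#

  i·_ : Carrier → ℂ.Carrier
  i· t = 0# , t

  ----------------------------------------------------------------------
  -- Spectra and the Duarte property

  -- ν lists the eigenvalues of A with algebraic multiplicity, i.e.
  -- det (zI − A) = ∏ₖ (z − νₖ).  Since ℂ is infinite, equality as
  -- functions of z is equality of polynomials.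
  IsSpectrum : Matrix n → Vector ℂ.Carrier n → Set (c ⊔ ℓ₁)
  IsSpectrum A ν =
    ∀ z → ℂᴹ.det (λ i j → z ℂ.* ℂᴹ.𝟙 i j ℂ.+ ℂ.- fromReal (A i j))
          ℂ.≈ ℂᴹ.product (λ k → z ℂ.+ ℂ.- ν k)

  -- λ₁ < μ₁ < λ₂ < ⋯ < μₖ < λₙ with n = k + 1.  The lengths are not
  -- definitionally related where this is used, hence toℕ.
  StrictlyInterlaces : Vector Carrier k → Vector Carrier n → Set ℓ₂
  StrictlyInterlaces {k = k} {n = n} μ ν =
    n ≡ suc k
    × (∀ i j → toℕ j ≡ toℕ i       → ν j < μ i)
    × (∀ i j → toℕ j ≡ suc (toℕ i) → μ i < ν j)

  -- a ≤ b in iℝ means −ia ≤ −ib, so eigenvalues iλ are ordered as the λ.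
  SpectrumStrictlyInterlaces : Matrix k → Matrix n → Set (c ⊔ ℓ₁ ⊔ ℓ₂)
  SpectrumStrictlyInterlaces B A =
    ∃[ μ ] ∃[ ν ] (IsSpectrum B (i·_ ∘ μ) × IsSpectrum A (i·_ ∘ ν)
                   × StrictlyInterlaces μ ν)

  graphOf : Matrix n → Graph n ℓ₁
  graphOf A = record
    { Adj    = λ i j → (i <ᶠ j × ¬ (A i j ≈ 0#)) ⊎ (j <ᶠ i × ¬ (A j i ≈ 0#))
    ; adj?   = λ i j → ((i Finₚ.<? j) ×-dec ¬? (A i j ≟ 0#))
                       ⊎-dec ((j Finₚ.<? i) ×-dec ¬? (A j i ≟ 0#))
    ; sym    = swap
    ; irrefl = [ ℕₚ.<-irrefl refl ∘ proj₁ , ℕₚ.<-irrefl refl ∘ proj₁ ]′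
    }

  IsSkewSymmetric : Matrix n → Set ℓ₁
  IsSkewSymmetric A = ∀ i j → A j i ≈ - A i j

  S⁻ : Graph n g → Matrix n → Set (ℓ₁ ⊔ g)
  S⁻ T A = IsSkewSymmetric A × SameEdges (graphOf A) T

  -- Duarte A S w: the principal submatrix A [ S ] has the Duarte property
  -- with respect to w, where S is the vertex set of a subtree of the graph
  -- of A and w ∈ S.
  data Duarte (A : Matrix n) (S : Subset n) (w : Fin n) : Set (c ⊔ ℓ₁ ⊔ ℓ₂) where
    single : w ∈ S → ∣ S ∣ ≡ 1 → Duarte A S w
    branch : w ∈ S → 2 ℕ.≤ ∣ S ∣ →
             SpectrumStrictlyInterlaces (A [ S - w ]) (A [ S ]) →
             (∀ v C → Adj (graphOf A) w v →
                      IsComponentAt (graphOf A) (S - w) v C → Duarte A C v) →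
             Duarte A S w

  ----------------------------------------------------------------------
  -- Jacobian matrices

  HasLimitAt0 : (Carrier → Carrier) → Carrier → Set (c ⊔ ℓ₁ ⊔ ℓ₂)
  HasLimitAt0 q L =
    ∀ ε → 0# < ε → ∃[ δ ] (0# < δ ×
      (∀ h → ¬ (h ≈ 0#) → - δ < h → h < δ → - ε < q h − L × q h − L < ε))

  IsPartialDerivative : (Vector Carrier m → Carrier) → Fin m → Vector Carrier m →
                        Carrier → Set (c ⊔ ℓ₁ ⊔ ℓ₂)
  IsPartialDerivative φ j x =
    HasLimitAt0 (λ h → (φ (updateAt x j (_+ h)) − φ x) * h ⁻¹)

  IsJacobian : (Vector Carrier m → Vector Carrier m) → Vector Carrier m →
               Matrix m → Set (c ⊔ ℓ₁ ⊔ ℓ₂)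
  IsJacobian f x J = ∀ i j → IsPartialDerivative (λ y → f y i) j x (J i j)

  Nonsingular : Matrix m → Set ℓ₁
  Nonsingular J = ¬ (det J ≈ 0#)

  ----------------------------------------------------------------------
  -- The polynomial map of a tree on n = suc r vertices

  module _ {r : ℕ} {T : Graph (suc r) g} (E : EdgeEnumeration T r) where
    open EdgeEnumeration E

    -- M(x) = ∑ₖ xₖ (E_{lo k, hi k} − E_{hi k, lo k}) in matrix units.
    treeMatrix : Vector Carrier r → Matrix (suc r)
    treeMatrix x i j =
      sum (λ k → x k * (𝟙 (lo k) i * 𝟙 (hi k) j − 𝟙 (hi k) i * 𝟙 (lo k) j))

    treeMatrix⁻ : Vector Carrier r → Matrix r
    treeMatrix⁻ x i j = treeMatrix x (inject₁ i) (inject₁ j)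

    -- tr A^{2k} / (4k), used for k ≥ 1.
    traceTerm : Matrix n → ℕ → Carrier
    traceTerm A k = tr (power A (2 ℕ.* k)) * ((4 ℕ.* k) · 1#) ⁻¹

    -- With m = ⌊n/2⌋, coordinates 0, …, m-1 use M and the remaining
    -- n - 1 - m (m - 1 for n even, m for n odd) use N.
    treeMap : Vector Carrier r → Vector Carrier r
    treeMap x l =
      if does (toℕ l ℕₚ.<? ⌊ suc r /2⌋)
      then traceTerm (treeMatrix x) (suc (toℕ l))
      else traceTerm (treeMatrix⁻ x) (suc (toℕ l ℕ.∸ ⌊ suc r /2⌋))

    edgeEntries : Matrix (suc r) → Vector Carrier r
    edgeEntries A k = A (lo k) (hi k)

{-# OPTIONS --safe #-}

-- Differentiating traces of powers, ∂ tr M²ᵏ / 4k along the edge {i, j} is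
-- −(M²ᵏ⁻¹)ᵢⱼ, and likewise for N.  So a linear relation between the rows of the
-- Jacobian matrix at A is a pair of odd polynomials p, q such that the skew
-- matrix X = p(A) + q(A(w)) vanishes at all edges of T; moreover [A , X]
-- vanishes off row and column w.  By induction over the branches at w this
-- forces X = 0.  On the branch C at v the induction hypothesis gives X = 0, the
-- entries (v, j) and (j, v) of the commutator then make row and column w of X
-- vanish, and what is left of X commutes with A(w), whose simple eigenvalues
-- put each eigenvector on a single branch, so it vanishes as well.
--
-- Hence p(A) = −q(A(w)) has zero column w.  By strict interlacing every left
-- eigenvector of A has a nonzero entry at w, so p vanishes at all eigenvalues
-- of A; these are distinct and more than deg p, so p = 0, and then q = 0 in the
-- same way.  Left kernel vectors and eigenvectors come from vanishing
-- determinants by column elimination.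

module Submission where

open import Defs
open import Data.Nat.Base using (ℕ; suc)
open import Data.Fin.Base using (fromℕ)
open import Data.Fin.Subset using (⊤)
open import Data.Product.Base using (_×_; ∃-syntax)

open import Algebra.Bundles using (CommutativeRing)
open import Algebra.Bundles.Raw using (RawRing)
import Algebra.Definitions.RawSemiring as RawSemiringDefinitions
import Algebra.Properties.AbelianGroup as AbelianGroupProperties
import Algebra.Properties.Ring as RingProperties
import Algebra.Properties.Semiring.Mult as Mult
import Algebra.Properties.Semiring.Mult.TCOptimised as OptimisedMult
import Algebra.Properties.Semiring.Sum as Sum
import Algebra.Solver.Ring
open import Algebra.Solver.Ring.AlmostCommutativeRing
  using (fromCommutativeRing; _-Raw-AlmostCommutative⟶_)
open import Algebra.Structures using (IsCommutativeRing)
open import Data.Bool.Base using (true; false; if_then_else_; _∧_)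
open import Data.Bool.Properties using (∧-zeroʳ)
open import Data.Empty using (⊥-elim)
open import Data.Fin.Base as Fin
  using (Fin; zero; suc; toℕ; inject₁; punchIn; punchOut; _↑ˡ_; _↑ʳ_)
import Data.Fin.Induction as FinInduction
import Data.Fin.Properties as Finₚ
open import Data.Fin.Subset using (Subset; inside; outside; _∈_; _∉_; ∣_∣; _-_; ⁅_⁆)
open import Data.Fin.Subset.Properties
  using (_∈?_; ∈⊤; ∣⊤∣≡n; p─q⊆p; x∈p∧x≢y⇒x∈p-y; x∈p⇒∣p-x∣<∣p∣)
open import Data.Integer.Base as ℤ using (ℤ; +_; -[1+_]; _⊖_; _◃_)
import Data.Integer.Properties as ℤₚ
open import Data.Maybe.Base using (map)
open import Data.Nat.Base as ℕ using (zero; ⌊_/2⌋)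
import Data.Nat.Properties as ℕₚ
open import Data.Product.Base using (_,_; ∃; proj₁; proj₂)
import Data.Sign.Base as Sign
open import Data.Sum.Base using (_⊎_; inj₁; inj₂)
open import Data.Vec.Base using ([]; _∷_; here; there; tabulate)
open import Data.Vec.Functional using (Vector; updateAt)
open import Data.Vec.Functional.Properties using (updateAt-updates; updateAt-minimal)
open import Data.Vec.Properties using (lookup∘tabulate; []=⇒lookup; lookup⇒[]=)
open import Function.Base using (_∘_)
open import Function.Bundles using (mk⇔; Equivalence)
open import Function.Definitions using (Injective)
open import Level using (_⊔_) renaming (suc to lsuc)
open import Relation.Binary.Construct.Closure.ReflexiveTransitive as Star
  using (Star; ε; _◅_; _◅◅_; reverse)
open import Relation.Binary.Definitions using (Decidable; tri<; tri≈; tri>)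
open import Relation.Binary.PropositionalEquality.Core as ≡ using (_≡_; _≢_)
open import Relation.Binary.Structures using (IsStrictTotalOrder)
open import Relation.Nullary using (¬_; yes; no; Dec; does)
open import Relation.Nullary.Decidable
  using (dec-true; dec-false; dec⇒maybe; decidable-stable; ¬¬-excluded-middle; _×-dec_)
open import Relation.Nullary.Negation using (¬¬-map)

-- The eigenvalues lie on the imaginary axis, so the eigenvector arguments run over the complex
-- numbers, with `A` and the real coefficients of p and q embedded by `fromReal`; the Jacobian
-- matrix and its kernel vector stay real. Why [A , X] vanishes off row and column w: p(A) commutes
-- with `A`, while q(A(w)), padded by zeros, commutes with the padded A(w), and `A` differs from
-- that matrix only in row and column w, where q(A(w)) is zero. The last point needs q without
-- constant term. Oddness has a second use: it makes X skew, so the diagonal of X is zero and each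
-- edge needs to be checked in one orientation only. Principal submatrices are kept at full size
-- with zeros outside a subset, so that nested branches need no reindexing. The padding adds
-- spurious zero eigenvalues, and for this reason every eigenvector in an eigenbasis is required to
-- be supported on the subset. The degree count is tight: p has floor(n/2) odd coefficients, hence
-- degree below n, and q has floor((n-1)/2), hence degree below n-1, against n and n-1 distinct
-- eigenvalues.

-- Ring identities with integer coefficients

module IntegerCoefficientSolver {c ℓ} (R : CommutativeRing c ℓ) where
  open CommutativeRing R
  open RingProperties ring
  open AbelianGroupProperties +-abelianGroup using (⁻¹-∙-comm; ⁻¹-involutive; ε⁻¹≈ε)
  open OptimisedMult semiring using (×-homo-+; 1+×; ×1-homo-*) renaming (_×_ to _·_)
  open import Relation.Binary.Reasoning.Setoid setoid

  -- The optimised multiple gives `1 · 1#` as `1#` by computation, so that `con (+ 1)` in a solver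
  -- call means `1#` on the nose and `refl` closes the goal.
  ⟦_⟧ℤ : ℤ → Carrier
  ⟦ + n ⟧ℤ      = n · 1#
  ⟦ -[1+ n ] ⟧ℤ = - (suc n · 1#)

  ⟦-⟧ : ∀ i → ⟦ ℤ.- i ⟧ℤ ≈ - ⟦ i ⟧ℤ
  ⟦-⟧ (+ zero)  = sym ε⁻¹≈ε
  ⟦-⟧ (+ suc n) = refl
  ⟦-⟧ -[1+ n ]  = sym (⁻¹-involutive _)

  ⟦⊖⟧ : ∀ m n → ⟦ m ⊖ n ⟧ℤ ≈ m · 1# + - (n · 1#)
  ⟦⊖⟧ m zero          = sym (trans (+-congˡ ε⁻¹≈ε) (+-identityʳ _))
  ⟦⊖⟧ zero (suc n)    = sym (+-identityˡ _)
  ⟦⊖⟧ (suc m) (suc n) = begin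
    ⟦ suc m ⊖ suc n ⟧ℤ                    ≡⟨ ≡.cong ⟦_⟧ℤ (ℤₚ.[1+m]⊖[1+n]≡m⊖n m n) ⟩
    ⟦ m ⊖ n ⟧ℤ                            ≈⟨ ⟦⊖⟧ m n ⟩
    m · 1# + - (n · 1#)                   ≈⟨ +-congʳ (+-identityʳ _) ⟨
    (m · 1# + 0#) + - (n · 1#)            ≈⟨ +-congʳ (+-congˡ (-‿inverseʳ 1#)) ⟨
    (m · 1# + (1# + - 1#)) + - (n · 1#)   ≈⟨ +-congʳ (+-assoc _ _ _) ⟨
    ((m · 1# + 1#) + - 1#) + - (n · 1#)   ≈⟨ +-assoc _ _ _ ⟩
    (m · 1# + 1#) + (- 1# + - (n · 1#))   ≈⟨ +-cong (+-comm _ _) (⁻¹-∙-comm _ _) ⟩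
    (1# + m · 1#) + - (1# + n · 1#)       ≈⟨ +-cong (1+× m 1#) (-‿cong (1+× n 1#)) ⟨
    suc m · 1# + - (suc n · 1#)           ∎

  ⟦+⟧ : ∀ i j → ⟦ i ℤ.+ j ⟧ℤ ≈ ⟦ i ⟧ℤ + ⟦ j ⟧ℤ
  ⟦+⟧ (+ m)    (+ n)    = ×-homo-+ 1# m n
  ⟦+⟧ (+ m)    -[1+ n ] = ⟦⊖⟧ m (suc n)
  ⟦+⟧ -[1+ m ] (+ n)    = trans (⟦⊖⟧ n (suc m)) (+-comm _ _)
  ⟦+⟧ -[1+ m ] -[1+ n ] = begin
    - (suc (suc (m ℕ.+ n)) · 1#)     ≡⟨ ≡.cong (λ k → - (suc k · 1#)) (ℕₚ.+-suc m n) ⟨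
    - ((suc m ℕ.+ suc n) · 1#)       ≈⟨ -‿cong (×-homo-+ 1# (suc m) (suc n)) ⟩
    - (suc m · 1# + suc n · 1#)      ≈⟨ ⁻¹-∙-comm _ _ ⟨
    - (suc m · 1#) + - (suc n · 1#)  ∎

  ⟦+◃⟧ : ∀ n → ⟦ Sign.+ ◃ n ⟧ℤ ≈ n · 1#
  ⟦+◃⟧ n = reflexive (≡.cong ⟦_⟧ℤ (ℤₚ.+◃n≡+n n))

  ⟦-◃⟧ : ∀ n → ⟦ Sign.- ◃ n ⟧ℤ ≈ - (n · 1#)
  ⟦-◃⟧ n = trans (reflexive (≡.cong ⟦_⟧ℤ (ℤₚ.-◃n≡-n n))) (⟦-⟧ (+ n))

  ⟦*⟧ : ∀ i j → ⟦ i ℤ.* j ⟧ℤ ≈ ⟦ i ⟧ℤ * ⟦ j ⟧ℤ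
  ⟦*⟧ (+ m)    (+ n)    = trans (⟦+◃⟧ (m ℕ.* n)) (×1-homo-* m n)
  ⟦*⟧ (+ m)    -[1+ n ] = trans (⟦-◃⟧ (m ℕ.* suc n))
    (trans (-‿cong (×1-homo-* m (suc n))) (-‿distribʳ-* _ _))
  ⟦*⟧ -[1+ m ] (+ n)    = trans (⟦-◃⟧ (suc m ℕ.* n))
    (trans (-‿cong (×1-homo-* (suc m) n)) (-‿distribˡ-* _ _))
  ⟦*⟧ -[1+ m ] -[1+ n ] = begin
    (suc m ℕ.* suc n) · 1#                ≈⟨ ×1-homo-* (suc m) (suc n) ⟩
    (suc m · 1#) * (suc n · 1#)           ≈⟨ ⁻¹-involutive _ ⟨
    - - ((suc m · 1#) * (suc n · 1#))     ≈⟨ -‿cong (-‿distribˡ-* _ _) ⟩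
    - (- (suc m · 1#) * (suc n · 1#))     ≈⟨ -‿distribʳ-* _ _ ⟩
    - (suc m · 1#) * - (suc n · 1#)       ∎

  -- The solver detects cancellation by comparing coefficients. Integers can be compared even when
  -- equality in `R` is undecided.
  morphism : CommutativeRing.rawRing ℤₚ.+-*-commutativeRing
             -Raw-AlmostCommutative⟶ fromCommutativeRing R
  morphism = record
    { ⟦_⟧    = ⟦_⟧ℤ
    ; +-homo = ⟦+⟧
    ; *-homo = ⟦*⟧
    ; -‿homo = ⟦-⟧
    ; 0-homo = refl
    ; 1-homo = refl
    }

  open Algebra.Solver.Ring (CommutativeRing.rawRing ℤₚ.+-*-commutativeRing)
    (fromCommutativeRing R) morphism
    (λ i j → map (λ i≡j → reflexive (≡.cong ⟦_⟧ℤ i≡j)) (dec⇒maybe (i ℤₚ.≟ j)))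
    public using (solve; con; _:=_; _:+_; _:*_; :-_; _:-_)

-- Determinants, row vectors and polynomials over a commutative ring

-- In contrast to `2 ℕ.* m`, each `suc` unfolds to two successors at the head, so recursion on
-- powers alternates between even and odd exponents by computation.
double : ℕ → ℕ
double zero    = zero
double (suc m) = suc (suc (double m))

module MatrixAlgebra {c ℓ} (R : CommutativeRing c ℓ) where
  open CommutativeRing R hiding (zero; _-_)
  open RingProperties ring using (-0#≈0#)
  open Matrices rawRing
  open Sum semiring using (sum-cong-≋; ∑-distrib-+; ∑-comm; *-distribˡ-sum; *-distribʳ-sum)
  open RawSemiringDefinitions (RawRing.rawSemiring rawRing) using (_^_)
  open IntegerCoefficientSolver R
  open import Relation.Binary.Reasoning.Setoid setoid

  infix 4 _≋_ _≋ᴹ_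
  _≋_ : ∀ {n} → (Fin n → Carrier) → (Fin n → Carrier) → Set ℓ
  u ≋ v = ∀ i → u i ≈ v i

  _≋ᴹ_ : ∀ {m n} → (Fin m → Fin n → Carrier) → (Fin m → Fin n → Carrier) → Set ℓ
  A ≋ᴹ B = ∀ i → A i ≋ B i

  𝟘 : ∀ {n} → Fin n → Carrier
  𝟘 _ = 0#

  sum-0 : ∀ {n} {f : Fin n → Carrier} → f ≋ 𝟘 → sum f ≈ 0#
  sum-0 {zero}  f≋0 = refl
  sum-0 {suc n} f≋0 = trans (+-cong (f≋0 zero) (sum-0 (f≋0 ∘ suc))) (+-identityʳ 0#)

  sum-neg : ∀ {n} (f : Fin n → Carrier) → sum (λ i → - f i) ≈ - sum f
  sum-neg {zero}  f = sym -0#≈0#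
  sum-neg {suc n} f = trans (+-congˡ (sum-neg (f ∘ suc)))
    (solve 2 (λ x y → :- x :+ :- y := :- (x :+ y)) refl _ _)

  sum-single : ∀ {n} k (f : Fin n → Carrier) → (∀ i → i ≢ k → f i ≈ 0#) → sum f ≈ f k
  sum-single zero    f f≈0 = trans (+-congˡ (sum-0 λ i → f≈0 (suc i) λ ())) (+-identityʳ _)
  sum-single (suc k) f f≈0 = trans
    (+-cong (f≈0 zero λ ())
            (sum-single k (f ∘ suc) λ i i≢k → f≈0 (suc i) (i≢k ∘ Finₚ.suc-injective)))
    (+-identityˡ _)

  sum-pair : ∀ {n} (j : Fin n) (f : Fin (suc n) → Carrier) →
             (∀ l → l ≢ inject₁ j → l ≢ suc j → f l ≈ 0#) →
             sum f ≈ f (inject₁ j) + f (suc j)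
  sum-pair zero f f≈0 = trans (sym (+-assoc _ _ _))
    (trans (+-congˡ (sum-0 λ i → f≈0 (suc (suc i)) (λ ()) (λ ()))) (+-identityʳ _))
  sum-pair (suc j) f f≈0 = trans
    (+-cong (f≈0 zero (λ ()) (λ ()))
            (sum-pair j (f ∘ suc) λ l p q →
              f≈0 (suc l) (p ∘ Finₚ.suc-injective) (q ∘ Finₚ.suc-injective)))
    (+-identityˡ _)

  minor : ∀ {n} → Fin (suc n) → Matrix (suc n) → Matrix n
  minor l M i k = M (suc i) (punchIn l k)

  cofactor : ∀ {n} → Matrix (suc n) → Fin (suc n) → Carrier
  cofactor M l = (- 1#) ^ toℕ l * (M zero l * det (minor l M))

  cofactor-0 : ∀ {n} (M : Matrix (suc n)) l →
               M zero l ≈ 0# ⊎ det (minor l M) ≈ 0# → cofactor M l ≈ 0#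
  cofactor-0 M l (inj₁ e) = trans (*-congˡ (trans (*-congʳ e) (zeroˡ _))) (zeroʳ _)
  cofactor-0 M l (inj₂ e) = trans (*-congˡ (trans (*-congˡ e) (zeroʳ _))) (zeroʳ _)

  det-cong : ∀ {n} {M N : Matrix n} → M ≋ᴹ N → det M ≈ det N
  det-cong {zero}  M≋N = refl
  det-cong {suc n} {M} {N} M≋N = sum-cong-≋ {suc n} {cofactor M} {cofactor N} λ l → *-congˡ
    (*-cong (M≋N zero l) (det-cong λ i k → M≋N (suc i) (punchIn l k)))

  det-zeroColumn : ∀ {n} (M : Matrix (suc n)) → (∀ i → M i zero ≈ 0#) → det M ≈ 0#
  det-zeroColumn {n} M M≈0 = sum-0 {suc n} {cofactor M} (term M M≈0)
    where
    term : ∀ {n} (M : Matrix (suc n)) → (∀ i → M i zero ≈ 0#) → ∀ l → cofactor M l ≈ 0#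
    term         M M≈0 zero    = cofactor-0 M zero (inj₁ (M≈0 zero))
    term {suc n} M M≈0 (suc l) =
      cofactor-0 M (suc l) (inj₂ (det-zeroColumn (minor (suc l) M) (M≈0 ∘ suc)))

  -- Induction along the first row. For `l` equal to `b` the entry splits and the minor does not see
  -- column `b`; otherwise the entry is common and the minor splits at the place that column `b`
  -- takes after column `l` is deleted.
  det-linear : ∀ {n} (b : Fin n) s {M N P : Matrix n} →
               (∀ i → M i b ≈ N i b + s * P i b) →
               (∀ i k → k ≢ b → M i k ≈ N i k) →
               (∀ i k → k ≢ b → P i k ≈ N i k) →
               det M ≈ det N + s * det P
  det-linear {suc n} b s {M} {N} {P} Mb M≈N P≈N = trans
    (sum-cong-≋ {suc n} {cofactor M} {λ l → cofactor N l + s * cofactor P l} term)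
    (trans (∑-distrib-+ (cofactor N) λ l → s * cofactor P l)
           (+-congˡ (sym (*-distribˡ-sum s (cofactor P)))))
    where
    term : ∀ l → cofactor M l ≈ cofactor N l + s * cofactor P l
    term l with l Finₚ.≟ b
    ... | yes ≡.refl = trans
      (*-congˡ (*-cong (Mb zero) (det-cong λ i k → M≈N (suc i) _ (Finₚ.punchInᵢ≢i l k))))
      (trans
        (solve 5 (λ g x s p d → g :* ((x :+ s :* p) :* d) := g :* (x :* d) :+ s :* (g :* (p :* d)))
          refl ((- 1#) ^ toℕ l) (N zero l) s (P zero l) (det (minor l N)))
        (+-congˡ (*-congˡ (*-congˡ (*-congˡ {P zero l} {det (minor l N)} {det (minor l P)}
          (det-cong λ i k → sym (P≈N (suc i) _ (Finₚ.punchInᵢ≢i l k))))))))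
    ... | no l≢b = trans
      (*-congˡ (*-cong (M≈N zero l l≢b) (det-linear (punchOut l≢b) s {N = minor l N} {minor l P}
        (λ i → ≡.subst (λ k → M (suc i) k ≈ N (suc i) k + s * P (suc i) k) (≡.sym b≡) (Mb (suc i)))
        (λ i k k≢ → M≈N (suc i) _ (punch≢ k≢))
        (λ i k k≢ → P≈N (suc i) _ (punch≢ k≢)))))
      (trans
        (solve 5 (λ g x s d e → g :* (x :* (d :+ s :* e)) := g :* (x :* d) :+ s :* (g :* (x :* e)))
          refl ((- 1#) ^ toℕ l) (N zero l) s (det (minor l N)) (det (minor l P)))
        (+-congˡ (*-congˡ (*-congˡ (*-congʳ {det (minor l P)} (sym (P≈N zero l l≢b)))))))
      where
      b≡ : punchIn l (punchOut l≢b) ≡ b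
      b≡ = Finₚ.punchIn-punchOut l≢b
      punch≢ : ∀ {k} → k ≢ punchOut l≢b → punchIn l k ≢ b
      punch≢ k≢ eq = k≢ (Finₚ.punchIn-injective l _ _ (≡.trans eq (≡.sym b≡)))

  -- Deleting a third column leaves two neighbouring columns neighbours; this keeps the induction in
  -- `det-alternating` within adjacent pairs.
  punchIn-adjacent : ∀ {n} (l : Fin (suc (suc n))) (j : Fin (suc n)) →
                     l ≢ inject₁ j → l ≢ suc j →
                     ∃[ j′ ] (punchIn l (inject₁ {n = n} j′) ≡ inject₁ j × punchIn l (suc j′) ≡ suc j)
  punchIn-adjacent zero    zero    p q = ⊥-elim (p ≡.refl)
  punchIn-adjacent zero    (suc j) p q = j , ≡.refl , ≡.refl
  punchIn-adjacent (suc zero)    zero p q = ⊥-elim (q ≡.refl)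
  punchIn-adjacent {suc n} (suc (suc l)) zero p q = zero , ≡.refl , ≡.refl
  punchIn-adjacent {suc n} (suc l) (suc j) p q
    with j′ , e , f ← punchIn-adjacent l j (p ∘ ≡.cong suc) (q ∘ ≡.cong suc)
    = suc j′ , ≡.cong suc e , ≡.cong suc f

  punchIn-inject₁-suc : ∀ {n} (j : Fin n) k →
    punchIn (inject₁ j) k ≡ punchIn (suc j) k ⊎
    (punchIn (inject₁ j) k ≡ suc j × punchIn (suc j) k ≡ inject₁ j)
  punchIn-inject₁-suc zero    zero    = inj₂ (≡.refl , ≡.refl)
  punchIn-inject₁-suc zero    (suc k) = inj₁ ≡.refl
  punchIn-inject₁-suc (suc j) zero    = inj₁ ≡.refl
  punchIn-inject₁-suc (suc j) (suc k) with punchIn-inject₁-suc j k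
  ... | inj₁ e       = inj₁ (≡.cong suc e)
  ... | inj₂ (e , f) = inj₂ (≡.cong suc e , ≡.cong suc f)

  -- The cofactors at the two equal columns have opposite signs, equal entries and equal minors,
  -- hence cancel. Every other minor still contains both columns, side by side, and vanishes by
  -- induction.
  det-alternating : ∀ {n} (j : Fin n) (M : Matrix (suc n)) →
                    (∀ i → M i (inject₁ j) ≈ M i (suc j)) → det M ≈ 0#
  det-alternating {suc n} j M eq = trans (sum-pair j (cofactor M) others) (trans
    (+-cong {cofactor M (inject₁ j)} {ς * (M zero (inject₁ j) * D)}
            {cofactor M (suc j)} {(- 1#) * ς * (M zero (inject₁ j) * D)}
      (*-congʳ (reflexive (≡.cong ((- 1#) ^_) (Finₚ.toℕ-inject₁ j))))
      (*-congˡ (*-cong (sym (eq zero)) (det-cong minors))))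
    (solve 3 (λ g m d → g :* (m :* d) :+ (:- con (+ 1) :* g) :* (m :* d) := con (+ 0))
      refl ς (M zero (inject₁ j)) D))
    where
    ς = (- 1#) ^ toℕ j
    D = det (minor (inject₁ j) M)
    minors : minor (suc j) M ≋ᴹ minor (inject₁ j) M
    minors i k with punchIn-inject₁-suc j k
    ... | inj₁ e       = reflexive (≡.cong (M (suc i)) (≡.sym e))
    ... | inj₂ (e , f) = trans (reflexive (≡.cong (M (suc i)) f))
                           (trans (eq (suc i)) (reflexive (≡.cong (M (suc i)) (≡.sym e))))
    others : ∀ l → l ≢ inject₁ j → l ≢ suc j → cofactor M l ≈ 0#
    others l p q with j′ , e , f ← punchIn-adjacent l j p q =
      cofactor-0 M l (inj₂ (det-alternating j′ (minor l M) λ i →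
        trans (reflexive (≡.cong (M (suc i)) e))
          (trans (eq (suc i)) (reflexive (≡.cong (M (suc i)) (≡.sym f))))))

  infixl 7 _◁_
  -- Row `i` of `A ⊛ B` is by definition `A i ◁ B`, so one set of lemmas serves row vectors and
  -- matrix products alike.
  _◁_ : ∀ {m n} → (Fin m → Carrier) → (Fin m → Fin n → Carrier) → Fin n → Carrier
  (v ◁ A) j = sum (λ i → v i * A i j)

  ◁-cong : ∀ {m n} {u v : Fin m → Carrier} {A B : Fin m → Fin n → Carrier} →
           u ≋ v → A ≋ᴹ B → u ◁ A ≋ v ◁ B
  ◁-cong u≋v A≋B j = sum-cong-≋ λ i → *-cong (u≋v i) (A≋B i j)

  ◁-assoc : ∀ {l m n} (v : Fin l → Carrier) (A : Fin l → Fin m → Carrier)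
            (B : Fin m → Fin n → Carrier) → v ◁ A ◁ B ≋ v ◁ (λ i → A i ◁ B)
  ◁-assoc v A B j = begin
    sum (λ k → sum (λ i → v i * A i k) * B k j)
      ≈⟨ sum-cong-≋ (λ k → *-distribʳ-sum (B k j) (λ i → v i * A i k)) ⟩
    sum (λ k → sum (λ i → v i * A i k * B k j))
      ≈⟨ ∑-comm (λ k i → v i * A i k * B k j) ⟩
    sum (λ i → sum (λ k → v i * A i k * B k j))
      ≈⟨ sum-cong-≋ (λ i → sum-cong-≋ λ k → *-assoc (v i) (A i k) (B k j)) ⟩
    sum (λ i → sum (λ k → v i * (A i k * B k j)))
      ≈⟨ sum-cong-≋ (λ i → *-distribˡ-sum (v i) (λ k → A i k * B k j)) ⟨
    sum (λ i → v i * sum (λ k → A i k * B k j)) ∎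

  ◁-scale : ∀ {m n} s (v : Fin m → Carrier) (A : Fin m → Fin n → Carrier) →
            (λ i → s * v i) ◁ A ≋ λ j → s * (v ◁ A) j
  ◁-scale s v A j = trans (sum-cong-≋ λ i → *-assoc s (v i) (A i j))
                          (sym (*-distribˡ-sum s (λ i → v i * A i j)))

  ◁-𝟘 : ∀ {m n} {v : Fin m → Carrier} (A : Fin m → Fin n → Carrier) → v ≋ 𝟘 → v ◁ A ≋ 𝟘
  ◁-𝟘 A v≋0 j = sum-0 λ i → trans (*-congʳ (v≋0 i)) (zeroˡ _)

  𝟙-same : ∀ {n} (i : Fin n) → 𝟙 i i ≈ 1#
  𝟙-same i rewrite dec-true (i Finₚ.≟ i) ≡.refl = refl

  𝟙-diff : ∀ {n} {i j : Fin n} → i ≢ j → 𝟙 i j ≈ 0#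
  𝟙-diff {i = i} {j} i≢j rewrite dec-false (i Finₚ.≟ j) i≢j = refl

  𝟙-◁ : ∀ {m n} (A : Fin m → Fin n → Carrier) i → 𝟙 i ◁ A ≋ A i
  𝟙-◁ A i j = trans
    (sum-single i _ λ k k≢i → trans (*-congʳ (𝟙-diff (k≢i ∘ ≡.sym))) (zeroˡ _))
    (trans (*-congʳ (𝟙-same i)) (*-identityˡ _))

  ◁-𝟙 : ∀ {n} (v : Fin n → Carrier) → v ◁ 𝟙 ≋ v
  ◁-𝟙 v j = trans
    (sum-single j _ λ k k≢j → trans (*-congˡ (𝟙-diff k≢j)) (zeroʳ _))
    (trans (*-congˡ (𝟙-same j)) (*-identityʳ _))

  eval : ∀ {n} → (Fin n → Carrier) → Carrier → Carrier
  eval {zero}  a x = 0#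
  eval {suc n} a x = a zero + x * eval (a ∘ suc) x

  eval-𝟘 : ∀ {n} {a : Fin n → Carrier} x → a ≋ 𝟘 → eval a x ≈ 0#
  eval-𝟘 {zero}  x a≋0 = refl
  eval-𝟘 {suc n} x a≋0 = trans (+-cong (a≋0 zero) (*-congˡ (eval-𝟘 x (a≋0 ∘ suc))))
    (trans (+-identityˡ _) (zeroʳ x))

  -- Synthetic division by the linear polynomial with root r.
  quotient : ∀ {n} → (Fin (suc n) → Carrier) → Carrier → Fin n → Carrier
  quotient a r zero    = eval (a ∘ suc) r
  quotient a r (suc i) = quotient (a ∘ suc) r i

  eval-quotient : ∀ {n} (a : Fin (suc n) → Carrier) r x →
                  eval a x ≈ eval a r + (x + - r) * eval (quotient a r) x
  eval-quotient {zero} a r x =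
    solve 3 (λ a r x → a :+ x :* con (+ 0) :=
                       a :+ r :* con (+ 0) :+ (x :+ :- r) :* con (+ 0)) refl (a zero) r x
  eval-quotient {suc n} a r x = trans
    (+-congˡ (*-congˡ (eval-quotient (a ∘ suc) r x)))
    (solve 5 (λ a e r x q → a :+ x :* (e :+ (x :+ :- r) :* q) :=
                            a :+ r :* e :+ (x :+ :- r) :* (e :+ x :* q))
      refl (a zero) (eval (a ∘ suc) r) r x (eval (quotient (a ∘ suc) r) x))

  -- Each coefficient of the quotient is a tail of `a` evaluated at `r`. Once the longer-degree
  -- coefficients are known to be zero, that value is the first coefficient of the tail, so `a` is
  -- recovered from the top down.
  quotient-𝟘 : ∀ {n} (a : Fin (suc n) → Carrier) r → quotient a r ≋ 𝟘 → a ∘ suc ≋ 𝟘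
  quotient-𝟘 {suc n} a r q≋0 = λ where
      zero    → trans (sym (trans (+-congˡ (trans (*-congˡ (eval-𝟘 r tail≋0)) (zeroʳ r)))
                                  (+-identityʳ _)))
                      (q≋0 zero)
      (suc i) → tail≋0 i
    where tail≋0 = quotient-𝟘 (a ∘ suc) r (q≋0 ∘ suc)

  -- Places `a p` at degree 2p + 1 in an ordinary coefficient list. The length `double m` is the
  -- number of distinct roots that forces the list to be zero.
  spread : ∀ {m} → (Fin m → Carrier) → Fin (double m) → Carrier
  spread {suc m} a zero          = 0#
  spread {suc m} a (suc zero)    = a zero
  spread {suc m} a (suc (suc i)) = spread (a ∘ suc) i

  spread-𝟘 : ∀ {m} (a : Fin m → Carrier) → spread a ≋ 𝟘 → a ≋ 𝟘
  spread-𝟘 {suc m} a s≋0 zero    = s≋0 (suc zero)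
  spread-𝟘 {suc m} a s≋0 (suc i) = spread-𝟘 (a ∘ suc) (λ k → s≋0 (suc (suc k))) i

  eval-spread : ∀ {m} (a : Fin m → Carrier) x →
                eval (spread a) x ≈ sum (λ p → a p * x ^ suc (double (toℕ p)))
  eval-spread {zero}  a x = refl
  eval-spread {suc m} a x = trans (+-identityˡ _) (trans
    (*-congˡ (+-congˡ (*-congˡ (eval-spread (a ∘ suc) x))))
    (trans (solve 3 (λ x a s → x :* (a :+ x :* s) := a :* (x :* con (+ 1)) :+ x :* x :* s)
              refl x (a zero) (sum (λ p → a (suc p) * x ^ suc (double (toℕ p)))))
           (+-congˡ (trans (*-distribˡ-sum (x * x) (λ p → a (suc p) * x ^ suc (double (toℕ p))))
             (sum-cong-≋ λ p → solve 3 (λ x a y → x :* x :* (a :* y) := a :* (x :* (x :* y)))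
               refl x (a (suc p)) (x ^ suc (double (toℕ p))))))))

-- Left kernels and eigenbases over a field with decidable equality

enum-∈ : ∀ {n} (S : Subset n) k → enum S k ∈ S
enum-∈ (inside  ∷ S) zero    = here
enum-∈ (inside  ∷ S) (suc k) = there (enum-∈ S k)
enum-∈ (outside ∷ S) k       = there (enum-∈ S k)

enum-surjective : ∀ {n} {S : Subset n} {j} → j ∈ S → ∃[ k ] enum S k ≡ j
enum-surjective {S = inside ∷ S} here = zero , ≡.refl
enum-surjective {S = inside ∷ S} (there j∈S) with k , e ← enum-surjective j∈S = suc k , ≡.cong suc e
enum-surjective {S = outside ∷ S} (there j∈S) with k , e ← enum-surjective j∈S = k , ≡.cong suc e

-- Decidable equality serves the choice of pivots. The real instance yields the kernel vector of the
-- Jacobian matrix, the complex one the eigenvectors of `A`.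
record DiscreteField c ℓ : Set (lsuc (c ⊔ ℓ)) where
  field
    commutativeRing : CommutativeRing c ℓ
  open CommutativeRing commutativeRing public
  field
    _≟_      : Decidable _≈_
    _⁻¹      : Carrier → Carrier
    inverseʳ : ∀ x → ¬ x ≈ 0# → x * x ⁻¹ ≈ 1#
    1≉0      : ¬ 1# ≈ 0#
  infix 9 _⁻¹

module FieldLinearAlgebra {c ℓ} (F : DiscreteField c ℓ) where
  open DiscreteField F renaming (commutativeRing to R) hiding (zero; _-_)
  open Matrices rawRing
  open Sum semiring using (sum-cong-≋; ∑-distrib-+; *-distribˡ-sum)
  open IntegerCoefficientSolver R
  open MatrixAlgebra R

  zero-product : ∀ {x y} → ¬ x ≈ 0# → x * y ≈ 0# → y ≈ 0#
  zero-product {x} {y} x≉0 xy≈0 = trans (sym (*-identityˡ y)) (trans (*-congʳ (sym (inverseʳ x x≉0)))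
    (trans (solve 3 (λ x i y → x :* i :* y := i :* (x :* y)) refl x (x ⁻¹) y)
           (trans (*-congˡ xy≈0) (zeroʳ _))))

  x-y≈0⇒x≈y : ∀ {x y} → x + - y ≈ 0# → x ≈ y
  x-y≈0⇒x≈y {x} {y} e = trans (solve 2 (λ x y → x := x :+ :- y :+ y) refl x y)
    (trans (+-congʳ e) (+-identityˡ y))

  Nonzero : ∀ {n} → (Fin n → Carrier) → Set ℓ
  Nonzero v = ∃[ i ] ¬ v i ≈ 0#

  Distinct : ∀ {n} → (Fin n → Carrier) → Set ℓ
  Distinct v = ∀ i j → v i ≈ v j → i ≡ j

  -- Column operations preserve the left kernel. Only one inclusion is recorded: the kernel vector
  -- is found for the reduced matrix `N` and carried back to `M`.
  record _⟿_ {n} (M N : Matrix n) : Set (c ⊔ ℓ) where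
    field
      det≈   : det N ≈ det M
      kernel : ∀ v → v ◁ N ≋ 𝟘 → v ◁ M ≋ 𝟘
  open _⟿_

  ⟿-refl : ∀ {n} {M : Matrix n} → M ⟿ M
  ⟿-refl = record { det≈ = refl ; kernel = λ _ p → p }

  ⟿-trans : ∀ {n} {M N P : Matrix n} → M ⟿ N → N ⟿ P → M ⟿ P
  ⟿-trans p q = record
    { det≈ = trans (det≈ q) (det≈ p) ; kernel = λ v → kernel p v ∘ kernel q v }

  addColumn : ∀ {m n} → Fin n → Fin n → Carrier →
              (Fin m → Fin n → Carrier) → Fin m → Fin n → Carrier
  addColumn a b s M i = updateAt (M i) b (_+ s * M i a)

  AdjacentPair : ∀ {n} → Fin n → Fin (suc n) → Fin (suc n) → Set
  AdjacentPair j a b = (a ≡ inject₁ j × b ≡ suc j) ⊎ (a ≡ suc j × b ≡ inject₁ j)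

  inject₁≢suc : ∀ {n} (j : Fin n) → inject₁ j ≢ suc j
  inject₁≢suc j e = ℕₚ.1+n≢n (≡.trans (≡.cong toℕ (≡.sym e)) (Finₚ.toℕ-inject₁ j))

  adjacent⇒≢ : ∀ {n} {j : Fin n} {a b} → AdjacentPair j a b → a ≢ b
  adjacent⇒≢ {j = j} (inj₁ (≡.refl , ≡.refl)) = inject₁≢suc j
  adjacent⇒≢ {j = j} (inj₂ (≡.refl , ≡.refl)) = inject₁≢suc j ∘ ≡.sym

  adjacent-≈ : ∀ {n} {j : Fin n} {a b} (f : Fin (suc n) → Carrier) →
               AdjacentPair j a b → f a ≈ f b → f (inject₁ j) ≈ f (suc j)
  adjacent-≈ f (inj₁ (≡.refl , ≡.refl)) = λ e → e
  adjacent-≈ f (inj₂ (≡.refl , ≡.refl)) = sym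

  -- By linearity in column `b` the determinant changes by `s` times the determinant of `P`, which
  -- has two equal adjacent columns. For the kernel, column `b` of `v ◁ M′` differs from that of
  -- `v ◁ M` by `s` times column `a`, which is already zero.
  addColumn-⟿ : ∀ {n} (j : Fin n) {a b : Fin (suc n)} → AdjacentPair j a b →
                ∀ s (M : Matrix (suc n)) → M ⟿ addColumn a b s M
  addColumn-⟿ {n} j {a} {b} ab s M = record { det≈ = det≈′ ; kernel = kernel′ }
    where
    M′ P : Matrix (suc n)
    M′ = addColumn a b s M
    P i = updateAt (M i) b (λ _ → M i a)
    a≢b : a ≢ b
    a≢b = adjacent⇒≢ ab
    equalColumns : ∀ i → P i (inject₁ j) ≈ P i (suc j)
    equalColumns i = adjacent-≈ (P i) ab (reflexive
      (≡.trans (updateAt-minimal a b (M i) a≢b) (≡.sym (updateAt-updates b (M i)))))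
    M′b : ∀ i → M′ i b ≈ M i b + s * M i a
    M′b i = reflexive (updateAt-updates b (M i))
    det≈′ : det M′ ≈ det M
    det≈′ = trans
      (det-linear b s {M′} {M} {P}
        (λ i → trans (M′b i) (+-congˡ (*-congˡ (reflexive (≡.sym (updateAt-updates b (M i)))))))
        (λ i k k≢b → reflexive (updateAt-minimal k b (M i) k≢b))
        (λ i k k≢b → reflexive (updateAt-minimal k b (M i) k≢b)))
      (trans (+-congˡ (trans (*-congˡ (det-alternating j P equalColumns)) (zeroʳ s)))
             (+-identityʳ _))
    kernel′ : ∀ v → v ◁ M′ ≋ 𝟘 → v ◁ M ≋ 𝟘
    kernel′ v vM′≈0 = at
      where
      off : ∀ k → k ≢ b → (v ◁ M) k ≈ 0#
      off k k≢b = trans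
        (sum-cong-≋ {x = λ i → v i * M i k} {λ i → v i * M′ i k} λ i →
          *-congˡ (reflexive (≡.sym (updateAt-minimal k b (M i) k≢b))))
        (vM′≈0 k)
      at : ∀ k → (v ◁ M) k ≈ 0#
      at k with k Finₚ.≟ b
      ... | no k≢b     = off k k≢b
      ... | yes ≡.refl = trans (sym (+-identityʳ _)) (trans
        (+-congˡ (trans (sym (zeroʳ s)) (*-congˡ (sym (off a a≢b)))))
        (trans (+-congˡ (*-distribˡ-sum s (λ i → v i * M i a)))
        (trans (sym (∑-distrib-+ (λ i → v i * M i b) λ i → s * (v i * M i a)))
        (trans (sum-cong-≋ λ i → trans
          (solve 4 (λ v m s n → v :* m :+ s :* (v :* n) := v :* (m :+ s :* n)) refl
            (v i) (M i b) s (M i a))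
          (*-congˡ (sym (M′b i))))
        (vM′≈0 b)))))

  -- Sweep the first row from right to left with operations on adjacent
  -- columns, making the left entry of a pair nonzero before it is used.
  clearFirstRow : ∀ {n} (M : Matrix (suc n)) →
                  ∃[ M′ ] (M ⟿ M′ × (∀ l → M′ zero (suc l) ≈ 0#))
  clearFirstRow {n} M = let M′ , r , z = FinInduction.>-weakInduction P base step zero in
    M′ , r , λ l → z l ℕ.z≤n
    where
    -- The indices `suc l` with `toℕ i ℕ.≤ toℕ l` are the columns strictly to the right of `i`: the
    -- claim is empty at the last column and is the goal at `zero`.
    P : Fin (suc n) → Set _
    P i = ∃[ M′ ] (M ⟿ M′ × (∀ l → toℕ i ℕ.≤ toℕ l → M′ zero (suc l) ≈ 0#))
    base : P (fromℕ n)
    base = M , ⟿-refl , λ l n≤l → ⊥-elim (ℕₚ.<⇒≱ (Finₚ.toℕ<n l)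
      (≡.subst (ℕ._≤ toℕ l) (Finₚ.toℕ-fromℕ n) n≤l))
    step : ∀ j → P (suc j) → P (inject₁ j)
    step j (N , r , z) with N zero (suc j) ≟ 0#
    ... | yes e = N , r , λ l j≤l → at l (ℕₚ.m≤n⇒m<n∨m≡n (≡.subst (ℕ._≤ toℕ l) (Finₚ.toℕ-inject₁ j) j≤l))
      where
      at : ∀ l → toℕ j ℕ.< toℕ l ⊎ toℕ j ≡ toℕ l → N zero (suc l) ≈ 0#
      at l (inj₁ j<l) = z l j<l
      at l (inj₂ j≡l) with ≡.refl ← Finₚ.toℕ-injective j≡l = e
    ... | no b≉0 = clear (N zero (inject₁ j) ≟ 0#)
      where
      b = N zero (suc j)
      suc≢inject₁ : ∀ {l} → toℕ j ℕ.< toℕ l → suc l ≢ inject₁ j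
      suc≢inject₁ j<l e = ℕₚ.<-asym j<l
        (≡.subst (_ ℕ.<_) (≡.trans (≡.cong toℕ e) (Finₚ.toℕ-inject₁ j)) ℕₚ.≤-refl)
      suc≢suc : ∀ {l} → toℕ j ℕ.< toℕ l → suc l ≢ suc j
      suc≢suc j<l e = ℕₚ.<-irrefl (≡.cong toℕ (≡.sym (Finₚ.suc-injective e))) j<l
      pivot : ∀ N′ → M ⟿ N′ → ¬ N′ zero (inject₁ j) ≈ 0# →
              (∀ l → toℕ j ℕ.< toℕ l → N′ zero (suc l) ≈ 0#) → P (inject₁ j)
      pivot N′ r′ a≉0 z′ = addColumn (inject₁ j) (suc j) s N′ ,
        ⟿-trans r′ (addColumn-⟿ j (inj₁ (≡.refl , ≡.refl)) s N′) ,
        λ l j≤l → at l (ℕₚ.m≤n⇒m<n∨m≡n (≡.subst (ℕ._≤ toℕ l) (Finₚ.toℕ-inject₁ j) j≤l))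
        where
        a = N′ zero (inject₁ j)
        s = - N′ zero (suc j) * a ⁻¹
        at : ∀ l → toℕ j ℕ.< toℕ l ⊎ toℕ j ≡ toℕ l →
             addColumn (inject₁ j) (suc j) s N′ zero (suc l) ≈ 0#
        at l (inj₁ j<l) = trans
          (reflexive (updateAt-minimal (suc l) (suc j) (N′ zero) (suc≢suc j<l))) (z′ l j<l)
        at l (inj₂ j≡l) with ≡.refl ← Finₚ.toℕ-injective j≡l = trans
          (reflexive (updateAt-updates (suc j) (N′ zero)))
          (trans (solve 3 (λ b a i → b :+ (:- b :* i) :* a := b :+ :- (b :* (a :* i))) refl
                   (N′ zero (suc j)) a (a ⁻¹))
          (trans (+-congˡ (-‿cong (trans (*-congˡ (inverseʳ a a≉0)) (*-identityʳ _))))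
                 (-‿inverseʳ _)))
      clear : Dec (N zero (inject₁ j) ≈ 0#) → P (inject₁ j)
      clear (no a≉0)  = pivot N r a≉0 z
      clear (yes a≈0) = pivot (addColumn (suc j) (inject₁ j) 1# N)
        (⟿-trans r (addColumn-⟿ j (inj₂ (≡.refl , ≡.refl)) 1# N))
        (λ e → b≉0 (trans (sym (trans (+-cong a≈0 (*-identityˡ b)) (+-identityˡ b)))
          (trans (reflexive (≡.sym (updateAt-updates (inject₁ j) (N zero)))) e)))
        (λ l j<l → trans
          (reflexive (updateAt-minimal (suc l) (inject₁ j) (N zero) (suc≢inject₁ j<l)))
          (z l j<l))

  -- After the first row is cleared, a zero corner makes the first unit vector a kernel vector. A
  -- nonzero corner `a` makes the remaining minor singular, and its kernel vector extends by the
  -- first coordinate that solves the single equation left, the one for column `zero`.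
  singular⇒leftKernel : ∀ {n} (M : Matrix n) → det M ≈ 0# → ∃[ v ] (Nonzero v × v ◁ M ≋ 𝟘)
  singular⇒leftKernel {zero}  M detM≈0 = ⊥-elim (1≉0 detM≈0)
  singular⇒leftKernel {suc n} M detM≈0
    with clearFirstRow M
  ... | M′ , r , z with M′ zero zero ≟ 0#
  ... | yes a≈0 = 𝟙 zero , (zero , 1≉0 ∘ trans (sym (𝟙-same {suc n} zero))) ,
    kernel r (𝟙 zero) λ where
      zero    → trans (𝟙-◁ M′ zero zero) a≈0
      (suc l) → trans (𝟙-◁ M′ zero (suc l)) (z l)
  ... | no a≉0 = extend (singular⇒leftKernel (minor zero M′) (zero-product a≉0
      (trans (sym (trans (sum-single zero (cofactor M′) λ where
                     zero    0≢0 → ⊥-elim (0≢0 ≡.refl)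
                     (suc l) _   → cofactor-0 M′ (suc l) (inj₁ (z l)))
                   (*-identityˡ _)))
             (trans (det≈ r) detM≈0))))
    where
    a = M′ zero zero
    extend : ∃[ v ] (Nonzero v × v ◁ minor zero M′ ≋ 𝟘) → ∃[ v ] (Nonzero v × v ◁ M ≋ 𝟘)
    extend (v , (i , vi≉0) , vm≋0) = w , (suc i , vi≉0) , kernel r w λ where
        zero    → trans (+-congʳ (trans
          (solve 3 (λ t i a → (:- t :* i) :* a := :- (t :* (a :* i))) refl t (a ⁻¹) a)
          (-‿cong (trans (*-congˡ (inverseʳ a a≉0)) (*-identityʳ t))))) (-‿inverseˡ t)
        (suc l) → trans (+-cong (trans (*-congˡ (z l)) (zeroʳ _)) (vm≋0 l)) (+-identityˡ 0#)
      where
      t = sum (λ i → v i * M′ (suc i) zero)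
      w : Fin (suc n) → Carrier
      w zero    = - t * a ⁻¹
      w (suc i) = v i

  -- The vectors become the rows of a square matrix with an additional zero
  -- column.
  dependent : ∀ {n} (V : Fin (suc n) → Fin n → Carrier) → ∃[ v ] (Nonzero v × v ◁ V ≋ 𝟘)
  dependent {n} V =
    let v , nz , vM≋0 = singular⇒leftKernel M (det-zeroColumn M λ _ → refl)
    in v , nz , λ k → vM≋0 (suc k)
    where
    M : Matrix (suc n)
    M i zero    = 0#
    M i (suc k) = V i k

  SupportedOn : ∀ {n} → Subset n → (Fin n → Carrier) → Set ℓ
  SupportedOn S v = ∀ j → j ∉ S → v j ≈ 0#

  dependentOn : ∀ {n} (S : Subset n) (V : Fin (suc ∣ S ∣) → Fin n → Carrier) →
                (∀ k → SupportedOn S (V k)) → ∃[ v ] (Nonzero v × v ◁ V ≋ 𝟘)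
  dependentOn S V supp =
    let v , nz , vV≋0 = dependent (λ i → V i ∘ enum S) in v , nz , at v vV≋0
    where
    at : ∀ v → v ◁ (λ i → V i ∘ enum S) ≋ 𝟘 → v ◁ V ≋ 𝟘
    at v vV≋0 j with j ∈? S
    ... | no j∉S = sum-0 {f = λ i → v i * V i j} λ i → trans (*-congˡ (supp i j j∉S)) (zeroʳ _)
    ... | yes j∈S with k , ≡.refl ← enum-surjective j∈S = vV≋0 k

  Eigenvector : ∀ {n} → Matrix n → Carrier → (Fin n → Carrier) → Set ℓ
  Eigenvector B μ v = ∀ j → (v ◁ B) j ≈ μ * v j

  -- Applying `B` and subtracting `μ zero` times the relation removes the first vector and
  -- multiplies the other coefficients by the nonzero differences `δ`. The conclusion speaks of the
  -- products `a k * u k j`, so that it also covers vectors that may be zero.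
  eigenvectorsIndependent : ∀ {d n} (B : Matrix n) (μ : Fin d → Carrier) → Distinct μ →
    (u : Fin d → Fin n → Carrier) → (∀ k → Eigenvector B (μ k) (u k)) →
    ∀ a → a ◁ u ≋ 𝟘 → ∀ k j → a k * u k j ≈ 0#
  eigenvectorsIndependent {zero} _ _ _ _ _ _ _ ()
  eigenvectorsIndependent {suc d} B μ distinct u eig a au≋0 = λ where
      zero    j → trans (sym (+-identityʳ _))
                    (trans (+-congˡ (sym (sum-0 λ k → tail k j))) (au≋0 j))
      (suc k) j → tail k j
    where
    δ : Fin (suc d) → Carrier
    δ k = μ k + - μ zero
    apply : ∀ j → sum (λ k → a k * (μ k * u k j)) ≈ 0#
    apply j = trans
      (sum-cong-≋ {suc d} {λ k → a k * (μ k * u k j)} {λ k → a k * (u k ◁ B) j} λ k →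
        *-congˡ (sym (eig k j)))
      (trans (sym (◁-assoc a u B j)) (◁-𝟘 B au≋0 j))
    shifted : ∀ j → sum (λ k → a k * δ k * u k j) ≈ 0#
    shifted j = trans
      (sum-cong-≋ {suc d} {λ k → a k * δ k * u k j}
                  {λ k → a k * (μ k * u k j) + (- μ zero) * (a k * u k j)} λ k →
        solve 4 (λ a m m₀ v → a :* (m :+ :- m₀) :* v := a :* (m :* v) :+ (:- m₀) :* (a :* v))
          refl (a k) (μ k) (μ zero) (u k j))
      (trans (∑-distrib-+ (λ k → a k * (μ k * u k j)) (λ k → (- μ zero) * (a k * u k j)))
      (trans (+-cong (apply j)
               (trans (sym (*-distribˡ-sum (- μ zero) (λ k → a k * u k j)))
                      (trans (*-congˡ (au≋0 j)) (zeroʳ _))))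
             (+-identityʳ 0#)))
    δ≉0 : ∀ k → ¬ δ (suc k) ≈ 0#
    δ≉0 k e with () ← distinct (suc k) zero (x-y≈0⇒x≈y e)
    tail : ∀ k j → a (suc k) * u (suc k) j ≈ 0#
    tail k j = zero-product (δ≉0 k) (trans
      (solve 3 (λ d a v → d :* (a :* v) := a :* d :* v) refl (δ (suc k)) (a (suc k)) (u (suc k) j))
      (eigenvectorsIndependent B (μ ∘ suc) (λ i j e → Finₚ.suc-injective (distinct (suc i) (suc j) e))
        (u ∘ suc) (eig ∘ suc) (λ k → a (suc k) * δ (suc k))
        (λ j → trans (sym (+-identityˡ _)) (trans (+-congʳ (sym (trans
          (*-congʳ (trans (*-congˡ (-‿inverseʳ (μ zero))) (zeroʳ _))) (zeroˡ _)))) (shifted j)))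
        k j))

  -- The μ k are distinct and ∣ S ∣ in number, so the u k form a basis of the
  -- vectors supported on S.
  record EigenBasis {n} (B : Matrix n) (S : Subset n) : Set (c ⊔ ℓ) where
    field
      μ         : Fin ∣ S ∣ → Carrier
      distinct  : Distinct μ
      u         : Fin ∣ S ∣ → Fin n → Carrier
      eigen     : ∀ k → Eigenvector B (μ k) (u k)
      supported : ∀ k → SupportedOn S (u k)
      nonzero   : ∀ k → Nonzero (u k)

    -- `y` and the `u k` are one vector more than there are coordinates in `S`, hence dependent.
    -- Independence of the eigenvectors excludes a zero coefficient at `y`, and dividing by that
    -- coefficient expresses `y`.
    spans : ∀ y → SupportedOn S y → ∃[ a ] y ≋ a ◁ u
    spans y ySupp with dependentOn S V (λ { zero → ySupp ; (suc k) → supported k })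
      where
      V : Fin (suc ∣ S ∣) → Fin n → Carrier
      V zero    = y
      V (suc k) = u k
    ... | e , nz , eV≋0 with e zero ≟ 0#
    ...   | yes e₀≈0 = ⊥-elim (vanish nz)
      where
      tail≋0 : ∀ k → e (suc k) ≈ 0#
      tail≋0 k = let j , v≉0 = nonzero k in zero-product v≉0 (trans (*-comm _ _)
        (eigenvectorsIndependent B μ distinct u eigen (e ∘ suc)
          (λ j → trans (sym (+-identityˡ _)) (trans
            (+-congʳ (sym (trans (*-congʳ e₀≈0) (zeroˡ _)))) (eV≋0 j))) k j))
      vanish : ¬ Nonzero e
      vanish (zero  , ≉0) = ≉0 e₀≈0
      vanish (suc k , ≉0) = ≉0 (tail≋0 k)
    ...   | no e₀≉0 = (λ k → s * e (suc k)) , λ j → trans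
      (x-y≈0⇒x≈y (zero-product e₀≉0 (trans
        (solve 4 (λ e i y t → e :* (y :+ :- ((:- i) :* t)) := e :* y :+ (e :* i) :* t) refl
          (e zero) (e zero ⁻¹) (y j) (((e ∘ suc) ◁ u) j))
        (trans (+-congˡ (trans (*-congʳ (inverseʳ _ e₀≉0)) (*-identityˡ _))) (eV≋0 j)))))
      (sym (◁-scale s (e ∘ suc) u j))
      where s = - (e zero ⁻¹)

    -- Applying `B` minus `ν` to the expansion of `y` gives a relation between the `u k` with
    -- coefficients `a k * (μ k + - ν)`; each of its terms vanishes.
    coefficient : ∀ {ν y a} → Eigenvector B ν y → y ≋ a ◁ u →
                  ∀ k → ¬ μ k ≈ ν → ∀ j → a k * u k j ≈ 0#
    coefficient {ν} {y} {a} eig y≋au k μ≉ν j = zero-product (μ≉ν ∘ x-y≈0⇒x≈y) (trans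
      (solve 4 (λ m n a v → (m :+ :- n) :* (a :* v) := a :* (m :+ :- n) :* v) refl
        (μ k) ν (a k) (u k j))
      (eigenvectorsIndependent B μ distinct u eigen (λ k → a k * (μ k + - ν)) at k j))
      where
      at : (λ k → a k * (μ k + - ν)) ◁ u ≋ 𝟘
      at j = trans
        (sum-cong-≋ λ k → solve 4
          (λ a m n v → a :* (m :+ :- n) :* v := a :* (m :* v) :+ (:- n) :* (a :* v)) refl
          (a k) (μ k) ν (u k j))
        (trans (∑-distrib-+ (λ k → a k * (μ k * u k j)) (λ k → (- ν) * (a k * u k j)))
        (trans (+-cong
          (trans (sum-cong-≋ λ k → *-congˡ (sym (eigen k j)))
            (trans (sym (◁-assoc a u B j))
              (trans (◁-cong {A = B} (λ i → sym (y≋au i)) (λ _ _ → refl) j) (eig j))))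
          (trans (sym (*-distribˡ-sum (- ν) (λ k → a k * u k j)))
                 (*-congˡ (sym (y≋au j)))))
        (solve 2 (λ n y → n :* y :+ (:- n) :* y := con (+ 0)) refl ν (y j))))

    non-eigenvalue : ∀ {ν y} → SupportedOn S y → Eigenvector B ν y → (∀ k → ¬ μ k ≈ ν) → y ≋ 𝟘
    non-eigenvalue {ν} {y} ySupp eig μ≉ν j = let a , y≋au = spans y ySupp in
      trans (y≋au j) (sum-0 λ k → coefficient eig y≋au k (μ≉ν k) j)

    -- The expansion of `y` has only its term at `k`, and the entry at `i` shows that the factor is
    -- zero.
    simple : ∀ {y} k i → SupportedOn S y → Eigenvector B (μ k) y →
             ¬ u k i ≈ 0# → y i ≈ 0# → y ≋ 𝟘
    simple {y} k i ySupp eig uki≉0 yi≈0 j = let a , y≋au = spans y ySupp in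
      trans (only a y≋au j) (trans
        (*-congʳ (zero-product uki≉0 (trans (*-comm _ _) (trans (sym (only a y≋au i)) yi≈0))))
        (zeroˡ _))
      where
      only : ∀ a → y ≋ a ◁ u → ∀ j → y j ≈ a k * u k j
      only a y≋au j = trans (y≋au j) (sum-single k _ λ l l≢k →
        coefficient eig y≋au l (λ e → l≢k (distinct l k e)) j)

    separates : ∀ {m} (X : Fin n → Fin m → Carrier) → (∀ k → u k ◁ X ≋ 𝟘) →
                ∀ y → SupportedOn S y → y ◁ X ≋ 𝟘
    separates X uX≋0 y ySupp j = let a , y≋au = spans y ySupp in trans
      (◁-cong {A = X} y≋au (λ _ _ → refl) j)
      (trans (◁-assoc a u X j) (sum-0 λ k → trans (*-congˡ (uX≋0 k j)) (zeroʳ _)))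

  eigenBasis-cong : ∀ {n} {B C : Matrix n} {S} → B ≋ᴹ C → EigenBasis B S → EigenBasis C S
  eigenBasis-cong B≋C basis = record
    { EigenBasis basis
    ; eigen = λ k j → trans (◁-cong {u = u k} (λ _ → refl) (λ a b → sym (B≋C a b)) j) (eigen k j)
    }
    where open EigenBasis basis

  vanishing-polynomial : ∀ {d e} (a : Fin d → Carrier) (r : Fin e → Carrier) → d ℕ.≤ e →
                         Distinct r → (∀ k → eval a (r k) ≈ 0#) → a ≋ 𝟘
  vanishing-polynomial {zero}  {e}     a r d≤e distinct root ()
  vanishing-polynomial {suc d} {suc e} a r (ℕ.s≤s d≤e) distinct root = λ where
      zero    → trans (sym (trans (+-congˡ (trans (*-congˡ (eval-𝟘 (r zero) tail≋0)) (zeroʳ _)))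
                                  (+-identityʳ _))) (root zero)
      (suc i) → tail≋0 i
    where
    tail≋0 : a ∘ suc ≋ 𝟘
    tail≋0 = quotient-𝟘 a (r zero) (vanishing-polynomial (quotient a (r zero)) (r ∘ suc) d≤e
      (λ i j e → Finₚ.suc-injective (distinct (suc i) (suc j) e))
      λ k → zero-product (λ e → case (distinct (suc k) zero (x-y≈0⇒x≈y e)))
        (trans (sym (trans (+-congʳ (root zero)) (+-identityˡ _)))
          (trans (sym (eval-quotient a (r zero) (r (suc k)))) (root (suc k)))))
      where
      case : ∀ {n} {k : Fin n} → ¬ (suc k ≡ Fin.zero)
      case ()

-- Components, paths and cycles in induced subgraphs

-⊆ : ∀ {n} {S : Subset n} {w x} → x ∈ S - w → x ∈ S
-⊆ {S = S} {w} = p─q⊆p S ⁅ w ⁆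

∉- : ∀ {n} (S : Subset n) w → w ∉ S - w
∉- (inside  ∷ S) zero ()
∉- (outside ∷ S) zero ()
∉- (s ∷ S) (suc w) (there w∈) = ∉- S w w∈

-- Double negation commutes with a finite conjunction, which allows all membership questions for a
-- component to be settled at once under one double negation.
¬¬-∀ : ∀ {p n} {P : Fin n → Set p} → (∀ i → ¬ ¬ P i) → ¬ ¬ (∀ i → P i)
¬¬-∀ {n = zero}  f k = k λ ()
¬¬-∀ {n = suc n} f k = f zero λ p₀ → ¬¬-∀ (f ∘ suc) λ p → k λ where
  zero    → p₀
  (suc i) → p i

module _ {g n} (G : Graph n g) where

  -- Double negation suffices: components only serve to prove equations, which
  -- are decidable.
  component : ∀ {S v} → v ∈ S → ¬ ¬ ∃ (IsComponentAt G S v)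
  component {S} {v} v∈S = ¬¬-map build (¬¬-∀ λ u → ¬¬-excluded-middle {A = Star (AdjIn G S) v u})
    where
    build : (∀ u → Dec (Star (AdjIn G S) v u)) → ∃ (IsComponentAt G S v)
    build dec = C , v∈S , λ u → mk⇔
      (λ u∈C → sound u (≡.trans (≡.sym (lookup∘tabulate (does ∘ dec) u)) ([]=⇒lookup u∈C)))
      (λ p → lookup⇒[]= u C (≡.trans (lookup∘tabulate (does ∘ dec) u) (dec-true (dec u) p)))
      where
      C = tabulate (does ∘ dec)
      sound : ∀ u → does (dec u) ≡ inside → Star (AdjIn G S) v u
      sound u e with yes p ← dec u = p

  reverseIn : ∀ {S u v} → Star (AdjIn G S) u v → Star (AdjIn G S) v u
  reverseIn = reverse λ (x∈S , y∈S , xy) → y∈S , x∈S , Graph.sym G xy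

  target∈ : ∀ {S u v} → u ∈ S → Star (AdjIn G S) u v → v ∈ S
  target∈ u∈S ε                  = u∈S
  target∈ u∈S ((_ , x∈S , _) ◅ p) = target∈ x∈S p

  module Component {S v C} (isC : IsComponentAt G S v C) where
    v∈S = proj₁ isC

    reach : ∀ {u} → u ∈ C → Star (AdjIn G S) v u
    reach {u} = Equivalence.to (proj₂ isC u)

    reached : ∀ {u} → Star (AdjIn G S) v u → u ∈ C
    reached {u} = Equivalence.from (proj₂ isC u)

    root∈ : v ∈ C
    root∈ = reached ε

    ⊆S : ∀ {u} → u ∈ C → u ∈ S
    ⊆S u∈C = target∈ v∈S (reach u∈C)

    closed : ∀ {u x} → u ∈ C → x ∈ S → Adj G u x → x ∈ C
    closed u∈C x∈S ux = reached (reach u∈C ◅◅ (⊆S u∈C , x∈S , ux) ◅ ε)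

    connected : ∀ {u x} → u ∈ C → x ∈ C → Star (AdjIn G C) u x
    connected u∈C x∈C = within u∈C (reverseIn (reach u∈C) ◅◅ reach x∈C)
      where
      within : ∀ {u x} → u ∈ C → Star (AdjIn G S) u x → Star (AdjIn G C) u x
      within u∈C ε = ε
      within u∈C ((_ , y∈S , uy) ◅ p) = let y∈C = closed u∈C y∈S uy in
        (u∈C , y∈C , uy) ◅ within y∈C p

  -- Cutting the path at its first visit to `w` names the neighbour of `w` in whose branch `u` lies.
  firstArrival : ∀ {S u w} → u ∈ S → u ≢ w → Star (AdjIn G S) u w →
                 ∃[ v ] (v ∈ S - w × Adj G v w × Star (AdjIn G (S - w)) u v)
  firstArrival u∈S u≢w ε = ⊥-elim (u≢w ≡.refl)
  firstArrival {S} {u} {w} u∈S u≢w (_◅_ {j = x} (_ , x∈S , ux) p) with x Finₚ.≟ w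
  ... | yes ≡.refl = u , x∈p∧x≢y⇒x∈p-y u∈S u≢w , ux , ε
  ... | no x≢w with v , v∈ , vw , q ← firstArrival x∈S x≢w p =
    v , v∈ , vw , (x∈p∧x≢y⇒x∈p-y u∈S u≢w , x∈p∧x≢y⇒x∈p-y x∈S x≢w , ux) ◅ q

  -- The rest of the path lives in S - v, so no vertex repeats.
  data SimplePath (S : Subset n) : ℕ → Fin n → Fin n → Set g where
    stop : ∀ {v} → v ∈ S → SimplePath S 0 v v
    step : ∀ {k v x y} → v ∈ S → Adj G v x → SimplePath (S - v) k x y → SimplePath S (suc k) v y

  -- Three outcomes: the path avoids `v`, or it leaves `v` for the last time through `x`, or it ends
  -- at `v`. An empty path carries no membership evidence, so `inj₁ ε` can also occur at `v` itself;
  -- the case where the next recursion level meets `x` equal to `v` sorts this out.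
  lastExit : ∀ {S u y} v → Star (AdjIn G S) u y →
             Star (AdjIn G (S - v)) u y ⊎ ∃[ x ] (Adj G v x × x ∈ S - v × Star (AdjIn G (S - v)) x y)
             ⊎ v ≡ y
  lastExit v ε = inj₁ ε
  lastExit {S} {u} v (_◅_ {j = x} (u∈S , x∈S , ux) p) with lastExit v p
  ... | inj₂ r = inj₂ r
  ... | inj₁ q with x Finₚ.≟ v
  lastExit v (_◅_ {j = x} (u∈S , x∈S , ux) p) | inj₁ ε | yes ≡.refl = inj₂ (inj₂ ≡.refl)
  lastExit {S} v (_◅_ {j = x} (u∈S , x∈S , ux) p) | inj₁ ((x∈ , _) ◅ _) | yes ≡.refl =
    ⊥-elim (∉- S v x∈)
  lastExit {u = u} v (_◅_ {j = x} (u∈S , x∈S , ux) p) | inj₁ q | no x≢v with u Finₚ.≟ v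
  ... | yes ≡.refl = inj₂ (inj₁ (x , ux , x∈p∧x≢y⇒x∈p-y x∈S x≢v , q))
  ... | no u≢v = inj₁ ((x∈p∧x≢y⇒x∈p-y u∈S u≢v , x∈p∧x≢y⇒x∈p-y x∈S x≢v , ux) ◅ q)

  -- Everything up to the last visit to `v` is dropped and `v` is removed from `S`. The recursion is
  -- on a bound for the size of `S`, which this removal lowers.
  simplify : ∀ {S v y} fuel → ∣ S ∣ ℕ.≤ fuel → v ∈ S → Star (AdjIn G S) v y →
             ∃[ k ] SimplePath S k v y
  simplify {S} {v} zero ∣S∣≤0 v∈S p =
    ⊥-elim (ℕₚ.n≮0 (ℕₚ.<-≤-trans (x∈p⇒∣p-x∣<∣p∣ v∈S) ∣S∣≤0))
  simplify {S} {v} {y} (suc fuel) ∣S∣≤ v∈S p with v Finₚ.≟ y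
  ... | yes ≡.refl = 0 , stop v∈S
  ... | no v≢y with lastExit v p
  ...   | inj₁ ε = ⊥-elim (v≢y ≡.refl)
  ...   | inj₁ ((v∈ , _) ◅ _) = ⊥-elim (∉- S v v∈)
  ...   | inj₂ (inj₂ v≡y) = ⊥-elim (v≢y v≡y)
  ...   | inj₂ (inj₁ (x , vx , x∈ , q)) =
    let k , sp = simplify fuel (ℕₚ.≤-pred (ℕₚ.<-≤-trans (x∈p⇒∣p-x∣<∣p∣ v∈S) ∣S∣≤)) x∈ q
    in suc k , step v∈S vx sp

  vertex : ∀ {S k v y} → SimplePath S k v y → Fin (suc k) → Fin n
  vertex {v = v} (stop _)     _       = v
  vertex {v = v} (step _ _ p) zero    = v
  vertex         (step _ _ p) (suc i) = vertex p i

  vertex∈ : ∀ {S k v y} (p : SimplePath S k v y) i → vertex p i ∈ S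
  vertex∈ (stop v∈)     _       = v∈
  vertex∈ (step v∈ _ p) zero    = v∈
  vertex∈ (step v∈ _ p) (suc i) = -⊆ (vertex∈ p i)

  vertex-first : ∀ {S k v y} (p : SimplePath S k v y) → vertex p zero ≡ v
  vertex-first (stop _)     = ≡.refl
  vertex-first (step _ _ _) = ≡.refl

  vertex-last : ∀ {S k v y} (p : SimplePath S k v y) → vertex p (fromℕ k) ≡ y
  vertex-last (stop _)     = ≡.refl
  vertex-last (step _ _ p) = vertex-last p

  vertex-injective : ∀ {S k v y} (p : SimplePath S k v y) → Injective _≡_ _≡_ (vertex p)
  vertex-injective (stop _) {zero} {zero} _ = ≡.refl
  vertex-injective (step _ _ _) {zero} {zero} _ = ≡.refl
  vertex-injective {S} (step _ _ p) {zero} {suc j} e = ⊥-elim (∉- S _ (≡.subst (_∈ _) (≡.sym e) (vertex∈ p j)))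
  vertex-injective {S} (step _ _ p) {suc i} {zero} e = ⊥-elim (∉- S _ (≡.subst (_∈ _) e (vertex∈ p i)))
  vertex-injective (step _ _ p) {suc i} {suc j} e = ≡.cong suc (vertex-injective p e)

  vertex-adj : ∀ {S k v y} (p : SimplePath S (suc k) v y) i →
               Adj G (vertex p (inject₁ i)) (vertex p (suc i))
  vertex-adj {v = v} (step _ vx p) zero = ≡.subst (Adj G v) (≡.sym (vertex-first p)) vx
  vertex-adj {k = suc k} (step _ _ p) (suc i) = vertex-adj p i

  -- Otherwise a simple path between the two neighbours, with `suc k` edges and so k + 2 vertices in
  -- `S`, would close up through `w`, which is outside `S`, to a cycle of length k + 3.
  neighbour-unique : (∀ {k} (c : Fin (3 ℕ.+ k) → Fin n) → ¬ Cycle G c) →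
    ∀ {S w v v′} → w ∉ S → v ∈ S → Adj G w v → Adj G w v′ → Star (AdjIn G S) v v′ → v ≡ v′
  neighbour-unique acyclic {S} {w} {v} {v′} w∉S v∈S wv wv′ p with simplify _ ℕₚ.≤-refl v∈S p
  ... | zero  , stop _ = ≡.refl
  ... | suc k , sp     = ⊥-elim (acyclic c (injective , adj ,
      ≡.subst (λ x → Adj G x w) (≡.sym (vertex-last sp)) (Graph.sym G wv′)))
    where
    c : Fin (3 ℕ.+ k) → Fin n
    c zero    = w
    c (suc i) = vertex sp i
    injective : Injective _≡_ _≡_ c
    injective {zero}  {zero}  _ = ≡.refl
    injective {zero}  {suc j} e = ⊥-elim (w∉S (≡.subst (_∈ S) (≡.sym e) (vertex∈ sp j)))
    injective {suc i} {zero}  e = ⊥-elim (w∉S (≡.subst (_∈ S) e (vertex∈ sp i)))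
    injective {suc i} {suc j} e = ≡.cong suc (vertex-injective sp e)
    adj : ∀ i → Adj G (c (inject₁ i)) (c (suc i))
    adj zero    = ≡.subst (Adj G w) (≡.sym (vertex-first sp)) wv
    adj (suc i) = vertex-adj sp i

∣S∣≡1⇒unique : ∀ {n} {S : Subset n} {i j} → ∣ S ∣ ≡ 1 → i ∈ S → j ∈ S → i ≡ j
∣S∣≡1⇒unique {S = S} ∣S∣≡1 i∈S j∈S with enum-surjective i∈S | enum-surjective j∈S
... | k , ≡.refl | l , ≡.refl = ≡.cong (enum S) (Fin1 ∣S∣≡1 k l)
  where
  Fin1 : ∀ {m} → m ≡ 1 → (k l : Fin m) → k ≡ l
  Fin1 ≡.refl zero zero = ≡.refl

-- Principal submatrices at full size, padded with zeros

module Masking {c ℓ} (R : CommutativeRing c ℓ) where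
  open CommutativeRing R hiding (zero; _-_)
  open Matrices rawRing
  open Sum semiring using (sum-cong-≋; ∑-distrib-+; *-distribˡ-sum; *-distribʳ-sum)
  open IntegerCoefficientSolver R
  open MatrixAlgebra R

  -- Abstract, so that with-abstraction over i ∈? S leaves mask folded.
  abstract
    mask : ∀ {n} → Subset n → Matrix n → Matrix n
    mask S A i j = if does (i ∈? S) ∧ does (j ∈? S) then A i j else 0#

    mask-in : ∀ {n} {S : Subset n} (A : Matrix n) {i j} → i ∈ S → j ∈ S → mask S A i j ≈ A i j
    mask-in {S = S} A {i} {j} i∈S j∈S
      rewrite dec-true (i ∈? S) i∈S | dec-true (j ∈? S) j∈S = refl

    mask-row : ∀ {n} {S : Subset n} (A : Matrix n) {i} j → i ∉ S → mask S A i j ≈ 0#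
    mask-row {S = S} A {i} j i∉S rewrite dec-false (i ∈? S) i∉S = refl

    mask-column : ∀ {n} {S : Subset n} (A : Matrix n) i {j} → j ∉ S → mask S A i j ≈ 0#
    mask-column {S = S} A i {j} j∉S
      rewrite dec-false (j ∈? S) j∉S | ∧-zeroʳ (does (i ∈? S)) = refl

  module _ {n} (S : Subset n) (w : Fin n) (w∈S : w ∈ S) (A : Matrix n) where

    mask-split-row : ∀ {i} → i ∈ S - w → ∀ k →
                     mask S A i k ≈ mask (S - w) A i k + 𝟙 w k * A i w
    mask-split-row {i} i∈ k with k Finₚ.≟ w
    ... | yes ≡.refl = trans (mask-in A (-⊆ i∈) w∈S) (trans (sym (+-identityˡ _)) (+-cong
      (sym (mask-column A i (∉- S w)))
      (trans (sym (*-identityˡ _)) (*-congʳ (sym (𝟙-same w))))))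
    ... | no k≢w = trans (at (k ∈? S)) (trans (sym (+-identityʳ _))
      (+-congˡ (sym (trans (*-congʳ (𝟙-diff (k≢w ∘ ≡.sym))) (zeroˡ _)))))
      where
      at : Dec (k ∈ S) → mask S A i k ≈ mask (S - w) A i k
      at (yes k∈S) = trans (mask-in A (-⊆ i∈) k∈S)
                           (sym (mask-in A i∈ (x∈p∧x≢y⇒x∈p-y k∈S k≢w)))
      at (no k∉S)  = trans (mask-column A i k∉S) (sym (mask-column A i (k∉S ∘ -⊆)))

    mask-split-column : ∀ {j} → j ∈ S - w → ∀ k →
                        mask S A k j ≈ mask (S - w) A k j + 𝟙 w k * A w j
    mask-split-column {j} j∈ k with k Finₚ.≟ w
    ... | yes ≡.refl = trans (mask-in A w∈S (-⊆ j∈)) (trans (sym (+-identityˡ _)) (+-cong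
      (sym (mask-row A j (∉- S w)))
      (trans (sym (*-identityˡ _)) (*-congʳ (sym (𝟙-same w))))))
    ... | no k≢w = trans (at (k ∈? S)) (trans (sym (+-identityʳ _))
      (+-congˡ (sym (trans (*-congʳ (𝟙-diff (k≢w ∘ ≡.sym))) (zeroˡ _)))))
      where
      at : Dec (k ∈ S) → mask S A k j ≈ mask (S - w) A k j
      at (yes k∈S) = trans (mask-in A k∈S (-⊆ j∈))
                           (sym (mask-in A (x∈p∧x≢y⇒x∈p-y k∈S k≢w) j∈))
      at (no k∉S)  = trans (mask-row A j k∉S) (sym (mask-row A j (k∉S ∘ -⊆)))

    -- Isolates the contribution of `w`. With its mirror image below, it turns commutation on `S`
    -- into commutation on `S - w` up to the two terms `A i w * X w j` and `X i w * A w j`.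
    mask-◁-split : ∀ (X : Matrix n) {i} → i ∈ S - w → ∀ j →
                   (mask S A i ◁ X) j ≈ (mask (S - w) A i ◁ X) j + A i w * X w j
    mask-◁-split X {i} i∈ j = trans
      (sum-cong-≋ λ k → trans (*-congʳ (mask-split-row i∈ k))
        (solve 4 (λ m d a x → (m :+ d :* a) :* x := m :* x :+ a :* (d :* x)) refl
          (mask (S - w) A i k) (𝟙 w k) (A i w) (X k j)))
      (trans (∑-distrib-+ (λ k → mask (S - w) A i k * X k j) λ k → A i w * (𝟙 w k * X k j))
        (+-congˡ (trans (sym (*-distribˡ-sum (A i w) (λ k → 𝟙 w k * X k j)))
                        (*-congˡ (𝟙-◁ X w j)))))

    ◁-mask-split : ∀ (X : Matrix n) i {j} → j ∈ S - w →
                   (X i ◁ mask S A) j ≈ (X i ◁ mask (S - w) A) j + X i w * A w j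
    ◁-mask-split X i {j} j∈ = trans
      (sum-cong-≋ λ k → trans (*-congˡ (mask-split-column j∈ k))
        (solve 4 (λ m d a x → x :* (m :+ d :* a) := x :* m :+ (d :* x) :* a) refl
          (mask (S - w) A k j) (𝟙 w k) (A w j) (X i k)))
      (trans (∑-distrib-+ (λ k → X i k * mask (S - w) A k j) λ k → (𝟙 w k * X i k) * A w j)
        (+-congˡ (trans (sym (*-distribʳ-sum (A w j) (λ k → 𝟙 w k * X i k)))
                        (*-congʳ (𝟙-◁ (λ k _ → X i k) w j)))))

-- A matrix that commutes with `A` off the root and vanishes on edges is zero

module Rigidity {c ℓ} (F : DiscreteField c ℓ) where
  open DiscreteField F renaming (commutativeRing to R) hiding (zero; _-_)
  open Matrices rawRing
  open Sum semiring using (sum-cong-≋)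
  open MatrixAlgebra R
  open Masking R
  open FieldLinearAlgebra F

  module _ {g n} (G : Graph n g) (A : Matrix n)
    (offEdge : ∀ {i j} → ¬ Adj G i j → A i j ≈ 0#)
    (onEdge : ∀ {i j} → Adj G i j → ¬ A i j ≈ 0#) where

    module _ {S v C} (isC : IsComponentAt G S v C) where
      open Component G isC

      -- No edge inside `S` leaves the component `C`, so the row of a vertex of `C` is already zero
      -- on the rest of `S`.
      mask-component-row : ∀ {i} → i ∈ C → ∀ k → mask S A i k ≈ mask C A i k
      mask-component-row {i} i∈C k with k ∈? S | k ∈? C
      ... | _       | yes k∈C = trans (mask-in A (⊆S i∈C) (⊆S k∈C)) (sym (mask-in A i∈C k∈C))
      ... | no k∉S  | no k∉C  = trans (mask-column A i k∉S) (sym (mask-column A i k∉C))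
      ... | yes k∈S | no k∉C  = trans (mask-in A (⊆S i∈C) k∈S)
        (trans (offEdge (k∉C ∘ closed i∈C k∈S)) (sym (mask-column A i k∉C)))

      mask-component-column : ∀ {j} → j ∈ C → ∀ k → mask S A k j ≈ mask C A k j
      mask-component-column {j} j∈C k with k ∈? S | k ∈? C
      ... | _       | yes k∈C = trans (mask-in A (⊆S k∈C) (⊆S j∈C)) (sym (mask-in A k∈C j∈C))
      ... | no k∉S  | no k∉C  = trans (mask-row A j k∉S) (sym (mask-row A j k∉C))
      ... | yes k∈S | no k∉C  = trans (mask-in A k∈S (⊆S j∈C))
        (trans (offEdge (k∉C ∘ closed j∈C k∈S ∘ Graph.sym G)) (sym (mask-row A j k∉C)))

    -- Simple eigenvalues force every eigenvector of the block diagonal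
    -- matrix to live on one component, where the commuting matrix vanishes.
    commutant-vanishes : ∀ {S} → EigenBasis (mask S A) S → (X : Matrix n) →
      (∀ {i j} → i ∈ S → j ∈ S → (mask S A i ◁ X) j ≈ (X i ◁ mask S A) j) →
      (∀ {i j} → i ∈ S → Star (AdjIn G S) i j → X i j ≈ 0#) →
      ∀ {i j} → i ∈ S → j ∈ S → X i j ≈ 0#
    commutant-vanishes {S} basis X comm sameComponent {i} {j} i∈S j∈S = trans
      (sym (mask-in X i∈S j∈S)) (trans (sym (𝟙-◁ X′ i j))
        (separates X′ annihilates (𝟙 i)
          (λ k k∉S → 𝟙-diff (λ i≡k → k∉S (≡.subst (_∈ S) i≡k i∈S))) j))
      where
      open EigenBasis basis
      B X′ : Matrix n
      B  = mask S A
      X′ = mask S X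

      comm′ : ∀ i j → (B i ◁ X′) j ≈ (X′ i ◁ B) j
      comm′ i j with i ∈? S | j ∈? S
      ... | no i∉S | _ = trans (◁-𝟘 X′ (λ k → mask-row A k i∉S) j)
                               (sym (◁-𝟘 B (λ k → mask-row X k i∉S) j))
      ... | yes _ | no j∉S = trans
        (sum-0 λ k → trans (*-congˡ (mask-column X k j∉S)) (zeroʳ _))
        (sym (sum-0 λ k → trans (*-congˡ (mask-column A k j∉S)) (zeroʳ _)))
      ... | yes i∈S | yes j∈S = trans (sum-cong-≋ left) (trans (comm i∈S j∈S) (sum-cong-≋ right))
        where
        left : ∀ k → B i k * X′ k j ≈ B i k * X k j
        left k with k ∈? S
        ... | yes k∈S = *-congˡ (mask-in X k∈S j∈S)
        ... | no k∉S  = trans (trans (*-congʳ (mask-column A i k∉S)) (zeroˡ _))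
                          (sym (trans (*-congʳ (mask-column A i k∉S)) (zeroˡ _)))
        right : ∀ k → X i k * B k j ≈ X′ i k * B k j
        right k with k ∈? S
        ... | yes k∈S = *-congʳ (sym (mask-in X i∈S k∈S))
        ... | no k∉S  = trans (trans (*-congˡ (mask-row A j k∉S)) (zeroʳ _))
                          (sym (trans (*-congˡ (mask-row A j k∉S)) (zeroʳ _)))

      module _ (k : Fin ∣ S ∣) (i : Fin n) (ui≉0 : ¬ u k i ≈ 0#) {C}
               (isC : IsComponentAt G S i C) where
        open Component G isC

        B-across : ∀ {a b} → a ∈ C → b ∉ C → B a b ≈ 0#
        B-across {a} a∈C b∉C = trans (mask-component-row isC a∈C _) (mask-column A a b∉C)

        B-across′ : ∀ {a b} → a ∉ C → b ∈ C → B a b ≈ 0#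
        B-across′ {b = b} a∉C b∈C = trans (mask-component-column isC b∈C _) (mask-row A b a∉C)

        -- The eigenvector with its entries on `C` erased. Since `B` has no entries between `C` and
        -- its complement, this is again in the eigenspace of `μ k`; it is zero at `i`, where `u k`
        -- is not, hence zero altogether. So `u k` lives on `C`.
        elsewhere : Fin n → Carrier
        elsewhere j = if does (j ∈? C) then 0# else u k j

        elsewhere-C : ∀ {j} → j ∈ C → elsewhere j ≈ 0#
        elsewhere-C {j} j∈C rewrite dec-true (j ∈? C) j∈C = refl

        elsewhere-∉ : ∀ {j} → j ∉ C → elsewhere j ≈ u k j
        elsewhere-∉ {j} j∉C rewrite dec-false (j ∈? C) j∉C = refl

        elsewhere-eigen : Eigenvector B (μ k) elsewhere
        elsewhere-eigen j with j ∈? C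
        ... | yes j∈C = trans (sum-0 term) (sym (zeroʳ _))
          where
          term : ∀ a → elsewhere a * B a j ≈ 0#
          term a with a ∈? C
          ... | yes a∈C = zeroˡ _
          ... | no a∉C  = trans (*-congˡ (B-across′ a∉C j∈C)) (zeroʳ _)
        ... | no j∉C = trans (sum-cong-≋ term) (eigen k j)
          where
          term : ∀ a → elsewhere a * B a j ≈ u k a * B a j
          term a with a ∈? C
          ... | yes a∈C = trans (zeroˡ _) (sym (trans (*-congˡ (B-across a∈C j∉C)) (zeroʳ _)))
          ... | no a∉C  = refl

        elsewhere-supported : SupportedOn S elsewhere
        elsewhere-supported j j∉S with j ∈? C
        ... | yes _ = refl
        ... | no _  = supported k j j∉S

        u-supported-C : ∀ {j} → j ∉ C → u k j ≈ 0#
        u-supported-C j∉C = trans (sym (elsewhere-∉ j∉C))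
          (simple k i elsewhere-supported elsewhere-eigen ui≉0 (elsewhere-C root∈) _)

        -- `X′` commutes with `B` and therefore maps the eigenspace of `μ k` to itself. That
        -- eigenspace is a line, so one zero entry of the image is enough.
        image-eigen : Eigenvector B (μ k) (u k ◁ X′)
        image-eigen j = trans (◁-assoc (u k) X′ B j)
          (trans (sum-cong-≋ λ a → *-congˡ (sym (comm′ a j)))
          (trans (sym (◁-assoc (u k) B X′ j))
          (trans (◁-cong {A = X′} (eigen k) (λ _ _ → refl) j)
                 (◁-scale (μ k) (u k) X′ j))))

        image-supported : SupportedOn S (u k ◁ X′)
        image-supported j j∉S = sum-0 λ a → trans (*-congˡ (mask-column X a j∉S)) (zeroʳ _)

        -- Only entries of `u k` on `C` contribute, and `X′` vanishes between vertices of the same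
        -- component.
        image-root : (u k ◁ X′) i ≈ 0#
        image-root = sum-0 term
          where
          term : ∀ a → u k a * X′ a i ≈ 0#
          term a with a ∈? C
          ... | no a∉C  = trans (*-congʳ (u-supported-C a∉C)) (zeroˡ _)
          ... | yes a∈C = trans (*-congˡ (trans (mask-in X (⊆S a∈C) v∈S)
                  (sameComponent (⊆S a∈C) (reverseIn G (reach a∈C))))) (zeroʳ _)

        image≋𝟘 : u k ◁ X′ ≋ 𝟘
        image≋𝟘 = simple k i image-supported image-eigen ui≉0 image-root

      annihilates : ∀ k → u k ◁ X′ ≋ 𝟘
      annihilates k j with nonzero k
      ... | i , ui≉0 with i ∈? S
      ...   | no i∉S  = ⊥-elim (ui≉0 (supported k i i∉S))
      ...   | yes i∈S = decidable-stable (_ ≟ 0#)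
        (¬¬-map (λ (C , isC) → image≋𝟘 k i ui≉0 isC j) (component G i∈S))

    -- The spectral content that the induction takes from the Duarte property: at every stage, the
    -- simple spectrum of the matrix with `w` deleted, in the form of an eigenbasis.
    data Branching (S : Subset n) (w : Fin n) : Set (c ⊔ ℓ ⊔ g) where
      single : w ∈ S → ∣ S ∣ ≡ 1 → Branching S w
      branch : w ∈ S → EigenBasis (mask (S - w) A) (S - w) →
               (∀ v C → Adj G w v → IsComponentAt G (S - w) v C → Branching C v) →
               Branching S w

    module _ (acyclic : ∀ {k} (c : Fin (3 ℕ.+ k) → Fin n) → ¬ Cycle G c)
             (X : Matrix n) (diagonal : ∀ i → X i i ≈ 0#)
             (edge : ∀ {i j} → Adj G i j → X i j ≈ 0#) where

      -- Row and column `w` of the commutator are left free. This form is inherited by the branches,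
      -- with the neighbour `v` in the role of `w`, whereas full commutation is not.
      CommutesOff : Subset n → Fin n → Set _
      CommutesOff S w = ∀ {i j} → i ∈ S → j ∈ S → i ≢ w → j ≢ w →
                        (mask S A i ◁ X) j ≈ (X i ◁ mask S A) j

      rigid : ∀ {S w} → Branching S w → (∀ {u v} → u ∈ S → v ∈ S → Star (AdjIn G S) u v) →
              CommutesOff S w → ∀ {i j} → i ∈ S → j ∈ S → X i j ≈ 0#
      rigid (single w∈S ∣S∣≡1) conn comm {i} i∈S j∈S
        with ≡.refl ← ∣S∣≡1⇒unique ∣S∣≡1 i∈S j∈S = diagonal i
      rigid {S} {w} (branch w∈S basis sub) conn comm = all
        where
        S′ = S - w

        ∈⇒≢ : ∀ {i} → i ∈ S′ → i ≢ w
        ∈⇒≢ i∈ ≡.refl = ∉- S w i∈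

        split : ∀ {i j} → i ∈ S′ → j ∈ S′ →
                (mask S′ A i ◁ X) j + A i w * X w j ≈ (X i ◁ mask S′ A) j + X i w * A w j
        split {i} {j} i∈ j∈ = trans (sym (mask-◁-split S w w∈S A X i∈ j))
          (trans (comm (-⊆ i∈) (-⊆ j∈) (∈⇒≢ i∈) (∈⇒≢ j∈)) (◁-mask-split S w w∈S A X i j∈))

        module _ {v C} (wv : Adj G w v) (isC : IsComponentAt G S′ v C) where
          open Component G isC

          notAdjacent : ∀ {j} → j ∈ C → j ≢ v → ¬ Adj G w j
          notAdjacent j∈C j≢v wj = j≢v (≡.sym
            (neighbour-unique G acyclic (∉- S w) v∈S wv wj (reach j∈C)))

          A-row : ∀ {j} → j ∈ C → j ≢ v → A w j ≈ 0#
          A-row j∈C j≢v = offEdge (notAdjacent j∈C j≢v)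

          A-column : ∀ {j} → j ∈ C → j ≢ v → A j w ≈ 0#
          A-column j∈C j≢v = offEdge (notAdjacent j∈C j≢v ∘ Graph.sym G)

          toC-left : ∀ {i} → i ∈ C → ∀ j → (mask S′ A i ◁ X) j ≈ (mask C A i ◁ X) j
          toC-left i∈C = ◁-cong {A = X} (mask-component-row isC i∈C) (λ _ _ → refl)

          toC-right : ∀ i {j} → j ∈ C → (X i ◁ mask S′ A) j ≈ (X i ◁ mask C A) j
          toC-right i j∈C = sum-cong-≋ λ k → *-congˡ (mask-component-column isC j∈C k)

          -- The tree has no second edge from `w` into `C`, so the factors `A i w` and `A w j` in
          -- `split` vanish for `i` and `j` other than `v`.
          commC : CommutesOff C v
          commC {i} {j} i∈C j∈C i≢v j≢v = trans (sym (toC-left i∈C j)) (trans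
            (trans (sym (+-identityʳ _)) (+-congˡ (sym (trans (*-congʳ (A-column i∈C i≢v)) (zeroˡ _)))))
            (trans (split (⊆S i∈C) (⊆S j∈C)) (trans
            (trans (+-congˡ (trans (*-congˡ (A-row j∈C j≢v)) (zeroʳ _))) (+-identityʳ _))
            (toC-right i j∈C))))

          X-component : ∀ {i j} → i ∈ C → j ∈ C → X i j ≈ 0#
          X-component = rigid (sub v C wv isC) connected commC

          left-0 : ∀ {i j} → i ∈ C → j ∈ C → (mask S′ A i ◁ X) j ≈ 0#
          left-0 {i} {j} i∈C j∈C = trans (toC-left i∈C j) (sum-0 term)
            where
            term : ∀ k → mask C A i k * X k j ≈ 0#
            term k with k ∈? C
            ... | yes k∈C = trans (*-congˡ (X-component k∈C j∈C)) (zeroʳ _)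
            ... | no k∉C  = trans (*-congʳ (mask-column A i k∉C)) (zeroˡ _)

          right-0 : ∀ {i j} → i ∈ C → j ∈ C → (X i ◁ mask S′ A) j ≈ 0#
          right-0 {i} {j} i∈C j∈C = trans (toC-right i j∈C) (sum-0 term)
            where
            term : ∀ k → X i k * mask C A k j ≈ 0#
            term k with k ∈? C
            ... | yes k∈C = trans (*-congʳ (X-component i∈C k∈C)) (zeroˡ _)
            ... | no k∉C  = trans (*-congˡ (mask-row A j k∉C)) (zeroʳ _)

          -- With `X` zero on `C`, only the terms through `w` remain in `split`. Setting one index
          -- to `v` gives a nonzero edge entry on one side, while the entry of `A` on the other side
          -- is zero for any index other than `v`.
          cross : ∀ {i j} → i ∈ C → j ∈ C → A i w * X w j ≈ X i w * A w j
          cross i∈C j∈C = trans (sym (+-identityˡ _)) (trans (+-congʳ (sym (left-0 i∈C j∈C)))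
            (trans (split (⊆S i∈C) (⊆S j∈C))
            (trans (+-congʳ (right-0 i∈C j∈C)) (+-identityˡ _))))

          X-row : ∀ {j} → j ∈ C → X w j ≈ 0#
          X-row {j} j∈C with j Finₚ.≟ v
          ... | yes ≡.refl = edge wv
          ... | no j≢v = zero-product (onEdge (Graph.sym G wv)) (trans (cross root∈ j∈C)
            (trans (*-congˡ (A-row j∈C j≢v)) (zeroʳ _)))

          X-column : ∀ {i} → i ∈ C → X i w ≈ 0#
          X-column {i} i∈C with i Finₚ.≟ v
          ... | yes ≡.refl = edge (Graph.sym G wv)
          ... | no i≢v = zero-product (onEdge wv) (trans (*-comm _ _) (trans
            (sym (cross i∈C root∈)) (trans (*-congʳ (A-column i∈C i≢v)) (zeroˡ _))))

        -- The branch containing `i` exists only under a double negation. The goal is an equation,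
        -- decidable in the field, so the double negation can be removed.
        inComponent : ∀ {i j} → i ∈ S′ →
                      (∀ {v C} → Adj G w v → IsComponentAt G S′ v C → i ∈ C → X i j ≈ 0#) →
                      X i j ≈ 0#
        inComponent {i} {j} i∈ f with firstArrival G (-⊆ i∈) (∈⇒≢ i∈) (conn (-⊆ i∈) w∈S)
        ... | v , v∈ , vw , p = decidable-stable (X i j ≟ 0#) (¬¬-map
          (λ (C , isC) → f (Graph.sym G vw) isC (Component.reached G isC (reverseIn G p)))
          (component G v∈))

        X-column′ : ∀ {i} → i ∈ S′ → X i w ≈ 0#
        X-column′ i∈ = inComponent i∈ λ wv isC → X-column wv isC

        X-row′ : ∀ {j} → j ∈ S′ → X w j ≈ 0#
        X-row′ {j} j∈ with firstArrival G (-⊆ j∈) (∈⇒≢ j∈) (conn (-⊆ j∈) w∈S)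
        ... | v , v∈ , vw , p = decidable-stable (X w j ≟ 0#) (¬¬-map
          (λ (C , isC) → X-row (Graph.sym G vw) isC (Component.reached G isC (reverseIn G p)))
          (component G v∈))

        inner : ∀ {i j} → i ∈ S′ → j ∈ S′ → X i j ≈ 0#
        inner = commutant-vanishes basis X
          (λ {i} {j} i∈ j∈ → trans (sym (+-identityʳ _))
            (trans (+-congˡ (sym (trans (*-congˡ (X-row′ j∈)) (zeroʳ _))))
            (trans (split i∈ j∈)
            (trans (+-congˡ (trans (*-congʳ (X-column′ i∈)) (zeroˡ _))) (+-identityʳ _)))))
          (λ i∈ p → inComponent i∈ λ wv isC i∈C → X-component wv isC i∈C
            (Component.reached G isC (Component.reach G isC i∈C ◅◅ p)))

        all : ∀ {i j} → i ∈ S → j ∈ S → X i j ≈ 0#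
        all {i} {j} i∈S j∈S with i Finₚ.≟ w | j Finₚ.≟ w
        ... | yes ≡.refl | yes ≡.refl = diagonal i
        ... | yes ≡.refl | no j≢w     = X-row′ (x∈p∧x≢y⇒x∈p-y j∈S j≢w)
        ... | no i≢w     | yes ≡.refl = X-column′ (x∈p∧x≢y⇒x∈p-y i∈S i≢w)
        ... | no i≢w     | no j≢w     =
          inner (x∈p∧x≢y⇒x∈p-y i∈S i≢w) (x∈p∧x≢y⇒x∈p-y j∈S j≢w)

-- Odd polynomials in skew matrices

module OddPowers {c ℓ} (R : CommutativeRing c ℓ) where
  open CommutativeRing R hiding (zero; _-_)
  open RingProperties ring using (-0#≈0#)
  open Matrices rawRing
  open Sum semiring using (sum-cong-≋; ∑-comm; *-distribˡ-sum; *-distribʳ-sum)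
  open IntegerCoefficientSolver R
  open MatrixAlgebra R
  open Masking R

  Skew : ∀ {n} → Matrix n → Set ℓ
  Skew A = ∀ i j → A j i ≈ - A i j

  power-cong : ∀ {n} {A B : Matrix n} → A ≋ᴹ B → ∀ k → power A k ≋ᴹ power B k
  power-cong A≋B zero    i j = refl
  power-cong A≋B (suc k) i j = ◁-cong (A≋B i) (power-cong A≋B k) j

  power-comm : ∀ {n} (A : Matrix n) k → power A (suc k) ≋ᴹ (power A k ⊛ A)
  power-comm A zero    i j = trans (◁-𝟙 (A i) j) (sym (𝟙-◁ A i j))
  power-comm A (suc k) i j = trans
    (◁-cong {u = A i} (λ _ → refl) (power-comm A k) j)
    (sym (◁-assoc (A i) (power A k) A j))

  power-+ : ∀ {n} (A : Matrix n) k l → (power A k ⊛ power A l) ≋ᴹ power A (k ℕ.+ l)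
  power-+ A zero    l i j = 𝟙-◁ (power A l) i j
  power-+ A (suc k) l i j = trans (◁-assoc (A i) (power A k) (power A l) j)
    (◁-cong {u = A i} (λ _ → refl) (power-+ A k l) j)

  module _ {n} {A : Matrix n} (skew : Skew A) where
    -- Transposing `A ⊛ power A k` contributes one sign from the skew factor and reverses the
    -- product; `power-comm` restores the order. The sign `s` thus records the parity of the
    -- exponent.
    power-transpose : ∀ k {s} → (∀ i j → power A k j i ≈ s * power A k i j) →
                      ∀ i j → power A (suc k) j i ≈ - s * power A (suc k) i j
    power-transpose k {s} h i j = trans
      (sum-cong-≋ λ l → trans (*-cong (skew l j) (h i l))
        (solve 3 (λ a s p → (:- a) :* (s :* p) := (:- s) :* (p :* a)) refl
          (A l j) s (power A k i l)))
      (trans (sym (*-distribˡ-sum (- s) (λ l → power A k i l * A l j)))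
             (*-congˡ (sym (power-comm A k i j))))

    power-even : ∀ p i j → power A (double p) j i ≈ 1# * power A (double p) i j
    power-odd  : ∀ p i j → power A (suc (double p)) j i ≈ - 1# * power A (suc (double p)) i j
    power-even zero    i j = trans (sym (◁-𝟙 (𝟙 j) i)) (trans (◁-comm-𝟙 i j) (sym (*-identityˡ _)))
      where
      ◁-comm-𝟙 : ∀ i j → (𝟙 j ◁ 𝟙) i ≈ 𝟙 i j
      ◁-comm-𝟙 i j with i Finₚ.≟ j
      ... | yes ≡.refl = trans (◁-𝟙 (𝟙 i) i) (𝟙-same i)
      ... | no i≢j     = trans (◁-𝟙 (𝟙 j) i) (𝟙-diff (i≢j ∘ ≡.sym))
    power-even (suc p) i j = trans (power-transpose (suc (double p)) (power-odd p) i j)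
      (*-congʳ (solve 0 (:- (:- con (+ 1)) := con (+ 1)) refl))
    power-odd p i j = power-transpose (double p) (power-even p) i j

  mask-skew : ∀ {n} (S : Subset n) {A : Matrix n} → Skew A → Skew (mask S A)
  mask-skew S {A} skew i j with i ∈? S | j ∈? S
  ... | no i∉  | _      = trans (mask-column A j i∉) (sym (trans (-‿cong (mask-row A j i∉)) -0#≈0#))
  ... | yes _  | no j∉  = trans (mask-row A i j∉) (sym (trans (-‿cong (mask-column A i j∉)) -0#≈0#))
  ... | yes i∈ | yes j∈ = trans (mask-in A j∈ i∈)
    (trans (skew i j) (-‿cong (sym (mask-in A i∈ j∈))))

  -- a p is the coefficient of degree 2p + 1.
  oddPolynomial : ∀ {m n} → (Fin m → Carrier) → Matrix n → Matrix n
  oddPolynomial a M i j = sum (λ p → a p * power M (suc (double (toℕ p))) i j)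

  oddPolynomial-skew : ∀ {m n} (a : Fin m → Carrier) {M : Matrix n} → Skew M →
                       Skew (oddPolynomial a M)
  oddPolynomial-skew a {M} skew i j = trans
    (sum-cong-≋ λ p → trans (*-congˡ (power-odd skew (toℕ p) i j))
      (solve 2 (λ a x → a :* (:- con (+ 1) :* x) := :- (a :* x)) refl
        (a p) (power M (suc (double (toℕ p))) i j)))
    (sum-neg (λ p → a p * power M (suc (double (toℕ p))) i j))

  ◁-oddPolynomial : ∀ {m n} (v : Fin n → Carrier) (a : Fin m → Carrier) (M : Matrix n) j →
    (v ◁ oddPolynomial a M) j ≈ sum (λ p → a p * (v ◁ power M (suc (double (toℕ p)))) j)
  ◁-oddPolynomial v a M j = trans
    (sum-cong-≋ λ i → *-distribˡ-sum (v i) (λ p → a p * P p i j))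
    (trans (∑-comm (λ i p → v i * (a p * P p i j)))
    (sum-cong-≋ λ p → trans
      (sum-cong-≋ λ i → solve 3 (λ v a x → v :* (a :* x) := a :* (v :* x)) refl (v i) (a p) (P p i j))
      (sym (*-distribˡ-sum (a p) (λ i → v i * P p i j)))))
    where
    P = λ p → power M (suc (double (toℕ p)))

  oddPolynomial-comm : ∀ {m n} (a : Fin m → Carrier) (M : Matrix n) i j →
    (M i ◁ oddPolynomial a M) j ≈ (oddPolynomial a M i ◁ M) j
  oddPolynomial-comm a M i j = trans (◁-oddPolynomial (M i) a M j)
    (trans (sum-cong-≋ λ p → trans (*-congˡ (power-comm M (suc (double (toℕ p))) i j))
                                   (*-distribˡ-sum (a p) (λ k → P p i k * M k j)))
    (trans (∑-comm (λ p k → a p * (P p i k * M k j)))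
    (sum-cong-≋ λ k → trans
      (sum-cong-≋ λ p → sym (*-assoc (a p) (P p i k) (M k j)))
      (sym (*-distribʳ-sum (M k j) (λ p → a p * P p i k))))))
    where
    P = λ p → power M (suc (double (toℕ p)))

  -- Every term begins with a factor `M`; a constant term would spoil this.
  oddPolynomial-row : ∀ {m n} (a : Fin m → Carrier) {M : Matrix n} {i} →
                      M i ≋ 𝟘 → oddPolynomial a M i ≋ 𝟘
  oddPolynomial-row a {M} {i} Mi≋0 j =
    sum-0 {f = λ p → a p * power M (suc (double (toℕ p))) i j} λ p → trans (*-congˡ (◁-𝟘 (power M (double (toℕ p))) Mi≋0 j)) (zeroʳ _)

-- Linear independence of the odd powers of `A` and `A(w)` on the edges

module Independence {c ℓ} (F : DiscreteField c ℓ) where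
  open DiscreteField F renaming (commutativeRing to R) hiding (zero; _-_)
  open RingProperties ring using (-0#≈0#)
  open RawSemiringDefinitions (RawRing.rawSemiring rawRing) using (_^_)
  open Matrices rawRing
  open Sum semiring using (sum-cong-≋; ∑-distrib-+; *-distribʳ-sum)
  open IntegerCoefficientSolver R
  open MatrixAlgebra R
  open Masking R
  open OddPowers R
  open FieldLinearAlgebra F
  open Rigidity F

  eigenvector-power : ∀ {n} {M : Matrix n} {μ v} → Eigenvector M μ v →
                      ∀ k → Eigenvector (power M k) (μ ^ k) v
  eigenvector-power {v = v} eig zero j = trans (◁-𝟙 v j) (sym (*-identityˡ _))
  eigenvector-power {M = M} {μ} {v} eig (suc k) j = trans (sym (◁-assoc v M (power M k) j))
    (trans (◁-cong {A = power M k} eig (λ _ _ → refl) j)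
    (trans (◁-scale μ v (power M k) j)
    (trans (*-congˡ (eigenvector-power eig k j)) (sym (*-assoc μ (μ ^ k) (v j))))))

  eigenvector-oddPolynomial : ∀ {m n} (a : Fin m → Carrier) {M : Matrix n} {μ v} →
    Eigenvector M μ v → Eigenvector (oddPolynomial a M) (eval (spread a) μ) v
  eigenvector-oddPolynomial a {M} {μ} {v} eig j = trans (◁-oddPolynomial v a M j)
    (trans (sum-cong-≋ λ p → trans
      (*-congˡ (eigenvector-power eig (suc (double (toℕ p))) j))
      (sym (*-assoc (a p) (μ ^ suc (double (toℕ p))) (v j))))
    (trans (sym (*-distribʳ-sum (v j) (λ p → a p * μ ^ suc (double (toℕ p)))))
           (*-congʳ (sym (eval-spread a μ)))))

  -- The image of `u k` is the value of the polynomial at `μ k` times `u k`, so a single entry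
  -- decides whether `μ k` is a root. Asking for one entry only matters for `A`, where column `w`
  -- alone is known to vanish.
  oddPolynomial-injective : ∀ {m n} {S : Subset n} {M : Matrix n} (basis : EigenBasis M S)
    (a : Fin m → Carrier) → double m ℕ.≤ ∣ S ∣ →
    (∀ k → ∃[ j ] (¬ EigenBasis.u basis k j ≈ 0# × (EigenBasis.u basis k ◁ oddPolynomial a M) j ≈ 0#)) →
    a ≋ 𝟘
  oddPolynomial-injective basis a deg≤ zeros = spread-𝟘 a
    (vanishing-polynomial (spread a) μ deg≤ distinct λ k →
      let j , ukj≉0 , e = zeros k in zero-product ukj≉0
        (trans (*-comm _ _) (trans (sym (eigenvector-oddPolynomial a (eigen k) j)) e)))
    where open EigenBasis basis

  module _ (x≈-x⇒x≈0 : ∀ {x} → x ≈ - x → x ≈ 0#) {g n} (G : Graph n g)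
    (connected : ∀ u v → Star (Adj G) u v)
    (acyclic : ∀ {k} (c : Fin (3 ℕ.+ k) → Fin n) → ¬ Cycle G c)
    (A : Matrix n) (skew : Skew A)
    (offEdge : ∀ {i j} → ¬ Adj G i j → A i j ≈ 0#)
    (onEdge : ∀ {i j} → Adj G i j → ¬ A i j ≈ 0#)
    (w : Fin n) (branching : Branching G A offEdge onEdge ⊤ w)
    (basisA : EigenBasis A ⊤) (basisB : EigenBasis (mask (⊤ - w) A) (⊤ - w))
    (separate : ∀ k l → ¬ EigenBasis.μ basisB l ≈ EigenBasis.μ basisA k)
    {m m′} (a : Fin m → Carrier) (b : Fin m′ → Carrier)
    (m≤ : double m ℕ.≤ ∣ ⊤ {n} ∣) (m′≤ : double m′ ℕ.≤ ∣ ⊤ - w ∣) where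

    private
      B P Q X : Matrix n
      B = mask (⊤ - w) A
      P = oddPolynomial a A
      Q = oddPolynomial b B
      X i j = P i j + Q i j

      ∈⊤- : ∀ {i} → i ≢ w → i ∈ ⊤ - w
      ∈⊤- = x∈p∧x≢y⇒x∈p-y ∈⊤

      B-skew : Skew B
      B-skew = mask-skew (⊤ - w) skew

      Q-row : ∀ j → Q w j ≈ 0#
      Q-row = oddPolynomial-row b (λ k → mask-row A k (∉- ⊤ w))

      Q-column : ∀ i → Q i w ≈ 0#
      Q-column i = trans (oddPolynomial-skew b B-skew w i) (trans (-‿cong (Q-row i)) -0#≈0#)

      X-skew : Skew X
      X-skew i j = trans
        (+-cong (oddPolynomial-skew a skew i j) (oddPolynomial-skew b B-skew i j))
        (solve 2 (λ p q → :- p :+ :- q := :- (p :+ q)) refl (P i j) (Q i j))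

      mask-⊤ : ∀ i j → mask ⊤ A i j ≈ A i j
      mask-⊤ i j = mask-in A ∈⊤ ∈⊤

      -- Off row `w`, the matrices `A` and `B` differ only in the entry at column `w`, which meets
      -- the zero row `w` of `Q`.
      A◁Q : ∀ {i} j → i ≢ w → (A i ◁ Q) j ≈ (B i ◁ Q) j
      A◁Q {i} j i≢w = sum-cong-≋ term
        where
        term : ∀ k → A i k * Q k j ≈ B i k * Q k j
        term k with k Finₚ.≟ w
        ... | yes ≡.refl = trans (trans (*-congˡ (Q-row j)) (zeroʳ _))
                             (sym (trans (*-congˡ (Q-row j)) (zeroʳ _)))
        ... | no k≢w     = *-congʳ (sym (mask-in A (∈⊤- i≢w) (∈⊤- k≢w)))

      Q◁A : ∀ i {j} → j ≢ w → (Q i ◁ A) j ≈ (Q i ◁ B) j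
      Q◁A i {j} j≢w = sum-cong-≋ term
        where
        term : ∀ k → Q i k * A k j ≈ Q i k * B k j
        term k with k Finₚ.≟ w
        ... | yes ≡.refl = trans (trans (*-congʳ (Q-column i)) (zeroˡ _))
                             (sym (trans (*-congʳ (Q-column i)) (zeroˡ _)))
        ... | no k≢w     = *-congˡ (sym (mask-in A (∈⊤- k≢w) (∈⊤- j≢w)))

      ◁-+ : ∀ (v : Fin n → Carrier) j → (v ◁ X) j ≈ (v ◁ P) j + (v ◁ Q) j
      ◁-+ v j = trans (sum-cong-≋ λ k → distribˡ (v k) (P k j) (Q k j))
        (∑-distrib-+ (λ k → v k * P k j) (λ k → v k * Q k j))

      commutes : ∀ {i j} → i ≢ w → j ≢ w → (mask ⊤ A i ◁ X) j ≈ (X i ◁ mask ⊤ A) j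
      commutes {i} {j} i≢w j≢w = trans (◁-cong {A = X} (mask-⊤ i) (λ _ _ → refl) j)
        (trans (◁-+ (A i) j)
        (trans (+-cong (oddPolynomial-comm a A i j)
                 (trans (A◁Q j i≢w) (trans (oddPolynomial-comm b B i j) (sym (Q◁A i j≢w)))))
        (trans (sym (∑-distrib-+ (λ k → P i k * A k j) (λ k → Q i k * A k j)))
               (sum-cong-≋ λ k → trans (sym (distribʳ (A k j) (P i k) (Q i k)))
                                       (*-congˡ (sym (mask-⊤ k j)))))))

      star-⊤ : ∀ {u v} → Star (Adj G) u v → Star (AdjIn G ⊤) u v
      star-⊤ ε       = ε
      star-⊤ (e ◅ p) = (∈⊤ , ∈⊤ , e) ◅ star-⊤ p

      open EigenBasis basisA

      -- An eigenvector of `A` that vanishes at `w` would be an eigenvector of `B` supported off `w`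
      -- with the same eigenvalue, and strict interlacing leaves no common eigenvalue.
      u-w≉0 : ∀ k → ¬ u k w ≈ 0#
      u-w≉0 k ukw≈0 = let j , ukj≉0 = nonzero k in ukj≉0
        (EigenBasis.non-eigenvalue basisB supp eig (separate k) j)
        where
        supp : SupportedOn (⊤ - w) (u k)
        supp j j∉ with j Finₚ.≟ w
        ... | yes ≡.refl = ukw≈0
        ... | no j≢w     = ⊥-elim (j∉ (∈⊤- j≢w))
        eig : Eigenvector B (μ k) (u k)
        eig j with j Finₚ.≟ w
        ... | yes ≡.refl = trans
          (sum-0 λ i → trans (*-congˡ (mask-column A i (∉- ⊤ w))) (zeroʳ _))
          (sym (trans (*-congˡ ukw≈0) (zeroʳ _)))
        ... | no j≢w = trans (sum-cong-≋ term) (eigen k j)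
          where
          term : ∀ i → u k i * B i j ≈ u k i * A i j
          term i with i Finₚ.≟ w
          ... | yes ≡.refl = trans (trans (*-congʳ ukw≈0) (zeroˡ _))
                               (sym (trans (*-congʳ ukw≈0) (zeroˡ _)))
          ... | no i≢w     = *-congˡ (mask-in A (∈⊤- i≢w) (∈⊤- j≢w))

    independent : (∀ {i j} → i Fin.< j → Adj G i j →
                   oddPolynomial a A i j + oddPolynomial b (mask (⊤ - w) A) i j ≈ 0#) →
                  a ≋ 𝟘 × b ≋ 𝟘
    independent edge = a≋0 , oddPolynomial-injective basisB b m′≤ λ k →
        let j , ukj≉0 = EigenBasis.nonzero basisB k in j , ukj≉0 , Q-zero k j
      where
      edge′ : ∀ {i j} → Adj G i j → X i j ≈ 0#
      edge′ {i} {j} ij with Finₚ.<-cmp i j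
      ... | tri< i<j _ _    = edge i<j ij
      ... | tri≈ _ ≡.refl _ = ⊥-elim (Graph.irrefl G ij)
      ... | tri> _ _ j<i    = trans (X-skew j i) (trans (-‿cong (edge j<i (Graph.sym G ij))) -0#≈0#)
      X≋0 : ∀ i j → X i j ≈ 0#
      X≋0 i j = rigid G A offEdge onEdge acyclic X (λ i → x≈-x⇒x≈0 (X-skew i i)) edge′ branching
        (λ {u} {v} _ _ → star-⊤ (connected u v)) (λ _ _ → commutes) ∈⊤ ∈⊤
      a≋0 : a ≋ 𝟘
      a≋0 = oddPolynomial-injective basisA a m≤ λ k → w , u-w≉0 k ,
        trans (sym (+-identityʳ _)) (trans
          (+-congˡ (sym (sum-0 λ i → trans (*-congˡ (Q-column i)) (zeroʳ _))))
          (trans (sym (◁-+ (u k) w)) (sum-0 λ i → trans (*-congˡ (X≋0 i w)) (zeroʳ _))))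
      Q-zero : ∀ k j → (EigenBasis.u basisB k ◁ Q) j ≈ 0#
      Q-zero k j = sum-0 λ i → trans (*-congˡ (trans (sym (+-identityˡ _)) (trans
        (+-congʳ (sym (sum-0 λ p → trans (*-congʳ (a≋0 p)) (zeroˡ _)))) (X≋0 i j)))) (zeroʳ _)

-- Directional derivatives of traces of powers

module PowerDerivative {c ℓ} (R : CommutativeRing c ℓ) where
  open CommutativeRing R hiding (zero; _-_)
  open Matrices rawRing
  open Sum semiring using (sum-cong-≋; ∑-distrib-+; ∑-comm; *-distribˡ-sum; sum-init-last)
  open Mult semiring using () renaming (_×_ to _·_)
  open IntegerCoefficientSolver R
  open MatrixAlgebra R
  open Masking R
  open OddPowers R

  -- The product rule for `power` at `M` in direction `D`. The factors of the second term stand in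
  -- the order in which `expansion-*` delivers them.
  powerDerivative : ∀ {n} → Matrix n → Matrix n → ℕ → Matrix n
  powerDerivative D M zero    i j = 0#
  powerDerivative D M (suc k) i j =
    sum (λ l → M i l * powerDerivative D M k l j + power M k l j * D i l)

  ⊛-assoc : ∀ {n} (A B C : Matrix n) → ((A ⊛ B) ⊛ C) ≋ᴹ (A ⊛ (B ⊛ C))
  ⊛-assoc A B C i = ◁-assoc (A i) B C

  tr-cong : ∀ {n} {A B : Matrix n} → A ≋ᴹ B → tr A ≈ tr B
  tr-cong A≋B = sum-cong-≋ λ i → A≋B i i

  tr-comm : ∀ {n} (A B : Matrix n) → tr (A ⊛ B) ≈ tr (B ⊛ A)
  tr-comm A B = trans (∑-comm (λ i k → A i k * B k i))
    (sum-cong-≋ λ k → sum-cong-≋ λ i → *-comm (A i k) (B k i))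

  -- The extra factor `power M l` carries the induction: cyclicity of the trace moves the leading
  -- `M` of `M ⊛ D′` to the right end, where it raises `l` by one.
  tr-powerDerivative-⊛ : ∀ {n} (D M : Matrix n) k l →
    tr (powerDerivative D M (suc k) ⊛ power M l) ≈ (suc k · 1#) * tr (D ⊛ power M (k ℕ.+ l))
  tr-powerDerivative-⊛ {n} D M k l = trans
    (tr-cong (λ i → ◁-cong {u = powerDerivative D M (suc k) i} {B = power M l}
      (λ j → trans (∑-distrib-+ (λ a → M i a * D′ a j) (λ a → power M k a j * D i a))
                   (+-congˡ (sum-cong-≋ λ a → *-comm (power M k a j) (D i a)))) (λ _ _ → refl)))
    (trans (sum-cong-≋ λ i → trans
      (sum-cong-≋ λ j → distribʳ (power M l j i) ((M ⊛ D′) i j) ((D ⊛ power M k) i j))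
      (∑-distrib-+ (λ j → (M ⊛ D′) i j * power M l j i) (λ j → (D ⊛ power M k) i j * power M l j i)))
    (trans (∑-distrib-+ (λ i → ((M ⊛ D′) ⊛ power M l) i i) (λ i → ((D ⊛ power M k) ⊛ power M l) i i))
    (trans (+-cong (left k) right)
      (solve 2 (λ n t → n :* t :+ t := (con (+ 1) :+ n) :* t) refl (k · 1#) T))))
    where
    D′ = powerDerivative D M k
    T  = tr (D ⊛ power M (k ℕ.+ l))
    right : tr ((D ⊛ power M k) ⊛ power M l) ≈ T
    right = tr-cong λ i j → trans (⊛-assoc D (power M k) (power M l) i j)
      (◁-cong {u = D i} (λ _ → refl) (power-+ M k l) j)
    left : ∀ k → tr ((M ⊛ powerDerivative D M k) ⊛ power M l) ≈ (k · 1#) * tr (D ⊛ power M (k ℕ.+ l))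
    left zero = trans
      (sum-0 λ i → ◁-𝟘 {v = (M ⊛ powerDerivative D M 0) i} (power M l)
        (λ j → sum-0 {f = λ a → M i a * 0#} λ a → zeroʳ (M i a)) i)
      (sym (zeroˡ _))
    left (suc k) = trans (tr-cong (⊛-assoc M E (power M l)))
      (trans (tr-comm M (E ⊛ power M l))
      (trans (tr-cong (⊛-assoc E (power M l) M))
      (trans (tr-cong λ i j → ◁-cong {u = E i} (λ _ → refl) (λ a b → sym (power-comm M l a b)) j)
      (trans (tr-powerDerivative-⊛ D M k (suc l))
             (*-congˡ (reflexive (≡.cong (λ p → tr (D ⊛ power M p)) (ℕₚ.+-suc k l))))))))
      where E = powerDerivative D M (suc k)

  tr-powerDerivative : ∀ {n} (D M : Matrix n) k →
    tr (powerDerivative D M (suc k)) ≈ (suc k · 1#) * tr (D ⊛ power M k)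
  tr-powerDerivative D M k = trans
    (tr-cong λ i j → sym (◁-𝟙 (powerDerivative D M (suc k) i) j))
    (trans (tr-powerDerivative-⊛ D M k 0)
      (*-congˡ (reflexive (≡.cong (λ p → tr (D ⊛ power M p)) (ℕₚ.+-identityʳ k)))))

  edgeMatrix : ∀ {n} → Fin n → Fin n → Matrix n
  edgeMatrix p q i j = 𝟙 p i * 𝟙 q j + - (𝟙 q i * 𝟙 p j)

  edgeMatrix-skew : ∀ {n} (p q : Fin n) → Skew (edgeMatrix p q)
  edgeMatrix-skew p q i j = solve 4 (λ a b c d → a :* b :+ :- (c :* d) := :- (d :* c :+ :- (b :* a)))
    refl (𝟙 p j) (𝟙 q i) (𝟙 q j) (𝟙 p i)

  tr-edgeMatrix : ∀ {n} (p q : Fin n) (P : Matrix n) →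
                  tr (edgeMatrix p q ⊛ P) ≈ P q p + - P p q
  tr-edgeMatrix p q P = trans
    (sum-cong-≋ λ i → trans
      (sum-cong-≋ λ j → solve 5
        (λ a b c d x → (a :* b :+ :- (c :* d)) :* x := a :* (b :* x) :+ :- (c :* (d :* x)))
        refl (𝟙 p i) (𝟙 q j) (𝟙 q i) (𝟙 p j) (P j i))
      (trans (∑-distrib-+ (λ j → 𝟙 p i * (𝟙 q j * P j i)) (λ j → - (𝟙 q i * (𝟙 p j * P j i))))
        (+-cong (trans (sym (*-distribˡ-sum (𝟙 p i) (λ j → 𝟙 q j * P j i))) (*-congˡ (𝟙-◁ P q i)))
          (trans (sum-neg (λ j → 𝟙 q i * (𝟙 p j * P j i)))
            (-‿cong (trans (sym (*-distribˡ-sum (𝟙 q i) (λ j → 𝟙 p j * P j i)))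
                           (*-congˡ (𝟙-◁ P p i))))))))
    (trans (∑-distrib-+ (λ i → 𝟙 p i * P q i) (λ i → - (𝟙 q i * P p i)))
      (+-cong (𝟙-◁ (λ i _ → P q i) p q) (trans (sum-neg (λ i → 𝟙 q i * P p i))
        (-‿cong (𝟙-◁ (λ i _ → P p i) q p)))))

  tr-edgeMatrix-skew : ∀ {n} (p q : Fin n) {P : Matrix n} → Skew P →
                       tr (edgeMatrix p q ⊛ P) ≈ - (1# + 1#) * P p q
  tr-edgeMatrix-skew p q {P} skew = trans (tr-edgeMatrix p q P) (trans (+-congʳ (skew p q))
    (solve 1 (λ x → :- x :+ :- x := :- (con (+ 1) :+ con (+ 1)) :* x) refl (P p q)))

  module _ {r} (A : Matrix (suc r)) where
    private
      w = fromℕ r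
      B = mask (⊤ - w) A
      A⁻ : Matrix r
      A⁻ i j = A (inject₁ i) (inject₁ j)

    inject₁∈ : (i : Fin r) → inject₁ i ∈ ⊤ - w
    inject₁∈ i = x∈p∧x≢y⇒x∈p-y ∈⊤ (Finₚ.fromℕ≢inject₁ ∘ ≡.sym)

    power-restrict : ∀ k i j → power A⁻ k i j ≈ power B k (inject₁ i) (inject₁ j)
    power-restrict zero i j with i Finₚ.≟ j
    ... | yes ≡.refl = sym (𝟙-same (inject₁ i))
    ... | no i≢j     = sym (𝟙-diff (i≢j ∘ Finₚ.inject₁-injective))
    power-restrict (suc k) i j = trans
      (sum-cong-≋ λ l → *-cong (sym (mask-in A (inject₁∈ i) (inject₁∈ l))) (power-restrict k l j))
      (sym (trans (sum-init-last (λ l → B (inject₁ i) l * power B k l (inject₁ j)))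
        (trans (+-congˡ (trans (*-congʳ (mask-column A (inject₁ i) (∉- ⊤ w))) (zeroˡ _)))
               (+-identityʳ _))))

    -- From exponent one on, row and column `w` of the power of `B` are zero. At exponent zero the
    -- identity would contribute `D w w`.
    tr-restrict : ∀ (D : Matrix (suc r)) k →
      tr ((λ i j → D (inject₁ i) (inject₁ j)) ⊛ power A⁻ (suc k)) ≈ tr (D ⊛ power B (suc k))
    tr-restrict D k = sym (trans
      (sum-init-last (λ i → (D ⊛ P) i i))
      (trans (+-cong
        (sum-cong-≋ λ i → trans (sum-init-last (λ l → D (inject₁ i) l * P l (inject₁ i)))
          (trans (+-cong
            (sum-cong-≋ λ l → *-congˡ (sym (power-restrict (suc k) l i)))
            (trans (*-congˡ (P-row (inject₁ i))) (zeroʳ _)))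
            (+-identityʳ _)))
        (sum-0 {suc r} {λ l → D w l * P l w} λ l → trans (*-congˡ (P-column l)) (zeroʳ _)))
        (+-identityʳ _)))
      where
      P = power B (suc k)
      P-row : ∀ j → P w j ≈ 0#
      P-row = ◁-𝟘 (power B k) λ l → mask-row A l (∉- ⊤ w)
      P-column : ∀ i → P i w ≈ 0#
      P-column i = trans (power-comm B k i w)
        (sum-0 {suc r} {λ l → power B k i l * B l w} λ l →
          trans (*-congˡ (mask-column A l (∉- ⊤ w))) (zeroʳ _))

  sum-↑ : ∀ m {m′} (f : Fin (m ℕ.+ m′) → Carrier) →
          sum f ≈ sum (λ p → f (p ↑ˡ m′)) + sum (λ q → f (m ↑ʳ q))
  sum-↑ zero    f = sym (+-identityˡ _)
  sum-↑ (suc m) f = trans (+-congˡ (sum-↑ m (f ∘ suc))) (sym (+-assoc _ _ _))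

  -- Separates the rows coming from M from those coming from N. In the application `m` and `m′` are
  -- halves of `r`, so an equation between their sum and `r` cannot be matched there; the record
  -- keeps that match outside.
  record Splitting (r m m′ : ℕ) : Set (c ⊔ ℓ) where
    field
      inl       : Fin m → Fin r
      inr       : Fin m′ → Fin r
      toℕ-inl   : ∀ p → toℕ (inl p) ≡ toℕ p
      toℕ-inr   : ∀ q → toℕ (inr q) ≡ m ℕ.+ toℕ q
      cover     : ∀ l → (∃[ p ] l ≡ inl p) ⊎ (∃[ q ] l ≡ inr q)
      sum-split : ∀ f → sum f ≈ sum (f ∘ inl) + sum (f ∘ inr)

  splitting : ∀ {r} m m′ → m ℕ.+ m′ ≡ r → Splitting r m m′
  splitting m m′ ≡.refl = record
    { inl       = _↑ˡ m′
    ; inr       = m ↑ʳ_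
    ; toℕ-inl   = λ p → Finₚ.toℕ-↑ˡ p m′
    ; toℕ-inr   = Finₚ.toℕ-↑ʳ m
    ; cover     = cover
    ; sum-split = sum-↑ m
    }
    where
    cover : ∀ l → (∃[ p ] l ≡ p ↑ˡ m′) ⊎ (∃[ q ] l ≡ m ↑ʳ q)
    cover l with Fin.splitAt m l in eq
    ... | inj₁ p = inj₁ (p , ≡.sym (Finₚ.splitAt⁻¹-↑ˡ eq))
    ... | inj₂ q = inj₂ (q , ≡.sym (Finₚ.splitAt⁻¹-↑ʳ eq))

-- From a simple spectrum to an eigenbasis

module SimpleSpectrum {c ℓ} (F : DiscreteField c ℓ) where
  open DiscreteField F renaming (commutativeRing to R) hiding (zero; _-_)
  open Matrices rawRing
  open Sum semiring using (sum-cong-≋; ∑-distrib-+; *-distribˡ-sum)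
  open IntegerCoefficientSolver R
  open MatrixAlgebra R
  open Masking R
  open FieldLinearAlgebra F

  extend : ∀ {n} (S : Subset n) → (Fin ∣ S ∣ → Carrier) → Fin n → Carrier
  extend (inside  ∷ S) v zero    = v zero
  extend (inside  ∷ S) v (suc j) = extend S (v ∘ suc) j
  extend (outside ∷ S) v zero    = 0#
  extend (outside ∷ S) v (suc j) = extend S v j

  extend-enum : ∀ {n} (S : Subset n) v k → extend S v (enum S k) ≡ v k
  extend-enum (inside  ∷ S) v zero    = ≡.refl
  extend-enum (inside  ∷ S) v (suc k) = extend-enum S (v ∘ suc) k
  extend-enum (outside ∷ S) v k       = extend-enum S v k

  extend-supported : ∀ {n} (S : Subset n) v → SupportedOn S (extend S v)
  extend-supported (inside  ∷ S) v zero    j∉ = ⊥-elim (j∉ here)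
  extend-supported (inside  ∷ S) v (suc j) j∉ = extend-supported S (v ∘ suc) j (j∉ ∘ there)
  extend-supported (outside ∷ S) v zero    j∉ = refl
  extend-supported (outside ∷ S) v (suc j) j∉ = extend-supported S v j (j∉ ∘ there)

  sum-extend : ∀ {n} (S : Subset n) v (f : Fin n → Carrier) →
               sum (λ j → extend S v j * f j) ≈ sum (λ k → v k * f (enum S k))
  sum-extend []            v f = refl
  sum-extend (inside  ∷ S) v f = +-congˡ (sum-extend S (v ∘ suc) (f ∘ suc))
  sum-extend (outside ∷ S) v f = trans (+-cong (zeroˡ _) (sum-extend S v (f ∘ suc))) (+-identityˡ _)

  product-0 : ∀ {n} {f : Fin n → Carrier} k → f k ≈ 0# → product f ≈ 0#
  product-0 zero    e = trans (*-congʳ e) (zeroˡ _)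
  product-0 (suc k) e = trans (*-congˡ (product-0 k e)) (zeroʳ _)

  -- At `ν k` the product on the right has a zero factor, so the characteristic matrix is singular;
  -- its left kernel vector, extended by zero outside `S`, is the eigenvector.
  simpleSpectrum⇒eigenBasis : ∀ {n} (A : Matrix n) (S : Subset n) (ν : Fin ∣ S ∣ → Carrier) →
    Distinct ν → (∀ z → det (λ i j → z * 𝟙 i j + - (A [ S ]) i j) ≈ product (λ k → z + - ν k)) →
    EigenBasis (mask S A) S
  simpleSpectrum⇒eigenBasis A S ν distinct char = record
    { μ         = ν
    ; distinct  = distinct
    ; u         = λ k → extend S (v k)
    ; eigen     = eigen
    ; supported = λ k → extend-supported S (v k)
    ; nonzero   = λ k → let i , vi≉0 = proj₁ (proj₂ (kernel k)) in
        enum S i , λ e → vi≉0 (trans (reflexive (≡.sym (extend-enum S (v k) i))) e)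
    }
    where
    C : Fin ∣ S ∣ → Matrix ∣ S ∣
    C k i j = ν k * 𝟙 i j + - (A [ S ]) i j
    kernel : ∀ k → ∃[ v ] (Nonzero v × v ◁ C k ≋ 𝟘)
    kernel k = singular⇒leftKernel (C k) (trans (char (ν k)) (product-0 k (-‿inverseʳ (ν k))))
    v : ∀ k → Fin ∣ S ∣ → Carrier
    v k = proj₁ (kernel k)
    eigen : ∀ k → Eigenvector (mask S A) (ν k) (extend S (v k))
    eigen k j with j ∈? S
    ... | no j∉S = trans (sum-0 λ i → trans (*-congˡ (mask-column A i j∉S)) (zeroʳ _))
      (sym (trans (*-congˡ (extend-supported S (v k) j j∉S)) (zeroʳ _)))
    ... | yes j∈S with l , ≡.refl ← enum-surjective j∈S = trans
      (sum-extend S (v k) (λ i → mask S A i (enum S l)))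
      (trans (sum-cong-≋ λ i → *-congˡ (mask-in A (enum-∈ S i) (enum-∈ S l)))
      (sym (trans (*-congˡ (reflexive (extend-enum S (v k) l))) (x-y≈0⇒x≈y (trans
        (+-cong
          (trans (*-congˡ (sym (◁-𝟙 (v k) l))) (*-distribˡ-sum (ν k) (λ i → v k i * 𝟙 i l)))
          (sym (sum-neg (λ i → v k i * (A [ S ]) i l))))
        (trans (sym (∑-distrib-+ (λ i → ν k * (v k i * 𝟙 i l)) (λ i → - (v k i * (A [ S ]) i l))))
        (trans (sum-cong-≋ λ i → solve 4
          (λ n v d a → n :* (v :* d) :+ :- (v :* a) := v :* (n :* d :+ :- a)) refl
          (ν k) (v k i) (𝟙 i l) ((A [ S ]) i l))
          (proj₂ (proj₂ (kernel k)) l))))))))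

-- Order on the reals, the complex field, interlacing

module RealNumbers {c ℓ₁ ℓ₂} (ℝ : CompleteOrderedField c ℓ₁ ℓ₂) where
  open CompleteOrderedField ℝ
    using (isCommutativeRing; isStrictTotalOrder; 0<1; +-monoˡ-<; *-pos; ⁻¹-inverseʳ; _⁻¹; _<_)
    public
  open OverReals ℝ using (module ℂ; StrictlyInterlaces)

  ℝ-ring : CommutativeRing c ℓ₁
  ℝ-ring = record { isCommutativeRing = isCommutativeRing }

  open CommutativeRing ℝ-ring hiding (zero; _-_) public
  open IsStrictTotalOrder isStrictTotalOrder public
    using (compare; _≟_; <-respˡ-≈; <-respʳ-≈) renaming (trans to <-trans; irrefl to <-irrefl; asym to <-asym)
  open IntegerCoefficientSolver ℝ-ring
  open Mult semiring using () renaming (_×_ to _·_)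

  1≉0 : ¬ 1# ≈ 0#
  1≉0 e = <-irrefl (sym e) 0<1

  neg-pos : ∀ {x} → x < 0# → 0# < - x
  neg-pos {x} x<0 = <-respˡ-≈ (-‿inverseʳ x) (<-respʳ-≈ (+-identityˡ _) (+-monoˡ-< (- x) x<0))

  pos-neg : ∀ {x} → 0# < - x → x < 0#
  pos-neg {x} 0<-x = <-respˡ-≈ (+-identityˡ x) (<-respʳ-≈ (-‿inverseˡ x) (+-monoˡ-< x 0<-x))

  +-pos : ∀ {x y} → 0# < x → 0# < y → 0# < x + y
  +-pos {x} {y} 0<x 0<y = <-trans 0<y (<-respˡ-≈ (+-identityˡ y) (+-monoˡ-< y 0<x))

  square-pos : ∀ {x} → ¬ x ≈ 0# → 0# < x * x
  square-pos {x} x≉0 with compare x 0#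
  ... | tri< x<0 _ _ = <-respʳ-≈ (solve 1 (λ x → (:- x) :* (:- x) := x :* x) refl x)
                                 (*-pos (neg-pos x<0) (neg-pos x<0))
  ... | tri≈ _ x≈0 _ = ⊥-elim (x≉0 x≈0)
  ... | tri> _ _ 0<x = *-pos 0<x 0<x

  ·1-pos : ∀ n → 0# < suc n · 1#
  ·1-pos zero    = <-respʳ-≈ (sym (+-identityʳ 1#)) 0<1
  ·1-pos (suc n) = +-pos 0<1 (·1-pos n)

  pos⇒≉0 : ∀ {x} → 0# < x → ¬ x ≈ 0#
  pos⇒≉0 0<x e = <-irrefl (sym e) 0<x

  double-0 : ∀ {x} → x ≈ - x → x ≈ 0#
  double-0 {x} x≈-x with compare x 0#
  ... | tri< x<0 _ _ = ⊥-elim (<-asym x<0 (<-respʳ-≈ (sym x≈-x) (neg-pos x<0)))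
  ... | tri≈ _ x≈0 _ = x≈0
  ... | tri> _ _ 0<x = ⊥-elim (<-asym 0<x (pos-neg (<-respʳ-≈ x≈-x 0<x)))

  sum-of-squares : ∀ {x y} → ¬ (x ≈ 0# × y ≈ 0#) → ¬ x * x + y * y ≈ 0#
  sum-of-squares {x} {y} xy≉0 with x ≟ 0# | y ≟ 0#
  ... | yes x≈0 | yes y≈0 = ⊥-elim (xy≉0 (x≈0 , y≈0))
  ... | no x≉0  | no y≉0  = pos⇒≉0 (+-pos (square-pos x≉0) (square-pos y≉0))
  ... | no x≉0  | yes y≈0 = pos⇒≉0 (<-respʳ-≈
    (trans (sym (+-identityʳ _)) (+-congˡ (sym (trans (*-congʳ y≈0) (zeroˡ y))))) (square-pos x≉0))
  ... | yes x≈0 | no y≉0  = pos⇒≉0 (<-respʳ-≈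
    (trans (sym (+-identityˡ _)) (+-congʳ (sym (trans (*-congʳ x≈0) (zeroˡ x))))) (square-pos y≉0))

  ℂ-isCommutativeRing : IsCommutativeRing ℂ._≈_ ℂ._+_ ℂ._*_ ℂ.-_ ℂ.0# ℂ.1#
  ℂ-isCommutativeRing = record
    { isRing = record
      { +-isAbelianGroup = record
        { isGroup = record
          { isMonoid = record
            { isSemigroup = record
              { isMagma = record
                { isEquivalence = record
                  { refl  = refl , refl
                  ; sym   = λ (p , q) → sym p , sym q
                  ; trans = λ (p , q) (p′ , q′) → trans p p′ , trans q q′
                  }
                ; ∙-cong = λ (p , q) (p′ , q′) → +-cong p p′ , +-cong q q′
                }
              ; assoc = λ _ _ _ → +-assoc _ _ _ , +-assoc _ _ _
              }
            ; identity = (λ _ → +-identityˡ _ , +-identityˡ _) , (λ _ → +-identityʳ _ , +-identityʳ _)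
            }
          ; inverse = (λ _ → -‿inverseˡ _ , -‿inverseˡ _) , (λ _ → -‿inverseʳ _ , -‿inverseʳ _)
          ; ⁻¹-cong = λ (p , q) → -‿cong p , -‿cong q
          }
        ; comm = λ _ _ → +-comm _ _ , +-comm _ _
        }
      ; *-cong = λ (p , q) (p′ , q′) →
          +-cong (*-cong p p′) (-‿cong (*-cong q q′)) , +-cong (*-cong p q′) (*-cong q p′)
      ; *-assoc = λ (a , b) (c , d) (e , f) →
          solve 6 (λ a b c d e f → (a :* c :+ :- (b :* d)) :* e :+ :- ((a :* d :+ b :* c) :* f) :=
                     a :* (c :* e :+ :- (d :* f)) :+ :- (b :* (c :* f :+ d :* e))) refl a b c d e f ,
          solve 6 (λ a b c d e f → (a :* c :+ :- (b :* d)) :* f :+ (a :* d :+ b :* c) :* e :=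
                     a :* (c :* f :+ d :* e) :+ b :* (c :* e :+ :- (d :* f))) refl a b c d e f
      ; *-identity =
          (λ (a , b) →
            solve 2 (λ a b → con (+ 1) :* a :+ :- (con (+ 0) :* b) := a) refl a b ,
            solve 2 (λ a b → con (+ 1) :* b :+ con (+ 0) :* a := b) refl a b) ,
          (λ (a , b) →
            solve 2 (λ a b → a :* con (+ 1) :+ :- (b :* con (+ 0)) := a) refl a b ,
            solve 2 (λ a b → a :* con (+ 0) :+ b :* con (+ 1) := b) refl a b)
      ; distrib =
          (λ (a , b) (c , d) (e , f) →
            solve 6 (λ a b c d e f → a :* (c :+ e) :+ :- (b :* (d :+ f)) :=
              a :* c :+ :- (b :* d) :+ (a :* e :+ :- (b :* f))) refl a b c d e f ,
            solve 6 (λ a b c d e f → a :* (d :+ f) :+ b :* (c :+ e) :=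
              a :* d :+ b :* c :+ (a :* f :+ b :* e)) refl a b c d e f) ,
          (λ (a , b) (c , d) (e , f) →
            solve 6 (λ a b c d e f → (c :+ e) :* a :+ :- ((d :+ f) :* b) :=
              c :* a :+ :- (d :* b) :+ (e :* a :+ :- (f :* b))) refl a b c d e f ,
            solve 6 (λ a b c d e f → (c :+ e) :* b :+ (d :+ f) :* a :=
              c :* b :+ d :* a :+ (e :* b :+ f :* a)) refl a b c d e f)
      }
    ; *-comm = λ (a , b) (c , d) →
        solve 4 (λ a b c d → a :* c :+ :- (b :* d) := c :* a :+ :- (d :* b)) refl a b c d ,
        solve 4 (λ a b c d → a :* d :+ b :* c := c :* b :+ d :* a) refl a b c d
    }

  ℂ-ring : CommutativeRing c ℓ₁
  ℂ-ring = record { isCommutativeRing = ℂ-isCommutativeRing }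

  _ℂ≟_ : Decidable ℂ._≈_
  (a , b) ℂ≟ (a′ , b′) = (a ≟ a′) ×-dec (b ≟ b′)

  infix 9 _⁻¹ᶜ
  _⁻¹ᶜ : ℂ.Carrier → ℂ.Carrier
  (a , b) ⁻¹ᶜ = a * (a * a + b * b) ⁻¹ , - b * (a * a + b * b) ⁻¹

  ⁻¹ᶜ-inverseʳ : ∀ x → ¬ x ℂ.≈ ℂ.0# → x ℂ.* x ⁻¹ᶜ ℂ.≈ ℂ.1#
  ⁻¹ᶜ-inverseʳ (a , b) x≉0 =
    trans (solve 3 (λ a b n → a :* (a :* n) :+ :- (b :* (:- b :* n)) := (a :* a :+ b :* b) :* n)
             refl a b ((a * a + b * b) ⁻¹))
          (⁻¹-inverseʳ _ (sum-of-squares x≉0)) ,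
    solve 3 (λ a b n → a :* (:- b :* n) :+ b :* (a :* n) := con (+ 0)) refl a b ((a * a + b * b) ⁻¹)

  ℝ-field : DiscreteField c ℓ₁
  ℝ-field = record
    { commutativeRing = ℝ-ring ; _≟_ = _≟_ ; _⁻¹ = _⁻¹ ; inverseʳ = ⁻¹-inverseʳ ; 1≉0 = 1≉0 }

  ℂ-field : DiscreteField c ℓ₁
  ℂ-field = record
    { commutativeRing = ℂ-ring ; _≟_ = _ℂ≟_ ; _⁻¹ = _⁻¹ᶜ ; inverseʳ = ⁻¹ᶜ-inverseʳ
    ; 1≉0 = λ (e , _) → 1≉0 e }

  adjacent⇒increasing : ∀ {k} (f : Fin (suc k) → Carrier) →
    (∀ i → f (inject₁ i) < f (suc i)) → ∀ {i j} → i Fin.< j → f i < f j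
  adjacent⇒increasing {suc k} f inc {zero}  {suc zero}    _ = inc zero
  adjacent⇒increasing {suc k} f inc {zero}  {suc (suc j)} _ =
    <-trans (inc zero) (adjacent⇒increasing (f ∘ suc) (inc ∘ suc) (ℕ.s≤s ℕ.z≤n))
  adjacent⇒increasing {suc k} f inc {suc i} {suc j} (ℕ.s≤s i<j) =
    adjacent⇒increasing (f ∘ suc) (inc ∘ suc) i<j

  increasing⇒injective : ∀ {k} (f : Fin k → Carrier) → (∀ {i j} → i Fin.< j → f i < f j) →
                         ∀ i j → f i ≈ f j → i ≡ j
  increasing⇒injective f inc i j e with Finₚ.<-cmp i j
  ... | tri< i<j _ _ = ⊥-elim (<-irrefl e (inc i<j))
  ... | tri≈ _ i≡j _ = i≡j
  ... | tri> _ _ j<i = ⊥-elim (<-irrefl (sym e) (inc j<i))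

  -- Neighbours in either list are separated by a member of the other, so both lists increase. An
  -- index `j` is at most that of `i` or at least the next one, which puts `ν j` below or above
  -- `μ i`.
  interlacing : ∀ {k n} {μ : Fin k → Carrier} {ν : Fin n → Carrier} → StrictlyInterlaces μ ν →
    (∀ i j → μ i ≈ μ j → i ≡ j) × (∀ i j → ν i ≈ ν j → i ≡ j) × (∀ i j → ¬ μ i ≈ ν j)
  interlacing {k} {μ = μ} {ν} (≡.refl , ν<μ , μ<ν) =
    increasing⇒injective μ (μ-increasing μ ν below above) ,
    increasing⇒injective ν ν-increasing , different
    where
    below : ∀ i → ν (inject₁ i) < μ i
    below i = ν<μ i (inject₁ i) (Finₚ.toℕ-inject₁ i)
    above : ∀ i → μ i < ν (suc i)
    above i = μ<ν i (suc i) ≡.refl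
    ν-increasing : ∀ {i j} → i Fin.< j → ν i < ν j
    ν-increasing = adjacent⇒increasing ν λ i → <-trans (below i) (above i)
    μ-increasing : ∀ {k} (μ : Fin k → Carrier) (ν : Fin (suc k) → Carrier) →
      (∀ i → ν (inject₁ i) < μ i) → (∀ i → μ i < ν (suc i)) → ∀ {i j} → i Fin.< j → μ i < μ j
    μ-increasing {suc k} μ ν below above =
      adjacent⇒increasing μ λ i → <-trans (above (inject₁ i)) (below (suc i))
    different : ∀ i j → ¬ μ i ≈ ν j
    different i j e with Finₚ.<-cmp j (inject₁ i)
    ... | tri< j<i _ _    = <-irrefl (sym e) (<-trans (ν-increasing j<i) (below i))
    ... | tri≈ _ ≡.refl _ = <-irrefl (sym e) (below i)
    ... | tri> _ _ i<j with Finₚ.<-cmp (suc i) j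
    ...   | tri< i<j′ _ _   = <-irrefl e (<-trans (above i) (ν-increasing i<j′))
    ...   | tri≈ _ ≡.refl _ = <-irrefl e (above i)
    ...   | tri> _ _ j≤i    = ⊥-elim (ℕₚ.<⇒≱ i<j (≡.subst (toℕ j ℕ.≤_)
                                (≡.sym (Finₚ.toℕ-inject₁ i)) (ℕₚ.≤-pred j≤i)))

-- Derivatives by second-order remainders

module RealCalculus {c ℓ₁ ℓ₂} (ℝ : CompleteOrderedField c ℓ₁ ℓ₂) where
  open RealNumbers ℝ
  open OverReals ℝ using (HasLimitAt0; _−_)
  open Matrices (CommutativeRing.rawRing ℝ-ring)
  open IntegerCoefficientSolver ℝ-ring
  open PowerDerivative ℝ-ring

  -- The bound |x| < K without an absolute value: as two positivity statements it is handled by ring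
  -- identities together with `+-pos` and `*-pos`.
  Within : Carrier → Carrier → Set ℓ₂
  Within K x = 0# < K + - x × 0# < K + x

  within-cong : ∀ {K x y} → x ≈ y → Within K x → Within K y
  within-cong x≈y (p , q) = <-respʳ-≈ (+-congˡ (-‿cong x≈y)) p , <-respʳ-≈ (+-congˡ x≈y) q

  half-pos : ∀ {t} → 0# < t + t → 0# < t
  half-pos {t} 0<2t with compare t 0#
  ... | tri> _ _ 0<t = 0<t
  ... | tri≈ _ t≈0 _ = ⊥-elim (<-irrefl (sym (trans (+-cong t≈0 t≈0) (+-identityʳ 0#))) 0<2t)
  ... | tri< t<0 _ _ = ⊥-elim (<-asym 0<2t (pos-neg (<-respʳ-≈
    (solve 1 (λ t → :- t :+ :- t := :- (t :+ t)) refl t) (+-pos (neg-pos t<0) (neg-pos t<0)))))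

  within⇒pos : ∀ {K x} → Within K x → 0# < K
  within⇒pos {K} {x} (p , q) = half-pos (<-respʳ-≈
    (solve 2 (λ K x → K :+ :- x :+ (K :+ x) := K :+ K) refl K x) (+-pos p q))

  within-+ : ∀ {K L x y} → Within K x → Within L y → Within (K + L) (x + y)
  within-+ {K} {L} {x} {y} (p , q) (p′ , q′) =
    <-respʳ-≈ (solve 4 (λ K L x y → K :+ :- x :+ (L :+ :- y) := K :+ L :+ :- (x :+ y)) refl K L x y)
      (+-pos p p′) ,
    <-respʳ-≈ (solve 4 (λ K L x y → K :+ x :+ (L :+ y) := K :+ L :+ (x :+ y)) refl K L x y)
      (+-pos q q′)

  -- Twice KL - xy equals (K - x)(L + y) + (K + x)(L - y), and twice KL + xy equals (K - x)(L - y) +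
  -- (K + x)(L + y); no signs of `x` and `y` need to be distinguished.
  within-* : ∀ {K L x y} → Within K x → Within L y → Within (K * L) (x * y)
  within-* {K} {L} {x} {y} (p , q) (p′ , q′) =
    half-pos (<-respʳ-≈
      (solve 4 (λ K L x y → (K :+ :- x) :* (L :+ y) :+ (K :+ x) :* (L :+ :- y) :=
        K :* L :+ :- (x :* y) :+ (K :* L :+ :- (x :* y))) refl K L x y)
      (+-pos (*-pos p q′) (*-pos q p′))) ,
    half-pos (<-respʳ-≈
      (solve 4 (λ K L x y → (K :+ :- x) :* (L :+ :- y) :+ (K :+ x) :* (L :+ y) :=
        K :* L :+ x :* y :+ (K :* L :+ x :* y)) refl K L x y)
      (+-pos (*-pos p p′) (*-pos q q′)))

  within : ∀ a → ∃[ K ] Within K a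
  within a with compare a 0#
  ... | tri< a<0 _ _ = 1# + - a ,
    <-respʳ-≈ (sym (+-assoc _ _ _)) (+-pos 0<1 (+-pos (neg-pos a<0) (neg-pos a<0))) ,
    <-respʳ-≈ (solve 1 (λ a → con (+ 1) := con (+ 1) :+ :- a :+ a) refl a) 0<1
  ... | tri≈ _ a≈0 _ = 1# , within-cong (sym a≈0)
    (<-respʳ-≈ (solve 0 (con (+ 1) := con (+ 1) :+ :- con (+ 0)) refl) 0<1 ,
     <-respʳ-≈ (sym (+-identityʳ 1#)) 0<1)
  ... | tri> _ _ 0<a = 1# + a ,
    <-respʳ-≈ (solve 1 (λ a → con (+ 1) := con (+ 1) :+ a :+ :- a) refl a) 0<1 ,
    <-respʳ-≈ (sym (+-assoc _ _ _)) (+-pos 0<1 (+-pos 0<a 0<a))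

  -- The radius is fixed at 1, so sums and products need no common smaller neighbourhood. This is
  -- enough because the remainders are built from constants and `h` by sums and products.
  BoundedNear0 : (Carrier → Carrier) → Set _
  BoundedNear0 q = ∃[ K ] (∀ h → Within 1# h → Within K (q h))

  bounded-const : ∀ a → BoundedNear0 (λ _ → a)
  bounded-const a = let K , b = within a in K , λ _ _ → b

  bounded-id : BoundedNear0 (λ h → h)
  bounded-id = 1# , λ _ b → b

  bounded-+ : ∀ {q r} → BoundedNear0 q → BoundedNear0 r → BoundedNear0 (λ h → q h + r h)
  bounded-+ (K , b) (L , b′) = K + L , λ h near → within-+ (b h near) (b′ h near)

  bounded-* : ∀ {q r} → BoundedNear0 q → BoundedNear0 r → BoundedNear0 (λ h → q h * r h)
  bounded-* (K , b) (L , b′) = K * L , λ h near → within-* (b h near) (b′ h near)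

  -- A quantitative form of differentiability at 0, with value `a` and derivative `d`. It is closed
  -- under sums and products by pure algebra, and the limit is taken only once, at the end.
  Expansion : (Carrier → Carrier) → Carrier → Carrier → Set _
  Expansion φ a d = ∃[ q ] ((∀ h → φ h ≈ a + h * d + h * h * q h) × BoundedNear0 q)

  expansion-affine : ∀ {φ a d} → (∀ h → φ h ≈ a + h * d) → Expansion φ a d
  expansion-affine φ≈ = (λ _ → 0#) ,
    (λ h → trans (φ≈ h) (sym (trans (+-congˡ (zeroʳ _)) (+-identityʳ _)))) , bounded-const 0#

  expansion-const : ∀ a → Expansion (λ _ → a) a 0#
  expansion-const a = expansion-affine λ h → sym (trans (+-congˡ (zeroʳ h)) (+-identityʳ a))

  expansion-+ : ∀ {φ ψ a b d e} → Expansion φ a d → Expansion ψ b e →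
                Expansion (λ h → φ h + ψ h) (a + b) (d + e)
  expansion-+ {a = a} {b} {d} {e} (q , φ≈ , bq) (r , ψ≈ , br) = (λ h → q h + r h) ,
    (λ h → trans (+-cong (φ≈ h) (ψ≈ h)) (trans
      (solve 6 (λ x y z x′ y′ z′ → x :+ y :+ z :+ (x′ :+ y′ :+ z′) := x :+ x′ :+ (y :+ y′) :+ (z :+ z′))
        refl a (h * d) (h * h * q h) b (h * e) (h * h * r h))
      (+-cong (+-congˡ (sym (distribˡ h d e))) (sym (distribˡ (h * h) (q h) (r h)))))) ,
    bounded-+ bq br

  expansion-* : ∀ {φ ψ a b d e} → Expansion φ a d → Expansion ψ b e →
                Expansion (λ h → φ h * ψ h) (a * b) (a * e + b * d)
  expansion-* {a = a} {b} {d} {e} (q , φ≈ , bq) (r , ψ≈ , br) =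
    -- With the factors written as a + hx and b + hy, where x = d + hq and y = e + hr, the cross
    -- terms leave ar + bq at second order, and the last product adds xy.
    (λ h → a * r h + b * q h + (d + h * q h) * (e + h * r h)) ,
    (λ h → trans (*-cong (trans (φ≈ h) (regroup a d h (q h))) (trans (ψ≈ h) (regroup b e h (r h))))
      (trans (multiply a b h (d + h * q h) (e + h * r h))
      (trans (+-congʳ (+-congˡ (*-congˡ (trans
               (+-cong (linear a e h (r h)) (trans (*-comm _ b) (linear b d h (q h))))
               (trans (interchange (a * e) (h * (a * r h)) (b * d) (h * (b * q h)))
                      (+-congˡ (sym (distribˡ h (a * r h) (b * q h)))))))))
             (collect (a * b) h (a * e + b * d) (a * r h + b * q h)
                      ((d + h * q h) * (e + h * r h)))))) ,
    bounded-+ (bounded-+ (bounded-* (bounded-const a) br) (bounded-* (bounded-const b) bq))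
      (bounded-* (bounded-+ (bounded-const d) (bounded-* bounded-id bq))
                 (bounded-+ (bounded-const e) (bounded-* bounded-id br)))
    where
    regroup : ∀ a d h q → a + h * d + h * h * q ≈ a + h * (d + h * q)
    regroup = solve 4 (λ a d h q → a :+ h :* d :+ h :* h :* q := a :+ h :* (d :+ h :* q)) refl
    multiply : ∀ a b h x y →
               (a + h * x) * (b + h * y) ≈ a * b + h * (a * y + x * b) + h * h * (x * y)
    multiply = solve 5 (λ a b h x y → (a :+ h :* x) :* (b :+ h :* y) :=
                 a :* b :+ h :* (a :* y :+ x :* b) :+ h :* h :* (x :* y)) refl
    interchange : ∀ x y z w → x + y + (z + w) ≈ x + z + (y + w)
    interchange = solve 4 (λ x y z w → x :+ y :+ (z :+ w) := x :+ z :+ (y :+ w)) refl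
    collect : ∀ x h y z w → x + h * (y + h * z) + h * h * w ≈ x + h * y + h * h * (z + w)
    collect = solve 5 (λ x h y z w → x :+ h :* (y :+ h :* z) :+ h :* h :* w :=
                                     x :+ h :* y :+ h :* h :* (z :+ w)) refl
    linear : ∀ a e h r → a * (e + h * r) ≈ a * e + h * (a * r)
    linear = solve 4 (λ a e h r → a :* (e :+ h :* r) := a :* e :+ h :* (a :* r)) refl

  expansion-scale : ∀ {φ a d} s → Expansion φ a d → Expansion (λ h → φ h * s) (a * s) (d * s)
  expansion-scale {φ} {a} {d} s (q , φ≈ , bq) = (λ h → q h * s) ,
    (λ h → trans (*-congʳ (φ≈ h)) (solve 5
      (λ a d h q s → (a :+ h :* d :+ h :* h :* q) :* s := a :* s :+ h :* (d :* s) :+ h :* h :* (q :* s))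
      refl a d h (q h) s)) ,
    bounded-* bq (bounded-const s)

  expansion-sum : ∀ {n} {φ : Fin n → Carrier → Carrier} {a d : Fin n → Carrier} →
                  (∀ i → Expansion (φ i) (a i) (d i)) → Expansion (λ h → sum (λ i → φ i h)) (sum a) (sum d)
  expansion-sum {zero}  exp = expansion-const 0#
  expansion-sum {suc n} exp = expansion-+ (exp zero) (expansion-sum (exp ∘ suc))

  expansion-power : ∀ {n} (M : Carrier → Matrix n) (A D : Matrix n) →
    (∀ i j → Expansion (λ h → M h i j) (A i j) (D i j)) →
    ∀ k i j → Expansion (λ h → power (M h) k i j) (power A k i j) (powerDerivative D A k i j)
  expansion-power M A D exp zero    i j = expansion-const (𝟙 i j)
  expansion-power M A D exp (suc k) i j = expansion-sum
    {φ = λ l h → M h i l * power (M h) k l j} {λ l → A i l * power A k l j}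
    {λ l → A i l * powerDerivative D A k l j + power A k l j * D i l}
    λ l → expansion-* {λ h → M h i l} {λ h → power (M h) k l j} {A i l} {power A k l j}
            {D i l} {powerDerivative D A k l j} (exp i l) (expansion-power M A D exp k l j)

  ⁻¹-pos : ∀ {x} → 0# < x → 0# < x ⁻¹
  ⁻¹-pos {x} 0<x with compare (x ⁻¹) 0#
  ... | tri> _ _ 0<x⁻¹ = 0<x⁻¹
  ... | tri≈ _ x⁻¹≈0 _ = ⊥-elim (1≉0 (trans (sym (⁻¹-inverseʳ x (pos⇒≉0 0<x)))
    (trans (*-congˡ x⁻¹≈0) (zeroʳ x))))
  ... | tri< x⁻¹<0 _ _ = ⊥-elim (<-asym 0<1 (pos-neg (<-respʳ-≈
    (trans (solve 2 (λ x y → x :* (:- y) := :- (x :* y)) refl x (x ⁻¹))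
           (-‿cong (⁻¹-inverseʳ x (pos⇒≉0 0<x))))
    (*-pos 0<x (neg-pos x⁻¹<0)))))

  difference-pos : ∀ {x y} → x < y → 0# < y + - x
  difference-pos {x} {y} x<y = <-respˡ-≈ (-‿inverseʳ x) (+-monoˡ-< (- x) x<y)

  pos-difference : ∀ {x y} → 0# < y + - x → x < y
  pos-difference {x} {y} p = <-respˡ-≈ (+-identityˡ x) (<-respʳ-≈
    (solve 2 (λ x y → y :+ :- x :+ x := y) refl x y) (+-monoˡ-< x p))

  -- With |q| < K near 0, the choice δ = η / (K + η) gives δ < 1 and δK < η.
  expansion⇒limit : ∀ {φ a d v} → Expansion φ a d → v ≈ a →
                    HasLimitAt0 (λ h → (φ h − v) * h ⁻¹) d
  expansion⇒limit {φ} {a} {d} {v} (q , φ≈ , K , bounded) v≈a η 0<η = δ , 0<δ , limit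
    where
    0<K : 0# < K
    0<K = within⇒pos (bounded 0#
      (<-respʳ-≈ (solve 0 (con (+ 1) := con (+ 1) :+ :- con (+ 0)) refl) 0<1 ,
       <-respʳ-≈ (sym (+-identityʳ 1#)) 0<1))
    0<K+η = +-pos 0<K 0<η
    δ = η * (K + η) ⁻¹
    0<δ : 0# < δ
    0<δ = *-pos 0<η (⁻¹-pos 0<K+η)
    δ[K+η]≈η : δ * (K + η) ≈ η
    δ[K+η]≈η = trans (solve 3 (λ e i k → e :* i :* k := e :* (k :* i)) refl η ((K + η) ⁻¹) (K + η))
      (trans (*-congˡ (⁻¹-inverseʳ _ (pos⇒≉0 0<K+η))) (*-identityʳ η))
    0<1-δ : 0# < 1# + - δ
    0<1-δ = <-respʳ-≈
      (trans (solve 3 (λ k e i → k :* i := (k :+ e) :* i :+ :- (e :* i)) refl K η ((K + η) ⁻¹))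
             (+-congʳ (⁻¹-inverseʳ _ (pos⇒≉0 0<K+η))))
      (*-pos 0<K (⁻¹-pos 0<K+η))
    0<η-δK : 0# < η + - (δ * K)
    0<η-δK = <-respʳ-≈
      (trans (solve 3 (λ d k e → d :* e := d :* (k :+ e) :+ :- (d :* k)) refl δ K η)
             (+-congʳ δ[K+η]≈η))
      (*-pos 0<δ 0<η)
    widen : ∀ {L L′ x} → 0# < L′ + - L → Within L x → Within L′ x
    widen {L} {L′} {x} L<L′ (p , p′) =
      <-respʳ-≈ (solve 3 (λ L L′ x → L′ :+ :- L :+ (L :+ :- x) := L′ :+ :- x) refl L L′ x) (+-pos L<L′ p) ,
      <-respʳ-≈ (solve 3 (λ L L′ x → L′ :+ :- L :+ (L :+ x) := L′ :+ x) refl L L′ x) (+-pos L<L′ p′)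
    limit : ∀ h → ¬ h ≈ 0# → - δ < h → h < δ →
            - η < (φ h − v) * h ⁻¹ − d × (φ h − v) * h ⁻¹ − d < η
    limit h h≉0 -δ<h h<δ =
      pos-difference (<-respʳ-≈ (solve 2 (λ e t → e :+ t := t :+ :- (:- e)) refl η _) (proj₂ close)) ,
      pos-difference (proj₁ close)
      where
      near : Within δ h
      near = difference-pos h<δ ,
        <-respʳ-≈ (solve 2 (λ d h → h :+ :- (:- d) := d :+ h) refl δ h) (difference-pos -δ<h)
      quotient≈ : (φ h − v) * h ⁻¹ − d ≈ h * q h
      quotient≈ = trans
        (+-congʳ (*-congʳ (+-cong (φ≈ h) (-‿cong v≈a))))
        (trans (solve 5 (λ a d h q i →
            (a :+ h :* d :+ h :* h :* q :+ :- a) :* i :+ :- d := (h :* i) :* (d :+ h :* q) :+ :- d)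
            refl a d h (q h) (h ⁻¹))
        (trans (+-congʳ (trans (*-congʳ (⁻¹-inverseʳ h h≉0)) (*-identityˡ _)))
               (solve 2 (λ d t → d :+ t :+ :- d := t) refl d (h * q h))))
      close : Within η ((φ h − v) * h ⁻¹ − d)
      close = within-cong (sym quotient≈)
        (widen 0<η-δK (within-* near (bounded h (widen 0<1-δ near))))

-- Passage to complex eigenvectors and back to real coefficients

module Complexification {c ℓ₁ ℓ₂} (ℝ : CompleteOrderedField c ℓ₁ ℓ₂) where
  open RealNumbers ℝ
  open OverReals ℝ using (fromReal; i·_; module ℂ; SpectrumStrictlyInterlaces; Duarte; single; branch;
                          graphOf; IsSkewSymmetric)
  open Matrices (CommutativeRing.rawRing ℝ-ring)
  open IntegerCoefficientSolver ℝ-ring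
  open Masking ℝ-ring
  open OddPowers ℝ-ring
  open RingProperties ring using (-0#≈0#)

  private
    module ℂᴿ = CommutativeRing ℂ-ring
    module ℂᴹ = Matrices (CommutativeRing.rawRing ℂ-ring)
    module ℂᴬ = MatrixAlgebra ℂ-ring
    module ℂᴷ = Masking ℂ-ring
    module ℂᴼ = OddPowers ℂ-ring
    module ℂˢ = Sum ℂᴿ.semiring

  open FieldLinearAlgebra ℂ-field using (EigenBasis; eigenBasis-cong)
  open SimpleSpectrum ℂ-field using (simpleSpectrum⇒eigenBasis)
  open Rigidity ℂ-field using (Branching; single; branch)
  open Independence ℂ-field using (independent)

  complexify : ∀ {n} → Matrix n → ℂᴹ.Matrix n
  complexify A i j = fromReal (A i j)

  fromReal-* : ∀ x y → fromReal x ℂ.* fromReal y ℂ.≈ fromReal (x * y)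
  fromReal-* x y =
    solve 2 (λ x y → x :* y :+ :- (con (+ 0) :* con (+ 0)) := x :* y) refl x y ,
    solve 2 (λ x y → x :* con (+ 0) :+ con (+ 0) :* y := con (+ 0)) refl x y

  fromReal-+ : ∀ x y → fromReal x ℂ.+ fromReal y ℂ.≈ fromReal (x + y)
  fromReal-+ x y = refl , +-identityʳ 0#

  fromReal-sum : ∀ {n} (f : Fin n → Carrier) → ℂᴹ.sum (fromReal ∘ f) ℂ.≈ fromReal (sum f)
  fromReal-sum {zero}  f = refl , refl
  fromReal-sum {suc n} f = ℂᴿ.trans (ℂᴿ.+-congˡ {fromReal (f zero)} (fromReal-sum (f ∘ suc)))
                                    (fromReal-+ (f zero) (sum (f ∘ suc)))

  fromReal-product-sum : ∀ {n} (f g : Fin n → Carrier) (f′ g′ : Fin n → ℂ.Carrier) →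
    (∀ i → f′ i ℂ.≈ fromReal (f i)) → (∀ i → g′ i ℂ.≈ fromReal (g i)) →
    ℂᴹ.sum (λ i → f′ i ℂ.* g′ i) ℂ.≈ fromReal (sum (λ i → f i * g i))
  fromReal-product-sum f g f′ g′ f≈ g≈ = ℂᴿ.trans
    (ℂˢ.sum-cong-≋ {x = λ i → f′ i ℂ.* g′ i} {λ i → fromReal (f i * g i)} λ i →
      ℂᴿ.trans (ℂᴿ.*-cong (f≈ i) (g≈ i)) (fromReal-* (f i) (g i)))
    (fromReal-sum (λ i → f i * g i))

  fromReal-𝟙 : ∀ {n} (i j : Fin n) → ℂᴹ.𝟙 i j ℂ.≈ fromReal (𝟙 i j)
  fromReal-𝟙 i j with does (i Finₚ.≟ j)
  ... | true  = refl , refl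
  ... | false = refl , refl

  power-complexify : ∀ {n} {A′ : ℂᴹ.Matrix n} (A : Matrix n) → (∀ i j → A′ i j ℂ.≈ fromReal (A i j)) →
    ∀ k i j → ℂᴹ.power A′ k i j ℂ.≈ fromReal (power A k i j)
  power-complexify A A≈ zero    i j = fromReal-𝟙 i j
  power-complexify {A′ = A′} A A≈ (suc k) i j =
    fromReal-product-sum (A i) (λ l → power A k l j) (A′ i) (λ l → ℂᴹ.power A′ k l j)
      (A≈ i) (λ l → power-complexify A A≈ k l j)

  mask-complexify : ∀ {n} (S : Subset n) (A : Matrix n) i j →
    ℂᴷ.mask S (complexify A) i j ℂ.≈ fromReal (mask S A i j)
  mask-complexify S A i j with i ∈? S | j ∈? S
  ... | no i∉  | _      = ℂᴿ.trans (ℂᴷ.mask-row (complexify A) j i∉) (sym (mask-row A j i∉) , refl)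
  ... | yes _  | no j∉  = ℂᴿ.trans (ℂᴷ.mask-column (complexify A) i j∉) (sym (mask-column A i j∉) , refl)
  ... | yes i∈ | yes j∈ = ℂᴿ.trans (ℂᴷ.mask-in (complexify A) i∈ j∈) (sym (mask-in A i∈ j∈) , refl)

  oddPolynomial-complexify : ∀ {m n} (a : Fin m → Carrier) {A′ : ℂᴹ.Matrix n} (A : Matrix n) →
    (∀ i j → A′ i j ℂ.≈ fromReal (A i j)) →
    ∀ i j → ℂᴼ.oddPolynomial (fromReal ∘ a) A′ i j ℂ.≈ fromReal (oddPolynomial a A i j)
  oddPolynomial-complexify a {A′} A A≈ i j = fromReal-product-sum a (λ p → power A (odd p) i j)
    (fromReal ∘ a) (λ p → ℂᴹ.power A′ (odd p) i j)
    (λ _ → ℂᴿ.refl) (λ p → power-complexify A A≈ (odd p) i j)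
    where
    odd : Fin _ → ℕ
    odd p = suc (double (toℕ p))

  module _ {n} (A : Matrix n) (skew : IsSkewSymmetric A) where
    private
      G   = graphOf A
      Aᶜ  = complexify A

    interlacing⇒eigenBases : ∀ S S′ → SpectrumStrictlyInterlaces (A [ S′ ]) (A [ S ]) →
      ∃[ b ] ∃[ a ] (∀ k l → ¬ EigenBasis.μ {B = ℂᴷ.mask S′ Aᶜ} {S′} b l ℂ.≈
                                EigenBasis.μ {B = ℂᴷ.mask S Aᶜ} {S} a k)
    interlacing⇒eigenBases S S′ (μ , ν , spectrumB , spectrumA , inter)
      with μ-distinct , ν-distinct , different ← interlacing inter =
      simpleSpectrum⇒eigenBasis Aᶜ S′ (i·_ ∘ μ) (λ i j (_ , e) → μ-distinct i j e) spectrumB ,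
      simpleSpectrum⇒eigenBasis Aᶜ S (i·_ ∘ ν) (λ i j (_ , e) → ν-distinct i j e) spectrumA ,
      λ k l (_ , e) → different l k e

    offEdge : ∀ {i j} → ¬ Adj G i j → A i j ≈ 0#
    offEdge {i} {j} ¬ij with Finₚ.<-cmp i j
    ... | tri< i<j _ _ = decidable-stable (A i j ≟ 0#) λ ≉0 → ¬ij (inj₁ (i<j , ≉0))
    ... | tri≈ _ ≡.refl _ = double-0 (skew i i)
    ... | tri> _ _ j<i = trans (skew j i) (trans (-‿cong
      (decidable-stable (A j i ≟ 0#) λ ≉0 → ¬ij (inj₂ (j<i , ≉0)))) -0#≈0#)

    onEdge : ∀ {i j} → Adj G i j → ¬ A i j ≈ 0#
    onEdge         (inj₁ (_ , ≉0)) e = ≉0 e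
    onEdge {i} {j} (inj₂ (_ , ≉0)) e = ≉0 (trans (skew i j) (trans (-‿cong e) -0#≈0#))

    offEdgeᶜ : ∀ {i j} → ¬ Adj G i j → Aᶜ i j ℂ.≈ ℂ.0#
    offEdgeᶜ ¬ij = offEdge ¬ij , refl

    onEdgeᶜ : ∀ {i j} → Adj G i j → ¬ Aᶜ i j ℂ.≈ ℂ.0#
    onEdgeᶜ ij (e , _) = onEdge ij e

    Duarte⇒Branching : ∀ {S w} → Duarte A S w → Branching G Aᶜ offEdgeᶜ onEdgeᶜ S w
    Duarte⇒Branching (single w∈S ∣S∣≡1) = single w∈S ∣S∣≡1
    Duarte⇒Branching {S} {w} (branch w∈S _ spectra sub) = branch w∈S
      (proj₁ (interlacing⇒eigenBases S (S - w) spectra))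
      λ v C wv isC → Duarte⇒Branching (sub v C wv isC)

    module _ (connected : ∀ u v → Star (Adj G) u v)
             (acyclic : ∀ {k} (c : Fin (3 ℕ.+ k) → Fin n) → ¬ Cycle G c) (w : Fin n)
             {m m′} (a : Fin m → Carrier) (b : Fin m′ → Carrier) where

      open MatrixAlgebra ℝ-ring using (_≋_; 𝟘)

      oddPolynomials-independent : 2 ℕ.≤ n → Duarte A ⊤ w →
        double m ℕ.≤ n → suc (double m′) ℕ.≤ n →
        (∀ {i j} → i Fin.< j → Adj G i j →
          oddPolynomial a A i j + oddPolynomial b (mask (⊤ - w) A) i j ≈ 0#) →
        a ≋ 𝟘 × b ≋ 𝟘
      oddPolynomials-independent 2≤n (single _ ∣⊤∣≡1) _ _ _ =
        ⊥-elim (ℕₚ.<⇒≢ 2≤n (≡.trans (≡.sym ∣⊤∣≡1) (∣⊤∣≡n n)))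
      -- `size` is the equation between `∣ ⊤ ∣` and `suc ∣ ⊤ - w ∣` contained in strict interlacing;
      -- it turns the bound on `m′` into one by the number of eigenvalues of the deleted matrix.
      oddPolynomials-independent _ duarte@(branch _ _ spectra@(_ , _ , _ , _ , size , _) _) m≤ m′≤ edge
        with basisB , basisA , separate ← interlacing⇒eigenBases ⊤ (⊤ - w) spectra
        = let
            a≋0 , b≋0 = independent (λ (e , e′) → double-0 e , double-0 e′) G connected acyclic Aᶜ
              (λ i j → skew i j , sym -0#≈0#) offEdgeᶜ onEdgeᶜ w (Duarte⇒Branching duarte)
              (eigenBasis-cong (λ _ _ → ℂᴷ.mask-in Aᶜ ∈⊤ ∈⊤) basisA) basisB separate (fromReal ∘ a) (fromReal ∘ b)
              (≡.subst (double m ℕ.≤_) (≡.sym (∣⊤∣≡n n)) m≤)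
              (ℕₚ.≤-pred (≡.subst (suc (double m′) ℕ.≤_) (≡.trans (≡.sym (∣⊤∣≡n n)) size) m′≤))
              edgeᶜ
          in proj₁ ∘ a≋0 , proj₁ ∘ b≋0
        where
        edgeᶜ : ∀ {i j} → i Fin.< j → Adj G i j →
          ℂᴼ.oddPolynomial (fromReal ∘ a) Aᶜ i j
            ℂ.+ ℂᴼ.oddPolynomial (fromReal ∘ b) (ℂᴷ.mask (⊤ - w) Aᶜ) i j ℂ.≈ ℂ.0#
        edgeᶜ {i} {j} i<j ij = ℂᴿ.trans
          (ℂᴿ.+-cong (oddPolynomial-complexify a A (λ _ _ → ℂᴿ.refl) i j)
                     (oddPolynomial-complexify b (mask (⊤ - w) A) (mask-complexify (⊤ - w) A) i j))
          (ℂᴿ.trans (fromReal-+ (oddPolynomial a A i j) (oddPolynomial b (mask (⊤ - w) A) i j))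
                    (edge i<j ij , refl))

-- The Jacobian matrix of the tree map and its left kernel

module TreeMapJacobian {c ℓ₁ ℓ₂} (ℝ : CompleteOrderedField c ℓ₁ ℓ₂) where
  open RealNumbers ℝ
  open OverReals ℝ using (HasLimitAt0; _−_; treeMatrix; treeMatrix⁻; traceTerm; treeMap; edgeEntries;
                          IsJacobian; Nonsingular; graphOf; S⁻; Duarte)
  open Matrices (CommutativeRing.rawRing ℝ-ring)
  open Sum semiring using (sum-cong-≋; ∑-distrib-+; *-distribˡ-sum)
  open Mult semiring using () renaming (_×_ to _·_)
  open IntegerCoefficientSolver ℝ-ring
  open RingProperties ring using (-0#≈0#)
  open MatrixAlgebra ℝ-ring
  open Masking ℝ-ring
  open OddPowers ℝ-ring
  open PowerDerivative ℝ-ring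
  open RealCalculus ℝ
  open FieldLinearAlgebra ℝ-field
    using (Nonzero; zero-product; singular⇒leftKernel)
  open Complexification ℝ using (oddPolynomials-independent; offEdge)

  traceDerivative : ∀ {n} → Matrix n → Matrix n → ℕ → Carrier
  traceDerivative D M k = tr (powerDerivative D M (2 ℕ.* k)) * ((4 ℕ.* k) · 1#) ⁻¹

  -- The condition depends on the coordinate alone and not on `h`. With a variable Boolean the
  -- conditionals in the function, its base value and the derivative reduce together.
  if-limit : ∀ b {φ ψ : Carrier → Carrier} {u v d e} →
    HasLimitAt0 (λ h → (φ h − u) * h ⁻¹) d → HasLimitAt0 (λ h → (ψ h − v) * h ⁻¹) e →
    HasLimitAt0 (λ h → ((if b then φ h else ψ h) − (if b then u else v)) * h ⁻¹) (if b then d else e)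
  if-limit true  φ-limit ψ-limit = φ-limit
  if-limit false φ-limit ψ-limit = ψ-limit

  -- The exponent 2k that differentiation brings down, over the normalising 4k, with k = p + 1. The
  -- value is one half; being nonzero is what counts.
  weight : ℕ → Carrier
  weight p = (suc (suc (double p)) · 1#) * ((4 ℕ.* suc p) · 1#) ⁻¹

  weight≉0 : ∀ p → ¬ weight p ≈ 0#
  -- `4 ℕ.* suc p` reduces to the successor of `p ℕ.+ 3 ℕ.* suc p`, which is the form that `·1-pos`
  -- expects.
  weight≉0 p = pos⇒≉0 (*-pos (·1-pos (suc (double p))) (⁻¹-pos (·1-pos (p ℕ.+ 3 ℕ.* suc p))))

  2*suc≡ : ∀ p → 2 ℕ.* suc p ≡ suc (suc (double p))
  2*suc≡ zero    = ≡.refl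
  2*suc≡ (suc p) = ≡.cong suc (≡.trans (ℕₚ.+-suc (suc p) (suc (p ℕ.+ 0))) (≡.cong suc (2*suc≡ p)))

  traceDerivative≈ : ∀ {n} (D M : Matrix n) p →
    traceDerivative D M (suc p) ≈ weight p * tr (D ⊛ power M (suc (double p)))
  traceDerivative≈ D M p = trans
    (*-congʳ (trans (reflexive (≡.cong (λ k → tr (powerDerivative D M k)) (2*suc≡ p)))
                    (tr-powerDerivative D M (suc (double p)))))
    (solve 3 (λ x t y → x :* t :* y := x :* y :* t) refl
      (suc (suc (double p)) · 1#) (tr (D ⊛ power M (suc (double p)))) (((4 ℕ.* suc p) · 1#) ⁻¹))

  module _ {g r} {T : Graph (suc r) g} (E : EdgeEnumeration T r) where
    open EdgeEnumeration E

    direction : Fin r → Matrix (suc r)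
    direction e = edgeMatrix (lo e) (hi e)

    direction⁻ : Fin r → Matrix r
    direction⁻ e i j = direction e (inject₁ i) (inject₁ j)

    traceTerm-limit : ∀ {n} (M : Carrier → Matrix n) (A D : Matrix n) →
      (∀ h i j → M h i j ≈ A i j + h * D i j) → ∀ k →
      HasLimitAt0 (λ h → (traceTerm E (M h) k − traceTerm E A k) * h ⁻¹) (traceDerivative D A k)
    traceTerm-limit M A D M≈ k = expansion⇒limit
      (expansion-scale (((4 ℕ.* k) · 1#) ⁻¹) (expansion-sum {φ = λ i h → power (M h) (2 ℕ.* k) i i}
        {λ i → power A (2 ℕ.* k) i i} {λ i → powerDerivative D A (2 ℕ.* k) i i}
        λ i → expansion-power M A D (λ i j → expansion-affine (λ h → M≈ h i j)) (2 ℕ.* k) i i))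
      refl

    treeMatrix-updateAt : ∀ x e h i j →
      treeMatrix E (updateAt x e (_+ h)) i j ≈ treeMatrix E x i j + h * direction e i j
    treeMatrix-updateAt x e h i j = trans
      (sum-cong-≋ {x = λ k → updateAt x e (_+ h) k * direction k i j}
                  {λ k → x k * direction k i j + h * (𝟙 e k * direction k i j)} λ k →
        trans (*-congʳ (update k))
        (solve 4 (λ x h d m → (x :+ h :* d) :* m := x :* m :+ h :* (d :* m)) refl
          (x k) h (𝟙 e k) (direction k i j)))
      (trans (∑-distrib-+ (λ k → x k * direction k i j) (λ k → h * (𝟙 e k * direction k i j)))
        (+-congˡ (trans (sym (*-distribˡ-sum h (λ k → 𝟙 e k * direction k i j)))
                        (*-congˡ (𝟙-◁ (λ k _ → direction k i j) e j)))))
      where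
      update : ∀ k → updateAt x e (_+ h) k ≈ x k + h * 𝟙 e k
      update k with k Finₚ.≟ e
      ... | yes ≡.refl = trans (reflexive (updateAt-updates e x))
        (+-congˡ (sym (trans (*-congˡ (𝟙-same e)) (*-identityʳ h))))
      ... | no k≢e = trans (reflexive (updateAt-minimal k e x k≢e)) (trans (sym (+-identityʳ _))
        (+-congˡ (sym (trans (*-congˡ (𝟙-diff (k≢e ∘ ≡.sym))) (zeroʳ h)))))

    jacobian : Vector Carrier r → Matrix r
    jacobian x l e = if does (toℕ l ℕₚ.<? ⌊ suc r /2⌋)
      then traceDerivative (direction e) (treeMatrix E x) (suc (toℕ l))
      else traceDerivative (direction⁻ e) (treeMatrix⁻ E x) (suc (toℕ l ℕ.∸ ⌊ suc r /2⌋))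

    isJacobian : ∀ x → IsJacobian (treeMap E) x (jacobian x)
    isJacobian x l e = if-limit (does (toℕ l ℕₚ.<? ⌊ suc r /2⌋))
      (traceTerm-limit (λ h → treeMatrix E (updateAt x e (_+ h))) (treeMatrix E x) (direction e)
        (treeMatrix-updateAt x e) (suc (toℕ l)))
      (traceTerm-limit (λ h → treeMatrix⁻ E (updateAt x e (_+ h))) (treeMatrix⁻ E x) (direction⁻ e)
        (λ h i j → treeMatrix-updateAt x e h (inject₁ i) (inject₁ j)) (suc (toℕ l ℕ.∸ ⌊ suc r /2⌋)))

    treeMatrix-skew : ∀ x → Skew (treeMatrix E x)
    treeMatrix-skew x i j = trans
      (sum-cong-≋ {x = λ k → x k * direction k j i} {λ k → - (x k * direction k i j)} λ k →
        trans (*-congˡ (edgeMatrix-skew (lo k) (hi k) i j))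
              (solve 2 (λ x d → x :* :- d := :- (x :* d)) refl (x k) (direction k i j)))
      (sum-neg (λ k → x k * direction k i j))

    module _ (A : Matrix (suc r)) (A∈S⁻ : S⁻ T A) where
      private
        skew : Skew A
        skew = proj₁ A∈S⁻
        w = fromℕ r
        B = mask (⊤ - w) A
        m m′ : ℕ
        m  = ⌊ suc r /2⌋
        m′ = ⌊ r /2⌋

      direction-0 : ∀ {i j} → i Fin.< j → ∀ k → ¬ (lo k ≡ i × hi k ≡ j) → direction k i j ≈ 0#
      direction-0 {i} {j} i<j k k≢ = trans
        (+-cong (first (lo k Finₚ.≟ i) (hi k Finₚ.≟ j)) (trans (-‿cong (second (hi k Finₚ.≟ i) (lo k Finₚ.≟ j))) -0#≈0#))
        (+-identityʳ 0#)
        where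
        first : Dec (lo k ≡ i) → Dec (hi k ≡ j) → 𝟙 (lo k) i * 𝟙 (hi k) j ≈ 0#
        first (yes p) (yes q) = ⊥-elim (k≢ (p , q))
        first (no p)  _       = trans (*-congʳ (𝟙-diff p)) (zeroˡ _)
        first (yes _) (no q)  = trans (*-congˡ (𝟙-diff q)) (zeroʳ _)
        second : Dec (hi k ≡ i) → Dec (lo k ≡ j) → 𝟙 (hi k) i * 𝟙 (lo k) j ≈ 0#
        second (yes p) (yes q) = ⊥-elim (ℕₚ.<-asym i<j (≡.subst₂ Fin._<_ q p (lo<hi k)))
        second (no p)  _       = trans (*-congʳ (𝟙-diff p)) (zeroˡ _)
        second (yes _) (no q)  = trans (*-congˡ (𝟙-diff q)) (zeroʳ _)

      direction-1 : ∀ k → direction k (lo k) (hi k) ≈ 1#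
      direction-1 k = trans
        (+-cong (trans (*-cong (𝟙-same (lo k)) (𝟙-same (hi k))) (*-identityʳ 1#))
                (trans (-‿cong (trans (*-congˡ (𝟙-diff (lo≢hi))) (zeroʳ _))) -0#≈0#))
        (+-identityʳ 1#)
        where
        lo≢hi : lo k ≢ hi k
        lo≢hi e = ℕₚ.<-irrefl (≡.cong toℕ e) (lo<hi k)

      treeMatrix-upper : ∀ {i j} → i Fin.< j → treeMatrix E (edgeEntries E A) i j ≈ A i j
      treeMatrix-upper {i} {j} i<j with Graph.adj? T i j
      ... | no ¬ij = trans
        (sum-0 {f = λ k → edgeEntries E A k * direction k i j} λ k → trans
          (*-congˡ (direction-0 i<j k λ { (≡.refl , ≡.refl) → ¬ij (isEdge k) })) (zeroʳ _))
        (sym (offEdge A skew (¬ij ∘ Equivalence.to (proj₂ A∈S⁻ i j))))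
      ... | yes ij with k , (≡.refl , ≡.refl) , unique ← complete i<j ij = trans
        (sum-single k (λ l → edgeEntries E A l * direction l i j) λ l l≢k → trans
          (*-congˡ (direction-0 i<j l (l≢k ∘ ≡.sym ∘ unique))) (zeroʳ _))
        (trans (*-congˡ (direction-1 k)) (*-identityʳ _))

      treeMatrix≋A : treeMatrix E (edgeEntries E A) ≋ᴹ A
      treeMatrix≋A i j with Finₚ.<-cmp i j
      ... | tri< i<j _ _    = treeMatrix-upper i<j
      ... | tri≈ _ ≡.refl _ = trans (double-0 (treeMatrix-skew (edgeEntries E A) i i)) (sym (double-0 (skew i i)))
      ... | tri> _ _ j<i    = trans (treeMatrix-skew (edgeEntries E A) j i)
        (trans (-‿cong (treeMatrix-upper j<i)) (sym (skew j i)))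

      J : Matrix r
      J = jacobian (edgeEntries E A)

      tr-direction : ∀ e {C P : Matrix (suc r)} p → P ≋ᴹ C → Skew C →
        tr (direction e ⊛ power P (suc (double p))) ≈ - (1# + 1#) * power C (suc (double p)) (lo e) (hi e)
      tr-direction e {C} {P} p P≋C skewC = trans
        (tr-cong λ i j → ◁-cong {u = direction e i} (λ _ → refl) (power-cong P≋C (suc (double p))) j)
        (tr-edgeMatrix-skew (lo e) (hi e) λ i j → trans (power-odd skewC p i j)
          (solve 1 (λ x → (:- con (+ 1)) :* x := :- x) refl (power C (suc (double p)) i j)))

      -- `⌊ suc r /2⌋` is by definition the upper half of `r`, so `m` and `m′` are its two halves.
      -- Hence `m′` is the number of coordinates taken from N, for either parity of `suc r`.
      open Splitting (splitting m m′ (≡.trans (ℕₚ.+-comm m m′) (ℕₚ.⌊n/2⌋+⌈n/2⌉≡n r)))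

      J-inl : ∀ p e → J (inl p) e ≈
        - (1# + 1#) * (weight (toℕ p) * power A (suc (double (toℕ p))) (lo e) (hi e))
      J-inl p e = trans (reflexive row) (trans (traceDerivative≈ (direction e) M (toℕ p)) (trans
        (*-congˡ (tr-direction e (toℕ p) treeMatrix≋A skew))
        (solve 3 (λ w t x → w :* (t :* x) := t :* (w :* x)) refl
          (weight (toℕ p)) (- (1# + 1#)) (power A (suc (double (toℕ p))) (lo e) (hi e)))))
        where
        M = treeMatrix E (edgeEntries E A)
        row : J (inl p) e ≡ traceDerivative (direction e) M (suc (toℕ p))
        row rewrite toℕ-inl p | dec-true (toℕ p ℕₚ.<? m) (Finₚ.toℕ<n p) = ≡.refl

      J-inr : ∀ q e → J (inr q) e ≈
        - (1# + 1#) * (weight (toℕ q) * power B (suc (double (toℕ q))) (lo e) (hi e))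
      J-inr q e = trans (reflexive row) (trans (traceDerivative≈ (direction⁻ e) N (toℕ q)) (trans
        (*-congˡ (trans
          (tr-cong λ i j → ◁-cong {u = direction⁻ e i} (λ _ → refl)
            (power-cong (λ a b → treeMatrix≋A (inject₁ a) (inject₁ b)) (suc (double (toℕ q)))) j)
          (trans (tr-restrict A (direction e) (double (toℕ q)))
                 (tr-direction e (toℕ q) (λ _ _ → refl) (mask-skew (⊤ - w) skew)))))
        (solve 3 (λ w t x → w :* (t :* x) := t :* (w :* x)) refl
          (weight (toℕ q)) (- (1# + 1#)) (power B (suc (double (toℕ q))) (lo e) (hi e)))))
        where
        N = treeMatrix⁻ E (edgeEntries E A)
        row : J (inr q) e ≡ traceDerivative (direction⁻ e) N (suc (toℕ q))
        row rewrite toℕ-inr q | dec-false (m ℕ.+ toℕ q ℕₚ.<? m) (ℕₚ.≤⇒≯ (ℕₚ.m≤m+n m (toℕ q)))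
                  | ℕₚ.m+n∸m≡n m (toℕ q) = ≡.refl

      double-half : ∀ n → double ⌊ n /2⌋ ℕ.≤ n
      double-half zero          = ℕ.z≤n
      double-half (suc zero)    = ℕ.z≤n
      double-half (suc (suc n)) = ℕ.s≤s (ℕ.s≤s (double-half n))

      nonsingular : IsTree T → Duarte A ⊤ w → Nonsingular J
      nonsingular tree duarte detJ≈0 with singular⇒leftKernel J detJ≈0
      ... | v , (l , vl≉0) , vJ≋0 = vl≉0 (vanish (cover l))
        where
        -- The weights are absorbed into the coefficients; the common factor -2 of all Jacobian
        -- entries is cancelled in `kernel`.
        a : Fin m → Carrier
        a p = v (inl p) * weight (toℕ p)
        b : Fin m′ → Carrier
        b q = v (inr q) * weight (toℕ q)

        2≤n : ∀ {r} → Fin r → 2 ℕ.≤ suc r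
        2≤n {suc r} _ = ℕ.s≤s (ℕ.s≤s ℕ.z≤n)

        kernel : ∀ e → oddPolynomial a A (lo e) (hi e) + oddPolynomial b B (lo e) (hi e) ≈ 0#
        kernel e = zero-product (λ -2≈0 → pos⇒≉0 (+-pos 0<1 0<1)
            (trans (solve 1 (λ x → x := :- (:- x)) refl (1# + 1#)) (trans (-‿cong -2≈0) -0#≈0#)))
          (trans (distribˡ (- (1# + 1#)) (oddPolynomial a A (lo e) (hi e)) (oddPolynomial b B (lo e) (hi e)))
          (trans (+-cong
            (pull A a (v ∘ inl) (λ p → J (inl p) e) (λ _ → refl) (λ p → J-inl p e))
            (pull B b (v ∘ inr) (λ q → J (inr q) e) (λ _ → refl) (λ q → J-inr q e)))
          (trans (sym (sum-split (λ l → v l * J l e))) (vJ≋0 e))))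
          where
          pull : ∀ {d} C (a v : Fin d → Carrier) (j : Fin d → Carrier) →
            (∀ p → a p ≈ v p * weight (toℕ p)) →
            (∀ p → j p ≈ - (1# + 1#) * (weight (toℕ p) * power C (suc (double (toℕ p))) (lo e) (hi e))) →
            - (1# + 1#) * oddPolynomial a C (lo e) (hi e) ≈ sum (λ p → v p * j p)
          pull C a v j a≈ j≈ = trans
            (*-distribˡ-sum (- (1# + 1#)) (λ p → a p * power C (suc (double (toℕ p))) (lo e) (hi e)))
            (sum-cong-≋ λ p → trans (*-congˡ (*-congʳ (a≈ p))) (trans
              (solve 4 (λ t v w x → t :* (v :* w :* x) := v :* (t :* (w :* x))) refl
                (- (1# + 1#)) (v p) (weight (toℕ p)) (power C (suc (double (toℕ p))) (lo e) (hi e)))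
              (*-congˡ (sym (j≈ p)))))

        edge : ∀ {i j} → i Fin.< j → Adj (graphOf A) i j → oddPolynomial a A i j + oddPolynomial b B i j ≈ 0#
        edge {i} {j} i<j ij
          with e , (≡.refl , ≡.refl) , _ ← complete i<j (Equivalence.to (proj₂ A∈S⁻ i j) ij) = kernel e

        coefficients : a ≋ 𝟘 × b ≋ 𝟘
        coefficients = oddPolynomials-independent A skew
          (λ u v → Star.map (λ {i} {j} → Equivalence.from (proj₂ A∈S⁻ i j)) (IsTree.connected tree u v))
          (λ c (injective , path , back) → IsTree.acyclic tree c
            (injective , (λ i → Equivalence.to (proj₂ A∈S⁻ _ _) (path i)) ,
             Equivalence.to (proj₂ A∈S⁻ _ _) back))
          -- The row index `l` is also an element of the edge index set, so `r` is positive and the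
          -- tree has at least two vertices. The two bounds from `double-half` are the degree counts
          -- for p and q.
          w a b (2≤n l) duarte (double-half (suc r)) (ℕ.s≤s (double-half r)) edge

        vanish : (∃[ p ] l ≡ inl p) ⊎ (∃[ q ] l ≡ inr q) → v l ≈ 0#
        vanish (inj₁ (p , ≡.refl)) =
          zero-product (weight≉0 (toℕ p)) (trans (*-comm _ _) (proj₁ coefficients p))
        vanish (inj₂ (q , ≡.refl)) =
          zero-product (weight≉0 (toℕ q)) (trans (*-comm _ _) (proj₂ coefficients q))

theorem4p6 : ∀ {c ℓ₁ ℓ₂ g} (ℝ : CompleteOrderedField c ℓ₁ ℓ₂) →
    let open OverReals ℝ in
    (r : ℕ) (T : Graph (suc r) g) → IsTree T → NEB T ⊤ (fromℕ r) →
    (E : EdgeEnumeration T r) (A : Matrix (suc r)) → S⁻ T A →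
    Duarte A ⊤ (fromℕ r) →
    ∃[ J ] (IsJacobian (treeMap E) (edgeEntries E A) J × Nonsingular J)
theorem4p6 ℝ r T tree _ E A A∈S⁻ duarte =
  jacobian E (edgeEntries E A) , isJacobian E (edgeEntries E A) , nonsingular E A A∈S⁻ tree duarte
  where
  open OverReals ℝ using (edgeEntries)
  open TreeMapJacobian ℝ
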